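{- The unit-distance graph $H(3,3)$ admits faithful planar realizations whose coordinate fields realize each tier of the constructibility hierarchy. Precisely, there are faithful realizations of $H(3,3)$ in $\mathbb{R}^2$, each a Minkowski realization with some base angle $\alpha$, such that: (1) (ruler and compass) one has coordinate field $\mathbb{Q}(\sqrt2,\sqrt3)$, of degree $4$ over $\mathbb{Q}$; (2) (origami) one has coordinate field $\mathbb{Q}(\sin 20^\circ)$, of degree $6$ over $\mathbb{Q}$; (3) (exotic) one has as coordinate field a number field $K$ of the exotic tier with $K\supseteq\mathbb{Q}(\cos\tfrac{2\pi}{11})$, where $[\mathbb{Q}(\cos\tfrac{2\pi}{11}):\mathbb{Q}]=5$. The corresponding base polynomials (in $y=2\cos\alpha$) are respectively $y^2-2$, $\;y^3-3y-1$, and $\;y^5+y^4-4y^3-3y^2+3y+1$, for the base angles $\alpha=45^\circ$, $\alpha=20^\circ$, $\alpha=\tfrac{2\pi}{11}$.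
   Context: $H(3,3)=K_3\square K_3\square K_3$ is the graph on $\{0,1,2\}^3$ with two words adjacent iff they differ in exactly one coordinate ($27$ vertices, $81$ edges). A faithful (unit-distance) realization of a graph $G=(V,E)$ in $\mathbb{R}^k$ is an injective map $p:V\to\mathbb{R}^k$ with $\|p(u)-p(v)\|=1$ if and only if $uv\in E$. The coordinate field of a realization is the subfield $K$ of $\mathbb{R}$ generated over $\mathbb{Q}$ by all coordinates of all vertices. When $K$ is a number field, its tier is: ruler-and-compass if $[K:\mathbb{Q}]=2^a$; origami if $[K:\mathbb{Q}]=2^a3^b$ (origami but not ruler-and-compass when $b\ge 1$); exotic if a prime $\ge5$ divides $[K:\mathbb{Q}]$. Minkowski realization with base angle $\alpha$: let $R=1/\sqrt3$, and for $\beta\in\{0,\alpha,2\alpha\}$ let $T_\beta[k]=R(\cos(\beta+120^\circ k),\sin(\beta+120^\circ k))$, $k=0,1,2$, be the vertices of a unit equilateral triangle. The vertex $(a,b,c)$ is placed at $P(a,b,c)=T_0[a]+T_\alpha[b]+T_{2\alpha}[c]$. The base polynomial is the minimal polynomial over $\mathbb{Q}$ of $y=2\cos\alpha$. -}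

module Defs where

open import Algebra.Apartness.Bundles using (HeytingField; HeytingCommutativeRing)
open import Algebra.Bundles using (CommutativeRing; Semiring)
import Algebra.Definitions.RawSemiring as RawSemiringOps
open import Data.Fin.Base using (Fin; zero; suc; toℕ)
open import Data.Integer.Base as ℤ using (ℤ; +_; -[1+_])
open import Data.List.Base using (List; []; _∷_; length; last; map)
open import Data.Maybe.Base using (just)
open import Data.Nat.Base as ℕ using (ℕ; zero; suc; _!; _≤_)
open import Data.Nat.Divisibility using (_∣_)
open import Data.Nat.Primality using (Prime)
open import Data.Nat.Properties using (_!≢0)
open import Data.Product.Base using (∃; ∃₂; ∃-syntax; _×_; _,_; proj₁)
open import Data.Rational.Base as ℚ using (ℚ; 0ℚ; 1ℚ)
open import Data.Sum.Base using (_⊎_; inj₁; inj₂)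
open import Data.Vec.Base as Vec using (Vec; []; _∷_; lookup)
open import Data.Vec.Functional using (Vector)
open import Function.Bundles using (_⇔_; Equivalence)
open import Function.Definitions using (Injective)
open import Level using (Level; _⊔_) renaming (suc to lsuc)
open import Relation.Binary.Core using (Rel)
open import Relation.Binary.Structures using (IsStrictPartialOrder)
open import Relation.Binary.PropositionalEquality.Core using (_≡_; _≢_; refl; sym)
open import Relation.Nullary.Negation using (¬_)
open import Relation.Unary using (Pred; _∈_)

------------------------------------------------------------------------
-- Real numbers
--
-- Cauchy-complete Archimedean ordered fields.  Classically ℝ is, up to
-- isomorphism, the only one.  The axioms are phrased constructively (an
-- apartness instead of decidable equality), so that Bishop's reals, too,
-- form a model.

record RealNumbers c ℓ₁ ℓ₂ : Set (lsuc (c ⊔ ℓ₁ ⊔ ℓ₂)) where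
  infix 4 _<_ _≤ᵣ_ _⟶_

  field
    heytingField : HeytingField c ℓ₁ ℓ₂

  open HeytingField heytingField public

  commutativeRing : CommutativeRing c ℓ₁
  commutativeRing = HeytingCommutativeRing.commutativeRing heytingCommutativeRing

  open RawSemiringOps (Semiring.rawSemiring (CommutativeRing.semiring commutativeRing)) public
    using (_^_; sum) renaming (_×_ to _×ᵣ_)

  fromℕ : ℕ → Carrier
  fromℕ n = n ×ᵣ 1#

  field
    _<_                  : Rel Carrier ℓ₂
    isStrictPartialOrder : IsStrictPartialOrder _≈_ _<_
    #⇔<⊎>                : ∀ {x y} → x # y ⇔ (x < y ⊎ y < x)
    0<1                  : 0# < 1#
    +-monoʳ-<            : ∀ z {x y} → x < y → z + x < z + y
    *-pos                : ∀ {x y} → 0# < x → 0# < y → 0# < x * y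
    archimedean          : ∀ x → ∃[ n ] x < fromℕ n

  _≤ᵣ_ : Rel Carrier ℓ₂
  x ≤ᵣ y = ¬ (y < x)

  -- Exchanging m and n turns the bound on s m - s n into one on ∣ s m - s n ∣.
  IsCauchy : (ℕ → Carrier) → Set (c ⊔ ℓ₂)
  IsCauchy s = ∀ ε → 0# < ε → ∃[ N ] ∀ m n → N ≤ m → N ≤ n → s m - s n < ε

  _⟶_ : (ℕ → Carrier) → Carrier → Set (c ⊔ ℓ₂)
  s ⟶ l = ∀ ε → 0# < ε → ∃[ N ] ∀ n → N ≤ n → (s n - l < ε) × (l - s n < ε)

  field
    complete : ∀ s → IsCauchy s → ∃[ l ] s ⟶ l

  private
    module < = IsStrictPartialOrder isStrictPartialOrder
    module CR = CommutativeRing commutativeRing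

  fromℕ-pos : ∀ n → 0# < fromℕ (suc n)
  fromℕ-pos zero    = <.<-respʳ-≈ (CR.sym (CR.+-identityʳ 1#)) 0<1
  fromℕ-pos (suc n) = <.trans 0<1
    (<.<-respˡ-≈ (CR.+-identityʳ 1#) (+-monoʳ-< 1# (fromℕ-pos n)))

  -- #⇒invertible inverts differences, here fromℕ (suc n) - 0#.
  1/suc : ℕ → Carrier
  1/suc n = proj₁ (#⇒invertible (Equivalence.from #⇔<⊎> (inj₂ (fromℕ-pos n))))

  fromℤ : ℤ → Carrier
  fromℤ (+ n)    = fromℕ n
  fromℤ -[1+ n ] = - fromℕ (suc n)

  fromℚ : ℚ → Carrier
  fromℚ q = fromℤ (ℚ.numerator q) * 1/suc (ℚ.denominator-1 q)

  infixr 7 _·_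
  _·_ : ℚ → Carrier → Carrier
  q · x = fromℚ q * x

  Sqrt : Carrier → Carrier → Set (ℓ₁ ⊔ ℓ₂)
  Sqrt x s = (0# ≤ᵣ s) × (s * s ≈ x)

  infix 4 ‖_‖≈_
  ‖_‖≈_ : ∀ {k} → Vector Carrier k → Carrier → Set (ℓ₁ ⊔ ℓ₂)
  ‖ x ‖≈ r = Sqrt (sum λ i → x i * x i) r

module PowerSeries {c ℓ₁ ℓ₂} (ℛ : RealNumbers c ℓ₁ ℓ₂) where
  open RealNumbers ℛ

  alternatingTerm : Carrier → (sign exponent : ℕ) → Carrier
  alternatingTerm x k n =
    (((ℤ.- (+ 1)) ℤ.^ k) ℚ./ (n !)) {{n !≢0}} · (x ^ n)

  cosPartial sinPartial : Carrier → ℕ → Carrier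
  cosPartial x n = sum {n} λ k → alternatingTerm x (toℕ k) (2 ℕ.* toℕ k)
  sinPartial x n = sum {n} λ k → alternatingTerm x (toℕ k) (suc (2 ℕ.* toℕ k))

-- All three are determined by the fields: cos and sin are the sums of their
-- power series (limits are unique), and π is the first
-- positive zero of sin.
record Trigonometry {c ℓ₁ ℓ₂} (ℛ : RealNumbers c ℓ₁ ℓ₂) : Set (c ⊔ ℓ₁ ⊔ ℓ₂) where
  open RealNumbers ℛ
  open PowerSeries ℛ

  field
    cos sin    : Carrier → Carrier
    cos-series : ∀ x → cosPartial x ⟶ cos x
    sin-series : ∀ x → sinPartial x ⟶ sin x
    π          : Carrier
    0<π        : 0# < π
    sin-π      : sin π ≈ 0#
    sin-pos    : ∀ x → 0# < x → x < π → 0# < sin x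

  infix 8 _°
  _° : ℕ → Carrier
  d ° = (+ d ℚ./ 180) · π

------------------------------------------------------------------------
-- Graphs

record Graph : Set₁ where
  field
    Vertex : Set
    Adj    : Rel Vertex _
    symm   : ∀ {u v} → Adj u v → Adj v u
    irrefl : ∀ {u} → ¬ Adj u u

DifferOnce : ∀ {d q} → Rel (Vec (Fin q) d) _
DifferOnce u v = ∃[ i ] (lookup u i ≢ lookup v i × (∀ j → j ≢ i → lookup u j ≡ lookup v j))

H : (d q : ℕ) → Graph
H d q = record
  { Vertex = Vec (Fin q) d
  ; Adj    = DifferOnce
  ; symm   = λ (i , ≢ , ≡s) → i , (λ eq → ≢ (sym eq)) , (λ j j≢i → sym (≡s j j≢i))
  ; irrefl = λ (i , ≢ , _) → ≢ refl
  }

------------------------------------------------------------------------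
-- Subfields, degrees, minimal polynomials

module Fields {c ℓ₁ ℓ₂} (ℛ : RealNumbers c ℓ₁ ℓ₂) where
  open RealNumbers ℛ

  private
    variable
      s : Level

  -- Every subfield contains the prime field ℚ.
  data ℚ⟨_⟩ (S : Pred Carrier s) : Pred Carrier (c ⊔ ℓ₁ ⊔ s) where
    gen  : ∀ {x} → x ∈ S → x ∈ ℚ⟨ S ⟩
    resp : ∀ {x y} → x ≈ y → x ∈ ℚ⟨ S ⟩ → y ∈ ℚ⟨ S ⟩
    zer  : 0# ∈ ℚ⟨ S ⟩
    one  : 1# ∈ ℚ⟨ S ⟩
    add  : ∀ {x y} → x ∈ ℚ⟨ S ⟩ → y ∈ ℚ⟨ S ⟩ → x + y ∈ ℚ⟨ S ⟩
    neg  : ∀ {x} → x ∈ ℚ⟨ S ⟩ → - x ∈ ℚ⟨ S ⟩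
    mul  : ∀ {x y} → x ∈ ℚ⟨ S ⟩ → y ∈ ℚ⟨ S ⟩ → x * y ∈ ℚ⟨ S ⟩
    inv  : ∀ {x y} → x ∈ ℚ⟨ S ⟩ → x * y ≈ 1# → y ∈ ℚ⟨ S ⟩

  combination : ∀ {n} → Vector ℚ n → Vector Carrier n → Carrier
  combination q b = sum λ i → q i · b i

  record Basis (K : Pred Carrier s) (n : ℕ) : Set (c ⊔ ℓ₁ ⊔ s) where
    field
      vec         : Vector Carrier n
      vec∈K       : ∀ i → vec i ∈ K
      independent : ∀ q → combination q vec ≈ 0# → ∀ i → q i ≡ 0ℚ
      spanning    : ∀ x → x ∈ K → ∃[ q ] x ≈ combination q vec

  infix 4 [_:ℚ]≡_
  [_:ℚ]≡_ : Pred Carrier s → ℕ → Set _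
  [ K :ℚ]≡ n = Basis K n

  RulerAndCompass : Pred Carrier s → Set _
  RulerAndCompass K = ∃[ a ] [ K :ℚ]≡ 2 ℕ.^ a

  -- Origami but not ruler-and-compass.
  StrictlyOrigami : Pred Carrier s → Set _
  StrictlyOrigami K = ∃₂ λ a b → 1 ≤ b × [ K :ℚ]≡ 2 ℕ.^ a ℕ.* 3 ℕ.^ b

  Exotic : Pred Carrier s → Set _
  Exotic K = ∃[ n ] [ K :ℚ]≡ n × ∃[ p ] Prime p × 5 ≤ p × p ∣ n

  -- Polynomials over ℚ are lists of coefficients, constant term first.
  eval : List ℚ → Carrier → Carrier
  eval []      y = 0#
  eval (a ∷ f) y = fromℚ a + y * eval f y

  Monic : List ℚ → Set
  Monic f = last f ≡ just 1ℚ

  record IsMinimalPolynomial (f : List ℚ) (y : Carrier) : Set ℓ₁ where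
    field
      monic : Monic f
      root  : eval f y ≈ 0#
      least : ∀ g → Monic g → eval g y ≈ 0# → length f ≤ length g

  poly : List ℤ → List ℚ
  poly = map (λ a → a ℚ./ 1)

------------------------------------------------------------------------
-- Realizations

module Realizations {c ℓ₁ ℓ₂} {ℛ : RealNumbers c ℓ₁ ℓ₂} (𝒯 : Trigonometry ℛ) where
  open RealNumbers ℛ public
  open Trigonometry 𝒯 public
  open Fields ℛ public
  open Graph

  record IsFaithful (G : Graph) {k : ℕ} (p : Vertex G → Vector Carrier k)
         : Set (ℓ₁ ⊔ ℓ₂) where
    field
      injective    : Injective _≡_ (λ x y → ∀ i → x i ≈ y i) p
      unitDistance : ∀ u v → (‖ (λ i → p u i - p v i) ‖≈ 1#) ⇔ Adj G u v

  coordinateField : ∀ {V : Set} {k} → (V → Vector Carrier k) → Pred Carrier (c ⊔ ℓ₁)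
  coordinateField p = ℚ⟨ (λ x → ∃₂ λ v i → x ≈ p v i) ⟩

  -- T R β is the triangle T_β; its circumradius R is passed explicitly.
  T : Carrier → Carrier → Fin 3 → Vector Carrier 2
  T R β k zero       = R * cos (β + (120 ℕ.* toℕ k) °)
  T R β k (suc zero) = R * sin (β + (120 ℕ.* toℕ k) °)

  minkowski : (R α : Carrier) → Vertex (H 3 3) → Vector Carrier 2
  minkowski R α (a ∷ b ∷ c ∷ []) i = T R 0# a i + T R α b i + T R (α + α) c i

  record IsMinkowski (α : Carrier) (p : Vertex (H 3 3) → Vector Carrier 2)
         : Set (c ⊔ ℓ₁ ⊔ ℓ₂) where
    field
      √3 R      : Carrier
      √3-sqrt   : Sqrt (fromℕ 3) √3
      R≈1/√3    : R * √3 ≈ 1#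
      placement : ∀ v i → p v i ≈ minkowski R α v i

  ℚ⟨√2,√3⟩ : Pred Carrier _
  ℚ⟨√2,√3⟩ = ℚ⟨ (λ x → Sqrt (fromℕ 2) x ⊎ Sqrt (fromℕ 3) x) ⟩

  ℚ⟨_⟩₁ : Carrier → Pred Carrier _
  ℚ⟨ x ⟩₁ = ℚ⟨ (_≈ x) ⟩

  baseElement : Carrier → Carrier
  baseElement α = fromℕ 2 * cos α

-- The trigonometric functions are only known through their power series.  Comparing the square and
-- triangular partial sums of a product of two exponential series gives the addition formulas, and
-- with sin > 0 on (0, π) these determine 2 cos and 2 sin at the special angles as explicit roots of
-- integral polynomials.
--
-- Write y = 2 cos α, θ = 2 sin α, and y′, θ′ for the same at 2α.  The squared distance of two vertices
-- of the Minkowski realization is their Hamming distance plus a rational combination of y, √3 θ, y′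
-- and √3 θ′.  Hence the realization is faithful as soon as no such combination is a nonzero rational,
-- and its coordinate field is ℚ(√3, y, θ).
--
-- All linear independence needed comes from Eisenstein polynomials: for 2 cos 15° - 1 at 2, for
-- 2 sin 20° and 2 cos 20° - 1 at 3, for 2 cos (2π/11) - 2 at 11, and for θ = 2 sin (2π/11), of degree
-- 10, at the prime 1 + 2√3 of ℤ[√3] above 11.  Instead of factoring polynomials, a relation between
-- the powers of t is divided by the prime until its constant term is a unit; multiplying it by the
-- powers of t then gives a matrix, triangular modulo the prime, that annihilates (1, t, t², …).
-- Inverses stay in the span of these powers because n + 1 vectors of ℚⁿ are dependent.

module Submission where

open import Defs
open import Algebra.Bundles using (CommutativeRing)
import Algebra.Properties.CommutativeMonoid.Sum as SumProperties
import Algebra.Properties.CommutativeSemigroup as CommutativeSemigroupProperties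
import Algebra.Properties.Ring as RingProperties
import Algebra.Properties.Semiring.Mult as SemiringMult
import Algebra.Properties.Semiring.Sum as SemiringSum
import Algebra.Solver.Ring as RingSolver
import Algebra.Solver.Ring.AlmostCommutativeRing as ACR
open import Data.Empty using (⊥-elim)
open import Data.Fin.Base using (Fin; toℕ; punchIn) renaming (zero to fzero; suc to fsuc)
open import Data.Fin.Patterns using (0F; 1F; 2F)
open import Data.Fin.Properties as Fin using (any?; toℕ<n)
open import Data.Integer.Base as ℤ using (ℤ; +_; -[1+_])
open import Data.Integer.Divisibility.Signed using (_∣_; divides; _∣?_; ∣⇒∣ᵤ; ∣ᵤ⇒∣; ∣m∣n⇒∣m+n)
import Data.Integer.Properties as ℤ
import Data.Integer.Solver as ℤSolver
open import Data.List.Base using (List; []; _∷_; applyUpTo; length; map)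
open import Data.List.Properties using (length-applyUpTo)
open import Data.Maybe.Base using (Maybe; just; nothing)
open import Data.Nat.Base as ℕ using (ℕ; zero; suc; _!; z≤n; s≤s)
import Data.Nat.Divisibility as ℕ
open import Data.Nat.Primality using (Prime; euclidsLemma; prime?; prime⇒nonZero; prime⇒nonTrivial)
import Data.Nat.Properties as ℕ
import Data.Nat.Solver as ℕSolver
open import Data.Product.Base using (∃; ∃-syntax; Σ-syntax; _×_; _,_; proj₁; proj₂)
open import Data.Rational.Base as ℚ using (ℚ; 0ℚ; 1ℚ; _/_)
import Data.Rational.Properties as ℚ
open import Data.Rational.Unnormalised.Base as ℚᵘ using (mkℚᵘ; *≡*)
open import Data.Sum.Base using (_⊎_; inj₁; inj₂; [_,_]′)
open import Data.Vec.Base using (Vec; []; _∷_; lookup)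
open import Data.Vec.Functional using (Vector; insertAt)
open import Data.Vec.Functional.Properties using (insertAt-lookup; insertAt-punchIn)
open import Function.Base using (_∘_; _$_)
open import Function.Bundles using (Equivalence; mk⇔)
open import Level using (_⊔_) renaming (suc to lsuc)
import Relation.Binary.Reasoning.Setoid as SetoidReasoning
open import Relation.Binary.PropositionalEquality.Core as ≡ using (_≡_; _≢_)
open import Relation.Binary.Structures using (IsStrictPartialOrder)
open import Relation.Nullary.Decidable using (Dec; yes; no; ¬?; decidable-stable; from-yes; from-no)
open import Relation.Nullary.Negation using (¬_)
open import Relation.Unary using (Pred; _∈_; _⊆_; _≐_)

-- Equality of reals is undecidable but stable under double negation, so equations may be proved by
-- cases and cancelled by factors merely known to be nonzero; decisions (pivots, divisibility) are
-- made in ℚ or ℤ only. Signs of cosines are not given: each choice of a root is forced by the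
-- positivity of sines.
--
-- Linear independence of 1, y, √3θ, y′, √3θ′ fails: y′ = 0 at 45°, and √3θ = 2y′ - y at 20°. What
-- survives is that a vanishing integer combination has constant term 0, and this recovers the
-- Hamming distance from a distance 0 or 1.
--
-- At 2π/11 it has to be excluded that √3 lies in ℚ(θ), which no criterion over ℤ for the powers of
-- θ alone can do. As 11 is unramified in ℤ[√3], the polynomial of θ stays Eisenstein at a prime
-- above 11, which gives independence over ℤ[√3] and degree 2 · 10. The subtracted constants 1 and 2
-- are the residues of the numbers at a totally ramified prime; thus 2 cos (2π/11) has residue 2
-- because 11th roots of unity become 1.

-- Integers and rationals inside the reals, and cancellation.

module Arithmetic {c ℓ₁ ℓ₂} (ℛ : RealNumbers c ℓ₁ ℓ₂) where
  open RealNumbers ℛ hiding (zero)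
  private module CR = CommutativeRing commutativeRing
  open RingProperties CR.ring public
    using (-0#≈0#; -‿distribˡ-*; -‿distribʳ-*; -‿involutive; -‿+-comm)
  open SemiringMult CR.semiring public using (×-homo-+; ×1-homo-*)
  open CommutativeSemigroupProperties CR.*-commutativeSemigroup public using (x∙yz≈y∙xz; interchange)
  open SetoidReasoning CR.setoid

  fromℤ-neg : ∀ i → fromℤ (ℤ.- i) ≈ - fromℤ i
  fromℤ-neg (+ zero)  = sym -0#≈0#
  fromℤ-neg (+ suc n) = refl
  fromℤ-neg -[1+ n ]  = sym (-‿involutive _)

  fromℤ-⊖ : ∀ m n → fromℤ (m ℤ.⊖ n) ≈ fromℕ m - fromℕ n
  fromℤ-⊖ m zero = begin
    fromℕ m            ≈⟨ +-identityʳ _ ⟨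
    fromℕ m + 0#       ≈⟨ +-congˡ -0#≈0# ⟨
    fromℕ m - fromℕ 0  ∎
  fromℤ-⊖ zero (suc n) = sym (+-identityˡ _)
  fromℤ-⊖ (suc m) (suc n) = begin
    fromℤ (suc m ℤ.⊖ suc n)            ≡⟨ ≡.cong fromℤ (ℤ.[1+m]⊖[1+n]≡m⊖n m n) ⟩
    fromℤ (m ℤ.⊖ n)                    ≈⟨ fromℤ-⊖ m n ⟩
    fromℕ m - fromℕ n                  ≈⟨ +-congʳ (+-identityˡ _) ⟨
    0# + fromℕ m - fromℕ n             ≈⟨ +-congʳ (+-congʳ (-‿inverseʳ 1#)) ⟨
    1# - 1# + fromℕ m - fromℕ n        ≈⟨ +-congʳ (+-assoc _ _ _) ⟩
    1# + (- 1# + fromℕ m) - fromℕ n    ≈⟨ +-congʳ (+-congˡ (+-comm _ _)) ⟩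
    1# + (fromℕ m - 1#) - fromℕ n      ≈⟨ +-congʳ (+-assoc _ _ _) ⟨
    fromℕ (suc m) - 1# - fromℕ n       ≈⟨ +-assoc _ _ _ ⟩
    fromℕ (suc m) + (- 1# - fromℕ n)   ≈⟨ +-congˡ (-‿+-comm _ _) ⟩
    fromℕ (suc m) - fromℕ (suc n)      ∎

  fromℤ-+ : ∀ i j → fromℤ (i ℤ.+ j) ≈ fromℤ i + fromℤ j
  fromℤ-+ (+ m)    (+ n)    = ×-homo-+ 1# m n
  fromℤ-+ (+ m)    -[1+ n ] = fromℤ-⊖ m (suc n)
  fromℤ-+ -[1+ m ] (+ n)    = trans (fromℤ-⊖ n (suc m)) (+-comm _ _)
  fromℤ-+ -[1+ m ] -[1+ n ] = begin
    - fromℕ (suc (suc (m ℕ.+ n)))        ≡⟨ ≡.cong (λ k → - fromℕ (suc k)) (ℕ.+-suc m n) ⟨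
    - fromℕ (suc m ℕ.+ suc n)            ≈⟨ -‿cong (×-homo-+ 1# (suc m) (suc n)) ⟩
    - (fromℕ (suc m) + fromℕ (suc n))    ≈⟨ -‿+-comm _ _ ⟨
    - fromℕ (suc m) - fromℕ (suc n)      ∎

  private
    fromℤ-*⁺ : ∀ m n → fromℤ (+ m ℤ.* + n) ≈ fromℤ (+ m) * fromℤ (+ n)
    fromℤ-*⁺ m n = trans (reflexive (≡.cong fromℤ (≡.sym (ℤ.pos-* m n)))) (×1-homo-* m n)

    fromℤ-*⁺ʳ : ∀ m j → fromℤ (+ m ℤ.* j) ≈ fromℤ (+ m) * fromℤ j
    fromℤ-*⁺ʳ m (+ n)    = fromℤ-*⁺ m n
    fromℤ-*⁺ʳ m -[1+ n ] = begin
      fromℤ (+ m ℤ.* -[1+ n ])            ≡⟨ ≡.cong fromℤ (ℤ.neg-distribʳ-* (+ m) (+ suc n)) ⟨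
      fromℤ (ℤ.- (+ m ℤ.* + suc n))       ≈⟨ fromℤ-neg (+ m ℤ.* + suc n) ⟩
      - fromℤ (+ m ℤ.* + suc n)           ≈⟨ -‿cong (fromℤ-*⁺ m (suc n)) ⟩
      - (fromℕ m * fromℕ (suc n))         ≈⟨ -‿distribʳ-* _ _ ⟩
      fromℕ m * - fromℕ (suc n)           ∎

  fromℤ-* : ∀ i j → fromℤ (i ℤ.* j) ≈ fromℤ i * fromℤ j
  fromℤ-* (+ m)    j = fromℤ-*⁺ʳ m j
  fromℤ-* -[1+ m ] j = begin
    fromℤ (-[1+ m ] ℤ.* j)         ≡⟨ ≡.cong fromℤ (ℤ.neg-distribˡ-* (+ suc m) j) ⟨
    fromℤ (ℤ.- (+ suc m ℤ.* j))    ≈⟨ fromℤ-neg (+ suc m ℤ.* j) ⟩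
    - fromℤ (+ suc m ℤ.* j)        ≈⟨ -‿cong (fromℤ-*⁺ʳ (suc m) j) ⟩
    - (fromℕ (suc m) * fromℤ j)    ≈⟨ -‿distribˡ-* _ _ ⟩
    - fromℕ (suc m) * fromℤ j      ∎

  private
    target = ACR.fromCommutativeRing commutativeRing

    morphism : ACR._-Raw-AlmostCommutative⟶_ (CommutativeRing.rawRing ℤ.+-*-commutativeRing) target
    morphism = record
      { ⟦_⟧ = fromℤ
      ; +-homo = fromℤ-+
      ; *-homo = fromℤ-*
      ; -‿homo = fromℤ-neg
      ; 0-homo = refl
      ; 1-homo = +-identityʳ 1#
      }

    coeff≟ : ∀ i j → Maybe (fromℤ i ≈ fromℤ j)
    coeff≟ i j with i ℤ.≟ j
    ... | yes ≡.refl = just refl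
    ... | no _       = nothing

  module Solver = RingSolver _ target morphism coeff≟

  open Solver public using (solve; con; _:=_; _:+_; _:*_; _:-_; :-_; _:^_)

  -- The solver interprets the constant 1 as `fromℕ 1`, which unfolds to `1# + 0#`; this translates
  -- wherever `1#` itself occurs in a goal.
  1≈ : fromℕ 1 ≈ 1#
  1≈ = +-identityʳ 1#

  private module < = IsStrictPartialOrder isStrictPartialOrder

  <-trans : ∀ {x y z} → x < y → y < z → x < z
  <-trans = <.trans

  <-irrefl : ∀ {x} → ¬ (x < x)
  <-irrefl = <.irrefl refl

  <-resp : ∀ {x x′ y y′} → x ≈ x′ → y ≈ y′ → x < y → x′ < y′
  <-resp p q = <.<-respˡ-≈ p ∘ <.<-respʳ-≈ q

  <⇒# : ∀ {x y} → x < y → x # y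
  <⇒# = Equivalence.from #⇔<⊎> ∘ inj₁

  >⇒# : ∀ {x y} → y < x → x # y
  >⇒# = Equivalence.from #⇔<⊎> ∘ inj₂

  -- The constructive remainder of trichotomy. Cotransitivity of apartness only says that z is apart
  -- from x or from y; where z lies outside the interval, transitivity settles the answer.
  <-cotrans : ∀ {x y} → x < y → ∀ z → x < z ⊎ z < y
  <-cotrans x<y z with #-cotrans (<⇒# x<y) z
  ... | inj₁ x#z with Equivalence.to #⇔<⊎> x#z
  ...   | inj₁ x<z = inj₁ x<z
  ...   | inj₂ z<x = inj₂ (<-trans z<x x<y)
  <-cotrans x<y z | inj₂ z#y with Equivalence.to #⇔<⊎> z#y
  ...   | inj₁ z<y = inj₂ z<y
  ...   | inj₂ y<z = inj₁ (<-trans x<y y<z)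

  -- By tightness equality is the negation of apartness, and negations are stable. Classical case
  -- distinctions are therefore allowed whenever the goal is an equation.
  ≈-stable : ∀ {x y} → ¬ ¬ (x ≈ y) → x ≈ y
  ≈-stable ¬¬x≈y = proj₁ (tight _ _) (λ x#y → ¬¬x≈y (λ x≈y → proj₂ (tight _ _) x≈y x#y))

  ¬≮⇒≈ : ∀ {x y} → ¬ (x < y) → ¬ (y < x) → x ≈ y
  ¬≮⇒≈ x≮y y≮x = proj₁ (tight _ _) λ x#y → [ x≮y , y≮x ]′ (Equivalence.to #⇔<⊎> x#y)

  #⇒≉ : ∀ {x y} → x # y → ¬ (x ≈ y)
  #⇒≉ x#y x≈y = proj₂ (tight _ _) x≈y x#y

  #0-inverse : ∀ {x} → x # 0# → ∃[ y ] x * y ≈ 1#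
  #0-inverse {x} x#0 with #⇒invertible x#0
  ... | y , _ , eq = y , trans (*-congʳ (solve 1 (λ x → x := x :- con (+ 0)) refl x)) eq

  #0-cancel : ∀ {x y z} → x # 0# → x * y ≈ x * z → y ≈ z
  #0-cancel {x} {y} {z} x#0 eq with #0-inverse x#0
  ... | w , xw = begin
    y            ≈⟨ *-identityˡ y ⟨
    1# * y       ≈⟨ *-congʳ xw ⟨
    x * w * y    ≈⟨ solve 3 (λ x w y → x :* w :* y := w :* (x :* y)) refl x w y ⟩
    w * (x * y)  ≈⟨ *-congˡ eq ⟩
    w * (x * z)  ≈⟨ solve 3 (λ x w y → w :* (x :* y) := x :* w :* y) refl x w z ⟩
    x * w * z    ≈⟨ *-congʳ xw ⟩
    1# * z       ≈⟨ *-identityˡ z ⟩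
    z            ∎

  -- No inverse of x can be computed from x ≉ 0, but the goal is stable, so x may be assumed apart
  -- from 0.
  ≉0-cancel : ∀ {x y z} → ¬ (x ≈ 0#) → x * y ≈ x * z → y ≈ z
  ≉0-cancel x≉0 eq = ≈-stable λ y≉z →
    x≉0 (proj₁ (tight _ _) λ x#0 → y≉z (#0-cancel x#0 eq))

  integral : ∀ {x y} → ¬ (x ≈ 0#) → x * y ≈ 0# → y ≈ 0#
  integral x≉0 eq = ≉0-cancel x≉0 (trans eq (sym (zeroʳ _)))

  x-y≈0⇒x≈y : ∀ {x y} → x - y ≈ 0# → x ≈ y
  x-y≈0⇒x≈y {x} {y} eq = begin
    x            ≈⟨ solve 2 (λ x y → x := (x :- y) :+ y) refl x y ⟩
    x - y + y    ≈⟨ +-congʳ eq ⟩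
    0# + y       ≈⟨ +-identityˡ y ⟩
    y            ∎

  x≈y⇒x-y≈0 : ∀ {x y} → x ≈ y → x - y ≈ 0#
  x≈y⇒x-y≈0 {x} {y} eq = trans (+-congʳ eq) (-‿inverseʳ y)

  fromℕ-suc#0 : ∀ n → fromℕ (suc n) # 0#
  fromℕ-suc#0 n = >⇒# (fromℕ-pos n)

  fromℕ-*-1/suc : ∀ n → fromℕ (suc n) * 1/suc n ≈ 1#
  fromℕ-*-1/suc n with #⇒invertible (Equivalence.from #⇔<⊎> (inj₂ (fromℕ-pos n)))
  ... | y , _ , eq = trans (*-congʳ (solve 1 (λ x → x := x :- con (+ 0)) refl (fromℕ (suc n)))) eq

  fromℤ-injective₀ : ∀ i → fromℤ i ≈ 0# → i ≡ + 0
  fromℤ-injective₀ (+ zero)  _  = ≡.refl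
  fromℤ-injective₀ (+ suc n) eq = ⊥-elim (#⇒≉ (fromℕ-suc#0 n) eq)
  fromℤ-injective₀ -[1+ n ]  eq = ⊥-elim (#⇒≉ (fromℕ-suc#0 n)
    (trans (sym (-‿involutive _)) (trans (-‿cong eq) -0#≈0#)))

  fromℤ-injective : ∀ i j → fromℤ i ≈ fromℤ j → i ≡ j
  fromℤ-injective i j eq = ℤ.i-j≡0⇒i≡j i j (fromℤ-injective₀ (i ℤ.- j) (begin
    fromℤ (i ℤ.- j)            ≈⟨ fromℤ-+ i (ℤ.- j) ⟩
    fromℤ i + fromℤ (ℤ.- j)    ≈⟨ +-congˡ (fromℤ-neg j) ⟩
    fromℤ i - fromℤ j          ≈⟨ x≈y⇒x-y≈0 eq ⟩
    0#                         ∎))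

  fromℚ-↥ : ∀ q → fromℤ (ℚ.↧ q) * fromℚ q ≈ fromℤ (ℚ.↥ q)
  fromℚ-↥ q@record{} = begin
    fromℤ (ℚ.↧ q) * (fromℤ (ℚ.↥ q) * 1/suc d)
      ≈⟨ solve 3 (λ x y z → x :* (y :* z) := y :* (x :* z)) refl (fromℤ (ℚ.↧ q)) (fromℤ (ℚ.↥ q)) (1/suc d) ⟩
    fromℤ (ℚ.↥ q) * (fromℤ (ℚ.↧ q) * 1/suc d)    ≈⟨ *-congˡ (fromℕ-*-1/suc d) ⟩
    fromℤ (ℚ.↥ q) * 1#                           ≈⟨ *-identityʳ _ ⟩
    fromℤ (ℚ.↥ q)                                ∎
    where d = ℚ.denominator-1 q

  ↧#0 : ∀ q → fromℤ (ℚ.↧ q) # 0#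
  ↧#0 q@record{} = fromℕ-suc#0 (ℚ.denominator-1 q)

  -- Sums and products in ℚ are brought to lowest terms, which hides their numerators. Comparison
  -- with an unnormalised fraction of the same value, by cross-multiplication, avoids the gcd.
  fromℚ-≃ : ∀ q p → ℚ.toℚᵘ q ℚᵘ.≃ p → fromℤ (ℚᵘ.↧ p) * fromℚ q ≈ fromℤ (ℚᵘ.↥ p)
  fromℚ-≃ q@record{} p (*≡* eq) = #0-cancel (↧#0 q) (begin
    ↧q * (↧p * fromℚ q)    ≈⟨ solve 3 (λ x y z → x :* (y :* z) := y :* (x :* z)) refl ↧q ↧p (fromℚ q) ⟩
    ↧p * (↧q * fromℚ q)    ≈⟨ *-congˡ (fromℚ-↥ q) ⟩
    ↧p * fromℤ (ℚ.↥ q)     ≈⟨ *-comm _ _ ⟩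
    fromℤ (ℚ.↥ q) * ↧p     ≈⟨ fromℤ-* (ℚ.↥ q) (ℚᵘ.↧ p) ⟨
    fromℤ (ℚ.↥ q ℤ.* ℚᵘ.↧ p)   ≡⟨ ≡.cong fromℤ eq ⟩
    fromℤ (ℚᵘ.↥ p ℤ.* ℚ.↧ q)   ≈⟨ fromℤ-* (ℚᵘ.↥ p) (ℚ.↧ q) ⟩
    fromℤ (ℚᵘ.↥ p) * ↧q    ≈⟨ *-comm _ _ ⟩
    ↧q * fromℤ (ℚᵘ.↥ p)    ∎)
    where
    ↧q = fromℤ (ℚ.↧ q)
    ↧p = fromℤ (ℚᵘ.↧ p)

  fromℚ-/ : ∀ i n → fromℕ (suc n) * fromℚ (i ℚ./ suc n) ≈ fromℤ i
  fromℚ-/ i n = fromℚ-≃ (i ℚ./ suc n) (mkℚᵘ i n) (ℚ.toℚᵘ-fromℚᵘ (mkℚᵘ i n))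

  private
    ↧↧#0 : ∀ p q → fromℤ (ℚ.↧ p) * fromℤ (ℚ.↧ q) # 0#
    ↧↧#0 p@record{} q@record{} =
      >⇒# (*-pos (fromℕ-pos (ℚ.denominator-1 p)) (fromℕ-pos (ℚ.denominator-1 q)))

    ↧ᵘ-* : ∀ p q → fromℤ (ℚᵘ.↧ (ℚ.toℚᵘ p ℚᵘ.* ℚ.toℚᵘ q)) ≈ fromℤ (ℚ.↧ p) * fromℤ (ℚ.↧ q)
    ↧ᵘ-* p@record{} q@record{} = fromℤ-* (ℚ.↧ p) (ℚ.↧ q)

    ↧ᵘ-+ : ∀ p q → fromℤ (ℚᵘ.↧ (ℚ.toℚᵘ p ℚᵘ.+ ℚ.toℚᵘ q)) ≈ fromℤ (ℚ.↧ p) * fromℤ (ℚ.↧ q)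
    ↧ᵘ-+ p@record{} q@record{} = fromℤ-* (ℚ.↧ p) (ℚ.↧ q)

  fromℚ-+ : ∀ p q → fromℚ (p ℚ.+ q) ≈ fromℚ p + fromℚ q
  fromℚ-+ p@record{} q@record{} = #0-cancel (↧↧#0 p q) (begin
    ↧p * ↧q * fromℚ (p ℚ.+ q)                      ≈⟨ *-congʳ (↧ᵘ-+ p q) ⟨
    fromℤ (ℚᵘ.↧ (ℚ.toℚᵘ p ℚᵘ.+ ℚ.toℚᵘ q)) * fromℚ (p ℚ.+ q) ≈⟨ fromℚ-≃ (p ℚ.+ q) _ (ℚ.toℚᵘ-homo-+ p q) ⟩
    fromℤ (ℚ.↥ p ℤ.* ℚ.↧ q ℤ.+ ℚ.↥ q ℤ.* ℚ.↧ p)    ≈⟨ fromℤ-+ (ℚ.↥ p ℤ.* ℚ.↧ q) (ℚ.↥ q ℤ.* ℚ.↧ p) ⟩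
    fromℤ (ℚ.↥ p ℤ.* ℚ.↧ q) + fromℤ (ℚ.↥ q ℤ.* ℚ.↧ p) ≈⟨ +-cong (fromℤ-* (ℚ.↥ p) (ℚ.↧ q)) (fromℤ-* (ℚ.↥ q) (ℚ.↧ p)) ⟩
    fromℤ (ℚ.↥ p) * ↧q + fromℤ (ℚ.↥ q) * ↧p        ≈⟨ +-cong (*-congʳ (fromℚ-↥ p)) (*-congʳ (fromℚ-↥ q)) ⟨
    ↧p * fromℚ p * ↧q + ↧q * fromℚ q * ↧p
      ≈⟨ solve 4 (λ a b x y → a :* x :* b :+ b :* y :* a := a :* b :* (x :+ y)) refl ↧p ↧q (fromℚ p) (fromℚ q) ⟩
    ↧p * ↧q * (fromℚ p + fromℚ q)                  ∎)
    where
    ↧p = fromℤ (ℚ.↧ p)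
    ↧q = fromℤ (ℚ.↧ q)

  fromℚ-* : ∀ p q → fromℚ (p ℚ.* q) ≈ fromℚ p * fromℚ q
  fromℚ-* p@record{} q@record{} = #0-cancel (↧↧#0 p q) (begin
    ↧p * ↧q * fromℚ (p ℚ.* q)                      ≈⟨ *-congʳ (↧ᵘ-* p q) ⟨
    fromℤ (ℚᵘ.↧ (ℚ.toℚᵘ p ℚᵘ.* ℚ.toℚᵘ q)) * fromℚ (p ℚ.* q) ≈⟨ fromℚ-≃ (p ℚ.* q) _ (ℚ.toℚᵘ-homo-* p q) ⟩
    fromℤ (ℚ.↥ p ℤ.* ℚ.↥ q)                        ≈⟨ fromℤ-* (ℚ.↥ p) (ℚ.↥ q) ⟩
    fromℤ (ℚ.↥ p) * fromℤ (ℚ.↥ q)                  ≈⟨ *-cong (fromℚ-↥ p) (fromℚ-↥ q) ⟨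
    ↧p * fromℚ p * (↧q * fromℚ q)
      ≈⟨ solve 4 (λ a b x y → a :* x :* (b :* y) := a :* b :* (x :* y)) refl ↧p ↧q (fromℚ p) (fromℚ q) ⟩
    ↧p * ↧q * (fromℚ p * fromℚ q)                  ∎)
    where
    ↧p = fromℤ (ℚ.↧ p)
    ↧q = fromℤ (ℚ.↧ q)

  fromℚ-neg : ∀ p → fromℚ (ℚ.- p) ≈ - fromℚ p
  fromℚ-neg p = begin
    fromℚ (ℚ.- p)                        ≈⟨ solve 2 (λ x y → y := :- x :+ (x :+ y)) refl (fromℚ p) (fromℚ (ℚ.- p)) ⟩
    - fromℚ p + (fromℚ p + fromℚ (ℚ.- p))  ≈⟨ +-congˡ (fromℚ-+ p (ℚ.- p)) ⟨
    - fromℚ p + fromℚ (p ℚ.- p)          ≡⟨ ≡.cong (λ q → - fromℚ p + fromℚ q) (ℚ.+-inverseʳ p) ⟩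
    - fromℚ p + fromℚ 0ℚ                 ≈⟨ +-congˡ (zeroˡ _) ⟩
    - fromℚ p + 0#                       ≈⟨ +-identityʳ _ ⟩
    - fromℚ p                            ∎

  fromℚ-0 : fromℚ 0ℚ ≈ 0#
  fromℚ-0 = zeroˡ _

  fromℚ-injective₀ : ∀ q → fromℚ q ≈ 0# → q ≡ 0ℚ
  fromℚ-injective₀ q eq = ℚ.↥p≡0⇒p≡0 q (fromℤ-injective₀ _
    (trans (sym (fromℚ-↥ q)) (trans (*-congˡ eq) (zeroʳ _))))

  fromℚ-/1 : ∀ i → fromℚ (i ℚ./ 1) ≈ fromℤ i
  fromℚ-/1 i = trans (sym (trans (*-congʳ 1≈) (*-identityˡ _))) (fromℚ-/ i 0)

  fromℚ-1 : fromℚ 1ℚ ≈ 1#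
  fromℚ-1 = trans (fromℚ-/1 (+ 1)) 1≈

-- Order, two-sided bounds and null sequences.

module Bounds {c ℓ₁ ℓ₂} (ℛ : RealNumbers c ℓ₁ ℓ₂) where
  open RealNumbers ℛ hiding (zero)
  open Arithmetic ℛ
  open SetoidReasoning (CommutativeRing.setoid commutativeRing)

  <⇒0<- : ∀ {x y} → x < y → 0# < y - x
  <⇒0<- {x} {y} x<y = <-resp (-‿inverseˡ x) (+-comm _ _) (+-monoʳ-< (- x) x<y)

  0<-⇒< : ∀ {x y} → 0# < y - x → x < y
  0<-⇒< {x} {y} p = <-resp (+-identityʳ x) (solve 2 (λ x y → x :+ (y :- x) := y) refl x y) (+-monoʳ-< x p)

  neg-< : ∀ {x} → x < 0# → 0# < - x
  neg-< p = <-resp refl (+-identityˡ _) (<⇒0<- p)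

  neg-<′ : ∀ {x} → 0# < x → - x < 0#
  neg-<′ {x} p = 0<-⇒< (<-resp refl (solve 1 (λ x → x := con (+ 0) :- (:- x)) refl x) p)

  -- Definitionally `0# ≤ᵣ x`, so it serves for `Sqrt`. As a negative statement it may be proved
  -- under double negation.
  0≤_ : Carrier → Set _
  0≤ x = ¬ (x < 0#)

  0≤-resp : ∀ {x y} → x ≈ y → 0≤ x → 0≤ y
  0≤-resp x≈y p = p ∘ <-resp (sym x≈y) refl

  0<⇒0≤ : ∀ {x} → 0# < x → 0≤ x
  0<⇒0≤ p q = <-irrefl (<-trans p q)

  0≤0 : 0≤ 0#
  0≤0 = <-irrefl

  -- Cotransitivity applied to x + y < 0 at the point y yields x < 0 or y < 0.
  0≤-+ : ∀ {x y} → 0≤ x → 0≤ y → 0≤ (x + y)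
  0≤-+ {x} {y} p q r with <-cotrans r y
  ... | inj₁ s = p (<-resp (solve 2 (λ x y → :- y :+ (x :+ y) := x) refl x y) (-‿inverseˡ y) (+-monoʳ-< (- y) s))
  ... | inj₂ s = q s

  -- The goal is a negation, so each factor may be treated as either zero or positive.
  0≤-* : ∀ {x y} → 0≤ x → 0≤ y → 0≤ (x * y)
  0≤-* {x} {y} p q r = p′ λ x≈0 → <-irrefl (<-resp (trans (*-congʳ x≈0) (zeroˡ y)) refl r)
    where
    q′ : 0# < x → ¬ ¬ (y ≈ 0#)
    q′ 0<x y≉0 = y≉0 (¬≮⇒≈ q λ 0<y → 0<⇒0≤ (*-pos 0<x 0<y) r)
    p′ : ¬ ¬ (x ≈ 0#)
    p′ x≉0 = x≉0 (¬≮⇒≈ p λ 0<x → q′ 0<x λ y≈0 → <-irrefl (<-resp (trans (*-congˡ y≈0) (zeroʳ x)) refl r))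

  0≤-*-cancel : ∀ {k x} → 0# < k → 0≤ (k * x) → 0≤ x
  0≤-*-cancel {k} {x} 0<k p x<0 =
    p (<-resp (solve 2 (λ k x → :- (k :* (:- x)) := k :* x) refl k x) refl (neg-<′ (*-pos 0<k (neg-< x<0))))

  0≤-fromℕ : ∀ n → 0≤ fromℕ n
  0≤-fromℕ zero    = 0≤0
  0≤-fromℕ (suc n) = 0<⇒0≤ (fromℕ-pos n)

  0≤-^ : ∀ {x} n → 0≤ x → 0≤ (x ^ n)
  0≤-^ zero    p = 0<⇒0≤ 0<1
  0≤-^ (suc n) p = 0≤-* p (0≤-^ n p)

  fromℕ-mono : ∀ {m n} → m ℕ.≤ n → 0≤ (fromℕ n - fromℕ m)
  fromℕ-mono {m} {n} m≤n = 0≤-resp (begin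
    fromℕ (n ℕ.∸ m)                          ≈⟨ solve 2 (λ d m → d := m :+ d :- m) refl _ (fromℕ m) ⟩
    fromℕ m + fromℕ (n ℕ.∸ m) - fromℕ m      ≈⟨ +-congʳ (×-homo-+ 1# m (n ℕ.∸ m)) ⟨
    fromℕ (m ℕ.+ (n ℕ.∸ m)) - fromℕ m        ≡⟨ ≡.cong (λ k → fromℕ k - fromℕ m) (ℕ.m+[n∸m]≡n m≤n) ⟩
    fromℕ n - fromℕ m                        ∎) (0≤-fromℕ (n ℕ.∸ m))

  -- Being invertible, 1/(n + 1) is apart from 0, and a negative value would make its product with n
  -- + 1, which is 1, negative.
  1/suc-pos : ∀ n → 0# < 1/suc n
  1/suc-pos n = [ (λ p → ⊥-elim (<-irrefl (<-trans 0<1 (<-resp (fromℕ-*-1/suc n) refl (neg p))))) , (λ p → p) ]′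
    (Equivalence.to #⇔<⊎> 1/#0)
    where
    1/#0 : 1/suc n # 0#
    1/#0 = invertible⇒# (fromℕ (suc n)
      , trans (*-congˡ x-0≈x) (fromℕ-*-1/suc n)
      , trans (*-congʳ x-0≈x) (trans (*-comm _ _) (fromℕ-*-1/suc n)))
      where
      x-0≈x : ∀ {x} → x - 0# ≈ x
      x-0≈x {x} = solve 1 (λ x → x :- con (+ 0) := x) refl x
    neg : 1/suc n < 0# → fromℕ (suc n) * 1/suc n < 0#
    neg p = <-resp (solve 2 (λ k x → :- (k :* (:- x)) := k :* x) refl _ _) refl (neg-<′ (*-pos (fromℕ-pos n) (neg-< p)))

  abstract
    divide : ∀ n {ε} → 0# < ε → ∃[ δ ] 0# < δ × fromℕ (suc n) * δ ≈ ε
    divide n {ε} 0<ε = 1/suc n * ε , *-pos (1/suc-pos n) 0<ε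
      , trans (sym (*-assoc _ _ _)) (trans (*-congʳ (fromℕ-*-1/suc n)) (*-identityˡ ε))

  -- ∣ x ∣ ≤ b, there being no absolute value function at hand.
  record Bd (x b : Carrier) : Set ℓ₂ where
    constructor bd
    field
      upper : 0≤ (b - x)
      lower : 0≤ (b + x)

  Bd-resp : ∀ {x x′ b b′} → x ≈ x′ → b ≈ b′ → Bd x b → Bd x′ b′
  Bd-resp p q (bd u l) = bd (0≤-resp (+-cong q (-‿cong p)) u) (0≤-resp (+-cong q p) l)

  Bd-0 : ∀ {b} → 0≤ b → Bd 0# b
  Bd-0 p = bd (0≤-resp (solve 1 (λ b → b := b :- con (+ 0)) refl _) p) (0≤-resp (sym (+-identityʳ _)) p)

  Bd-self : ∀ {b} → 0≤ b → Bd b b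
  Bd-self {b} p = bd (0≤-resp (sym (-‿inverseʳ b)) 0≤0) (0≤-+ p p)

  Bd-neg : ∀ {x b} → Bd x b → Bd (- x) b
  Bd-neg {x} {b} (bd u l) = bd (0≤-resp (solve 2 (λ x b → b :+ x := b :- (:- x)) refl x b) l) u

  Bd-+ : ∀ {x y a b} → Bd x a → Bd y b → Bd (x + y) (a + b)
  Bd-+ {x} {y} {a} {b} (bd u l) (bd u′ l′) = bd
    (0≤-resp (solve 4 (λ x y a b → a :- x :+ (b :- y) := a :+ b :- (x :+ y)) refl x y a b) (0≤-+ u u′))
    (0≤-resp (solve 4 (λ x y a b → a :+ x :+ (b :+ y) := a :+ b :+ (x :+ y)) refl x y a b) (0≤-+ l l′))

  -- 2(ab ∓ xy) = (a - x)(b ± y) + (a + x)(b ∓ y) exhibits both bounds as sums of products of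
  -- nonnegative numbers, with no distinction of signs.
  Bd-* : ∀ {x y a b} → Bd x a → Bd y b → Bd (x * y) (a * b)
  Bd-* {x} {y} {a} {b} (bd u l) (bd u′ l′) = bd
    (0≤-*-cancel (fromℕ-pos 1) (0≤-resp
      (solve 4 (λ x y a b → (a :- x) :* (b :+ y) :+ (a :+ x) :* (b :- y) := con (+ 2) :* (a :* b :- x :* y)) refl x y a b)
      (0≤-+ (0≤-* u l′) (0≤-* l u′))))
    (0≤-*-cancel (fromℕ-pos 1) (0≤-resp
      (solve 4 (λ x y a b → (a :- x) :* (b :- y) :+ (a :+ x) :* (b :+ y) := con (+ 2) :* (a :* b :+ x :* y)) refl x y a b)
      (0≤-+ (0≤-* u u′) (0≤-* l l′))))

  Bd-weaken : ∀ {x b b′} → 0≤ (b′ - b) → Bd x b → Bd x b′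
  Bd-weaken {x} {b} {b′} p (bd u l) = bd
    (0≤-resp (solve 3 (λ x b b′ → b′ :- b :+ (b :- x) := b′ :- x) refl x b b′) (0≤-+ p u))
    (0≤-resp (solve 3 (λ x b b′ → b′ :- b :+ (b :+ x) := b′ :+ x) refl x b b′) (0≤-+ p l))

  Bd-<ˡ : ∀ {x b} → x < b → - x < b → Bd x b
  Bd-<ˡ {x} {b} p q = bd (0<⇒0≤ (<⇒0<- p))
    (0≤-resp (+-congˡ (-‿involutive x)) (0<⇒0≤ (<⇒0<- q)))

  abstract
    bounded : ∀ x → ∃[ n ] Bd x (fromℕ n)
    bounded x with archimedean x | archimedean (- x)
    ... | m , p | n , q = m ℕ.⊔ n , bd
      (0≤-resp (solve 3 (λ b′ b x → b′ :- b :+ (b :- x) := b′ :- x) refl _ (fromℕ m) x)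
        (0≤-+ (fromℕ-mono (ℕ.m≤m⊔n m n)) (0<⇒0≤ (<⇒0<- p))))
      (0≤-resp (solve 3 (λ b′ b x → b′ :- b :+ (b :- (:- x)) := b′ :+ x) refl _ (fromℕ n) x)
        (0≤-+ (fromℕ-mono (ℕ.m≤n⊔m m n)) (0<⇒0≤ (<⇒0<- q))))

  Null : (ℕ → Carrier) → Set _
  Null s = ∀ ε → 0# < ε → ∃[ N ] ∀ n → N ℕ.≤ n → Bd (s n) ε

  Null-resp : ∀ {s t} → (∀ n → s n ≈ t n) → Null s → Null t
  Null-resp s≈t p ε 0<ε with p ε 0<ε
  ... | N , q = N , λ n N≤n → Bd-resp (s≈t n) refl (q n N≤n)

  Null-+ : ∀ {s t} → Null s → Null t → Null (λ n → s n + t n)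
  Null-+ p q ε 0<ε with divide 1 0<ε
  ... | δ , 0<δ , 2δ≈ε with p δ 0<δ | q δ 0<δ
  ... | M , p′ | N , q′ = M ℕ.⊔ N , λ n ≤n → Bd-resp refl
    (trans (solve 1 (λ δ → δ :+ δ := con (+ 2) :* δ) refl δ) 2δ≈ε)
    (Bd-+ (p′ n (ℕ.≤-trans (ℕ.m≤m⊔n M N) ≤n)) (q′ n (ℕ.≤-trans (ℕ.m≤n⊔m M N) ≤n)))

  Null-neg : ∀ {s} → Null s → Null (λ n → - s n)
  Null-neg p ε 0<ε with p ε 0<ε
  ... | N , q = N , λ n N≤n → Bd-neg (q n N≤n)

  Null-* : ∀ {s t} → Null s → Null t → Null (λ n → s n * t n)
  Null-* p q ε 0<ε with p 1# 0<1 | q ε 0<ε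
  ... | M , p′ | N , q′ = M ℕ.⊔ N , λ n ≤n → Bd-resp refl (*-identityˡ ε)
    (Bd-* (p′ n (ℕ.≤-trans (ℕ.m≤m⊔n M N) ≤n)) (q′ n (ℕ.≤-trans (ℕ.m≤n⊔m M N) ≤n)))

  Null-*ˡ : ∀ {s} k → Null s → Null (λ n → k * s n)
  Null-*ˡ k p ε 0<ε with bounded k
  -- ε is divided by b + 1, as b may be 0; the bound on k is weakened accordingly.
  ... | b , k≤b with divide b 0<ε
  ... | δ , 0<δ , bδ≈ε with p δ 0<δ
  ... | N , q = N , λ n N≤n → Bd-resp refl bδ≈ε
    (Bd-* (Bd-weaken (fromℕ-mono (ℕ.n≤1+n b)) k≤b) (q n N≤n))

  Null-∘ : ∀ {s} (f : ℕ → ℕ) → (∀ n → n ℕ.≤ f n) → Null s → Null (s ∘ f)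
  Null-∘ f f≥ p ε 0<ε with p ε 0<ε
  ... | N , q = N , λ n N≤n → q (f n) (ℕ.≤-trans N≤n (f≥ n))

  -- For positive x the bound x/2 fails, and a negative x is treated through - x. Uniqueness of
  -- limits rests on this.
  Null-const : ∀ {x} → Null (λ _ → x) → x ≈ 0#
  Null-const {x} p = ¬≮⇒≈ (λ x<0 → no-pos (neg-< x<0) (Null-neg p)) (λ 0<x → no-pos 0<x p)
    where
    no-pos : ∀ {x} → 0# < x → ¬ Null (λ _ → x)
    no-pos {x} 0<x q with divide 1 0<x
    ... | δ , 0<δ , 2δ≈x with q δ 0<δ
    ... | N , r = Bd.upper (r N ℕ.≤-refl) (<-resp (begin
      - δ                ≈⟨ solve 1 (λ δ → :- δ := δ :- con (+ 2) :* δ) refl δ ⟩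
      δ - fromℕ 2 * δ    ≈⟨ +-congˡ (-‿cong 2δ≈x) ⟩
      δ - x              ∎) refl (neg-<′ 0<δ))

  ⟶⇒Null : ∀ {s l} → s ⟶ l → Null (λ n → s n - l)
  ⟶⇒Null {s} {l} p ε 0<ε with p ε 0<ε
  ... | N , q = N , λ n N≤n → Bd-<ˡ (proj₁ (q n N≤n))
    (<-resp (solve 2 (λ s l → l :- s := :- (s :- l)) refl (s n) l) refl (proj₂ (q n N≤n)))

  -- Archimedes supplies k > C/ε, and then C ≤ nε for n > k; starting at k + 1 makes n a successor
  -- that can be cancelled.
  Null-1/n : ∀ {s} C → (∀ n → Bd (fromℕ n * s n) (fromℕ C)) → Null s
  Null-1/n {s} C p ε 0<ε with #0-inverse (>⇒# 0<ε)
  ... | e , εe≈1 with archimedean (fromℕ C * e)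
  ... | k , C*e<k = suc k , λ { (suc n) (s≤s k≤n) → bd
      (0≤-*-cancel (fromℕ-pos n) (0≤-resp (solve 4 (λ n ε s C → n :* ε :- C :+ (C :- n :* s) := n :* (ε :- s)) refl (fromℕ (suc n)) ε (s (suc n)) (fromℕ C))
        (0≤-+ (large n k≤n) (Bd.upper (p (suc n))))))
      (0≤-*-cancel (fromℕ-pos n) (0≤-resp (solve 4 (λ n ε s C → n :* ε :- C :+ (C :+ n :* s) := n :* (ε :+ s)) refl (fromℕ (suc n)) ε (s (suc n)) (fromℕ C))
        (0≤-+ (large n k≤n) (Bd.lower (p (suc n)))))) }
    where
    C<kε : 0# < (fromℕ k - fromℕ C * e) * ε
    C<kε = *-pos (<⇒0<- C*e<k) 0<ε
    large : ∀ n → k ℕ.≤ n → 0≤ (fromℕ (suc n) * ε - fromℕ C)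
    large n k≤n = 0≤-resp (begin
      (fromℕ (suc n) - fromℕ k) * ε + (fromℕ k - fromℕ C * e) * ε
        ≈⟨ solve 5 (λ n k ε C e → (n :- k) :* ε :+ (k :- C :* e) :* ε := n :* ε :- C :* (ε :* e)) refl (fromℕ (suc n)) (fromℕ k) ε (fromℕ C) e ⟩
      fromℕ (suc n) * ε - fromℕ C * (ε * e)  ≈⟨ +-congˡ (-‿cong (trans (*-congˡ εe≈1) (*-identityʳ _))) ⟩
      fromℕ (suc n) * ε - fromℕ C            ∎)
      (0≤-+ (0≤-* (fromℕ-mono (ℕ.≤-trans k≤n (ℕ.n≤1+n n))) (0<⇒0≤ 0<ε)) (0<⇒0≤ C<kε))

-- Finite sums over segments, antidiagonals, triangles and rectangles.

module Sums {c ℓ₁ ℓ₂} (ℛ : RealNumbers c ℓ₁ ℓ₂) where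
  open RealNumbers ℛ hiding (zero)
  open Arithmetic ℛ
  open Bounds ℛ
  open SetoidReasoning (CommutativeRing.setoid commutativeRing)

  -- Indexing by ℕ instead of `Fin` lets ranges be split, shifted and extended without transporting
  -- indices.
  Σ< : ℕ → (ℕ → Carrier) → Carrier
  Σ< zero    f = 0#
  Σ< (suc n) f = f 0 + Σ< n (f ∘ suc)

  sum≈Σ< : ∀ n f → sum {n} (f ∘ toℕ) ≈ Σ< n f
  sum≈Σ< zero    f = refl
  sum≈Σ< (suc n) f = +-congˡ (sum≈Σ< n (f ∘ suc))

  Σ<-cong : ∀ n {f g} → (∀ i → f i ≈ g i) → Σ< n f ≈ Σ< n g
  Σ<-cong zero    eq = refl
  Σ<-cong (suc n) eq = +-cong (eq 0) (Σ<-cong n (eq ∘ suc))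

  Σ<-cong< : ∀ n {f g} → (∀ i → i ℕ.< n → f i ≈ g i) → Σ< n f ≈ Σ< n g
  Σ<-cong< zero    eq = refl
  Σ<-cong< (suc n) eq = +-cong (eq 0 (s≤s z≤n)) (Σ<-cong< n (λ i i<n → eq (suc i) (s≤s i<n)))

  Σ<-0 : ∀ n {f} → (∀ i → f i ≈ 0#) → Σ< n f ≈ 0#
  Σ<-0 zero    eq = refl
  Σ<-0 (suc n) eq = trans (+-cong (eq 0) (Σ<-0 n (eq ∘ suc))) (+-identityˡ 0#)

  Σ<-+ : ∀ n f g → Σ< n (λ i → f i + g i) ≈ Σ< n f + Σ< n g
  Σ<-+ zero    f g = sym (+-identityˡ 0#)
  Σ<-+ (suc n) f g = trans (+-congˡ (Σ<-+ n (f ∘ suc) (g ∘ suc)))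
    (solve 4 (λ a b x y → a :+ b :+ (x :+ y) := a :+ x :+ (b :+ y)) refl (f 0) (g 0) _ _)

  Σ<-*ˡ : ∀ n k f → Σ< n (λ i → k * f i) ≈ k * Σ< n f
  Σ<-*ˡ zero    k f = sym (zeroʳ k)
  Σ<-*ˡ (suc n) k f = trans (+-congˡ (Σ<-*ˡ n k (f ∘ suc))) (sym (distribˡ k _ _))

  Σ<-split : ∀ m n f → Σ< (m ℕ.+ n) f ≈ Σ< m f + Σ< n (λ j → f (m ℕ.+ j))
  Σ<-split zero    n f = sym (+-identityˡ _)
  Σ<-split (suc m) n f = trans (+-congˡ (Σ<-split m n (f ∘ suc))) (sym (+-assoc _ _ _))

  Σ<-last : ∀ n f → Σ< (suc n) f ≈ Σ< n f + f n
  Σ<-last zero    f = trans (+-identityʳ _) (sym (+-identityˡ _))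
  Σ<-last (suc n) f = trans (+-congˡ (Σ<-last n (f ∘ suc))) (sym (+-assoc _ _ _))

  Σ<-Bd : ∀ n {f δ} → (∀ j → Bd (f j) δ) → Bd (Σ< n f) (fromℕ n * δ)
  Σ<-Bd zero    p = Bd-resp refl (sym (zeroˡ _)) (Bd-0 0≤0)
  Σ<-Bd (suc n) {f} {δ} p = Bd-resp refl
    (trans (solve 2 (λ n δ → δ :+ n :* δ := (con (+ 1) :+ n) :* δ) refl (fromℕ n) δ) (*-congʳ (+-congʳ 1≈)))
    (Bd-+ (p 0) (Σ<-Bd n (p ∘ suc)))

  -- The sum over all i + j = k, as in the Cauchy product of series.
  antidiagonal : ℕ → (ℕ → ℕ → Carrier) → Carrier
  antidiagonal zero    h = h 0 0
  antidiagonal (suc k) h = h 0 (suc k) + antidiagonal k (h ∘ suc)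

  antidiagonal-last : ∀ k h → antidiagonal (suc k) h ≈ antidiagonal k (λ i → h i ∘ suc) + h (suc k) 0
  antidiagonal-last zero    h = refl
  antidiagonal-last (suc k) h = trans (+-congˡ (antidiagonal-last k (h ∘ suc))) (sym (+-assoc _ _ _))

  antidiagonal-cong : ∀ k {h h′} → (∀ i j → h i j ≈ h′ i j) → antidiagonal k h ≈ antidiagonal k h′
  antidiagonal-cong zero    eq = eq 0 0
  antidiagonal-cong (suc k) eq = +-cong (eq 0 (suc k)) (antidiagonal-cong k (eq ∘ suc))

  antidiagonal-+ : ∀ k h h′ → antidiagonal k (λ i j → h i j + h′ i j) ≈ antidiagonal k h + antidiagonal k h′
  antidiagonal-+ zero    h h′ = refl
  antidiagonal-+ (suc k) h h′ = trans (+-congˡ (antidiagonal-+ k (h ∘ suc) (h′ ∘ suc)))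
    (solve 4 (λ a b x y → a :+ b :+ (x :+ y) := a :+ x :+ (b :+ y)) refl (h 0 (suc k)) (h′ 0 (suc k)) _ _)

  antidiagonal-* : ∀ k (F : ℕ → Carrier) h → antidiagonal k (λ i j → F (i ℕ.+ j) * h i j) ≈ F k * antidiagonal k h
  antidiagonal-* zero    F h = refl
  antidiagonal-* (suc k) F h = trans (+-congˡ (antidiagonal-* k (F ∘ suc) (h ∘ suc))) (sym (distribˡ _ _ _))

  rectangle : ℕ → ℕ → (ℕ → ℕ → Carrier) → Carrier
  rectangle zero    n h = 0#
  rectangle (suc m) n h = Σ< n (h 0) + rectangle m n (h ∘ suc)

  -- The sum over i + j < n, taken row by row.
  triangle : ℕ → (ℕ → ℕ → Carrier) → Carrier
  triangle zero    h = 0#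
  triangle (suc n) h = Σ< (suc n) (h 0) + triangle n (h ∘ suc)

  -- Taking off the first row shortens every antidiagonal by one entry, which is how the two
  -- recursions match.
  triangle≈antidiagonals : ∀ n h → triangle n h ≈ Σ< n (λ k → antidiagonal k h)
  triangle≈antidiagonals zero    h = refl
  triangle≈antidiagonals (suc n) h = begin
    h 0 0 + Σ< n (h 0 ∘ suc) + triangle n (h ∘ suc)
      ≈⟨ +-congˡ (triangle≈antidiagonals n (h ∘ suc)) ⟩
    h 0 0 + Σ< n (h 0 ∘ suc) + Σ< n (λ k → antidiagonal k (h ∘ suc))
      ≈⟨ +-assoc _ _ _ ⟩
    h 0 0 + (Σ< n (h 0 ∘ suc) + Σ< n (λ k → antidiagonal k (h ∘ suc)))
      ≈⟨ +-congˡ (Σ<-+ n (h 0 ∘ suc) (λ k → antidiagonal k (h ∘ suc))) ⟨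
    Σ< (suc n) (λ k → antidiagonal k h) ∎

  rectangle-cong : ∀ m n {h h′} → (∀ i j → h i j ≈ h′ i j) → rectangle m n h ≈ rectangle m n h′
  rectangle-cong zero    n eq = refl
  rectangle-cong (suc m) n eq = +-cong (Σ<-cong n (eq 0)) (rectangle-cong m n (eq ∘ suc))

  rectangle-+ : ∀ m n h h′ → rectangle m n (λ i j → h i j + h′ i j) ≈ rectangle m n h + rectangle m n h′
  rectangle-+ zero    n h h′ = sym (+-identityˡ 0#)
  rectangle-+ (suc m) n h h′ = trans (+-cong (Σ<-+ n (h 0) (h′ 0)) (rectangle-+ m n (h ∘ suc) (h′ ∘ suc)))
    (solve 4 (λ a b x y → a :+ b :+ (x :+ y) := a :+ x :+ (b :+ y)) refl (Σ< n (h 0)) (Σ< n (h′ 0)) _ _)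

  rectangle-* : ∀ m n f g → rectangle m n (λ i j → f i * g j) ≈ Σ< m f * Σ< n g
  rectangle-* zero    n f g = sym (zeroˡ _)
  rectangle-* (suc m) n f g = trans (+-cong (Σ<-*ˡ n (f 0) g) (rectangle-* m n (f ∘ suc) g)) (sym (distribʳ _ _ _))

  -- Only entries with i + j ≥ m survive, and the rough count m(m + d) of all entries suffices. The
  -- excess d of the width over the height is there for the induction: removing the first row lowers
  -- the height but not the width.
  rectangle-triangle : ∀ m d {h δ} → 0≤ δ → (∀ i j → m ℕ.≤ i ℕ.+ j → Bd (h i j) δ) →
    Bd (rectangle m (m ℕ.+ d) h - triangle m h) (fromℕ (m ℕ.* (m ℕ.+ d)) * δ)
  rectangle-triangle zero d 0≤δ p = Bd-resp (sym (-‿inverseʳ 0#)) (sym (zeroˡ _)) (Bd-0 0≤0)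
  rectangle-triangle (suc m) d {h} {δ} 0≤δ p = Bd-weaken
    (0≤-resp (solve 3 (λ a b δ → (a :- b) :* δ := a :* δ :- b :* δ) refl
                (fromℕ (suc m ℕ.* (suc m ℕ.+ d))) (fromℕ (d ℕ.+ m ℕ.* (m ℕ.+ suc d))) δ)
      (0≤-* (fromℕ-mono count) 0≤δ))
    (Bd-resp rows bounds (Bd-+ row rest))
    where
    row : Bd (Σ< d (λ j → h 0 (suc m ℕ.+ j))) (fromℕ d * δ)
    row = Σ<-Bd d (λ j → p 0 (suc m ℕ.+ j) (ℕ.m≤m+n (suc m) j))
    rest : Bd (rectangle m (m ℕ.+ suc d) (h ∘ suc) - triangle m (h ∘ suc)) (fromℕ (m ℕ.* (m ℕ.+ suc d)) * δ)
    rest = rectangle-triangle m (suc d) 0≤δ (λ i j m≤ → p (suc i) j (s≤s m≤))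
    rows : Σ< d (λ j → h 0 (suc m ℕ.+ j)) + (rectangle m (m ℕ.+ suc d) (h ∘ suc) - triangle m (h ∘ suc))
         ≈ rectangle (suc m) (suc m ℕ.+ d) h - triangle (suc m) h
    rows = begin
      r + (rectangle m (m ℕ.+ suc d) (h ∘ suc) - t)
        ≡⟨ ≡.cong (λ k → r + (rectangle m k (h ∘ suc) - t)) (ℕ.+-suc m d) ⟩
      r + (q - t)             ≈⟨ solve 4 (λ s r q t → r :+ (q :- t) := s :+ r :+ q :- (s :+ t)) refl s r q t ⟩
      s + r + q - (s + t)     ≈⟨ +-congʳ (+-congʳ (Σ<-split (suc m) d (h 0))) ⟨
      rectangle (suc m) (suc m ℕ.+ d) h - triangle (suc m) h ∎
      where
      s = Σ< (suc m) (h 0)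
      r = Σ< d (λ j → h 0 (suc m ℕ.+ j))
      q = rectangle m (suc m ℕ.+ d) (h ∘ suc)
      t = triangle m (h ∘ suc)
    bounds : fromℕ d * δ + fromℕ (m ℕ.* (m ℕ.+ suc d)) * δ ≈ fromℕ (d ℕ.+ m ℕ.* (m ℕ.+ suc d)) * δ
    bounds = trans (sym (distribʳ δ _ _)) (*-congʳ (sym (×-homo-+ 1# d (m ℕ.* (m ℕ.+ suc d)))))
    count : d ℕ.+ m ℕ.* (m ℕ.+ suc d) ℕ.≤ suc m ℕ.* (suc m ℕ.+ d)
    count = ℕ.+-mono-≤ (ℕ.m≤n+m d (suc m)) (ℕ.≤-reflexive (≡.cong (m ℕ.*_) (ℕ.+-suc m d)))

-- The exponential series: size of its terms and the Cauchy product.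

module ExponentialSeries {c ℓ₁ ℓ₂} (ℛ : RealNumbers c ℓ₁ ℓ₂) where
  open RealNumbers ℛ hiding (zero)
  open Arithmetic ℛ
  open Bounds ℛ
  open Sums ℛ
  open SetoidReasoning (CommutativeRing.setoid commutativeRing)

  abstract
    recip : ℕ → Carrier
    recip = 1/suc

    suc*recip : ∀ n → fromℕ (suc n) * recip n ≈ 1#
    suc*recip = fromℕ-*-1/suc

    0≤recip : ∀ n → 0≤ recip n
    0≤recip n = 0<⇒0≤ (1/suc-pos n)

  -- xⁱ / i!
  expTerm : Carrier → ℕ → Carrier
  expTerm x zero    = 1#
  expTerm x (suc i) = recip i * (x * expTerm x i)

  expTerm-suc : ∀ x i → fromℕ (suc i) * expTerm x (suc i) ≈ x * expTerm x i
  expTerm-suc x i = trans (sym (*-assoc _ _ _)) (trans (*-congʳ (suc*recip i)) (*-identityˡ _))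

  expTerm-unique : ∀ {x i y} → fromℕ (suc i) * y ≈ x * expTerm x i → y ≈ expTerm x (suc i)
  expTerm-unique {x} {i} eq = #0-cancel (fromℕ-suc#0 i) (trans eq (sym (expTerm-suc x i)))

  expTerm-! : ∀ x i → fromℕ (i !) * expTerm x i ≈ x ^ i
  expTerm-! x zero    = trans (*-congʳ 1≈) (*-identityˡ 1#)
  expTerm-! x (suc i) = begin
    fromℕ (suc i ℕ.* i !) * e′              ≈⟨ *-congʳ (×1-homo-* (suc i) (i !)) ⟩
    fromℕ (suc i) * fromℕ (i !) * e′        ≈⟨ solve 3 (λ a b e → a :* b :* e := b :* (a :* e)) refl (fromℕ (suc i)) (fromℕ (i !)) e′ ⟩
    fromℕ (i !) * (fromℕ (suc i) * e′)      ≈⟨ *-congˡ (expTerm-suc x i) ⟩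
    fromℕ (i !) * (x * expTerm x i)         ≈⟨ solve 3 (λ a b e → a :* (b :* e) := b :* (a :* e)) refl (fromℕ (i !)) x (expTerm x i) ⟩
    x * (fromℕ (i !) * expTerm x i)         ≈⟨ *-congˡ (expTerm-! x i) ⟩
    x * x ^ i                               ∎
    where e′ = expTerm x (suc i)

  expTerm-cong : ∀ {x y} → x ≈ y → ∀ i → expTerm x i ≈ expTerm y i
  expTerm-cong eq zero    = refl
  expTerm-cong eq (suc i) = *-congˡ (*-cong eq (expTerm-cong eq i))

  expTerm-scale : ∀ k x i → expTerm (k * x) i ≈ k ^ i * expTerm x i
  expTerm-scale k x zero    = sym (*-identityˡ 1#)
  expTerm-scale k x (suc i) = sym (expTerm-unique (begin
    fromℕ (suc i) * (k * k ^ i * e′)        ≈⟨ solve 4 (λ a k m e → a :* (k :* m :* e) := k :* m :* (a :* e)) refl (fromℕ (suc i)) k (k ^ i) e′ ⟩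
    k * k ^ i * (fromℕ (suc i) * e′)        ≈⟨ *-congˡ (expTerm-suc x i) ⟩
    k * k ^ i * (x * expTerm x i)           ≈⟨ solve 4 (λ k m x e → k :* m :* (x :* e) := k :* x :* (m :* e)) refl k (k ^ i) x (expTerm x i) ⟩
    k * x * (k ^ i * expTerm x i)           ≈⟨ *-congˡ (expTerm-scale k x i) ⟨
    k * x * expTerm (k * x) i               ∎))
    where e′ = expTerm x (suc i)

  -- The binomial theorem without binomial coefficients: on an antidiagonal the weight k + 1 = i + j
  -- splits as in the Leibniz rule, and each half drops to the previous antidiagonal by
  -- `expTerm-suc`.
  binomial : ∀ x y k → antidiagonal k (λ i j → expTerm x i * expTerm y j) ≈ expTerm (x + y) k
  binomial x y zero    = *-identityˡ 1#
  binomial x y (suc k) = expTerm-unique (begin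
    fromℕ (suc k) * antidiagonal (suc k) h
      ≈⟨ antidiagonal-* (suc k) fromℕ h ⟨
    antidiagonal (suc k) (λ i j → fromℕ (i ℕ.+ j) * h i j)
      ≈⟨ antidiagonal-cong (suc k) (λ i j → trans (*-congʳ (×-homo-+ 1# i j)) (distribʳ (h i j) _ _)) ⟩
    antidiagonal (suc k) (λ i j → fromℕ i * h i j + fromℕ j * h i j)
      ≈⟨ antidiagonal-+ (suc k) (λ i j → fromℕ i * h i j) (λ i j → fromℕ j * h i j) ⟩
    antidiagonal (suc k) (λ i j → fromℕ i * h i j) + antidiagonal (suc k) (λ i j → fromℕ j * h i j)
      ≈⟨ +-cong left right ⟩
    x * antidiagonal k h + y * antidiagonal k h   ≈⟨ distribʳ _ x y ⟨
    (x + y) * antidiagonal k h                    ≈⟨ *-congˡ (binomial x y k) ⟩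
    (x + y) * expTerm (x + y) k                   ∎)
    where
    h : ℕ → ℕ → Carrier
    h i j = expTerm x i * expTerm y j
    left : antidiagonal (suc k) (λ i j → fromℕ i * h i j) ≈ x * antidiagonal k h
    left = begin
      0# * h 0 (suc k) + antidiagonal k (λ i j → fromℕ (suc i) * h (suc i) j)
        ≈⟨ trans (+-congʳ (zeroˡ _)) (+-identityˡ _) ⟩
      antidiagonal k (λ i j → fromℕ (suc i) * h (suc i) j)
        ≈⟨ antidiagonal-cong k (λ i j → trans (sym (*-assoc _ _ _)) (trans (*-congʳ (expTerm-suc x i)) (*-assoc _ _ _))) ⟩
      antidiagonal k (λ i j → x * h i j)   ≈⟨ antidiagonal-* k (λ _ → x) h ⟩
      x * antidiagonal k h                 ∎
    right : antidiagonal (suc k) (λ i j → fromℕ j * h i j) ≈ y * antidiagonal k h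
    right = begin
      antidiagonal (suc k) (λ i j → fromℕ j * h i j)
        ≈⟨ antidiagonal-last k (λ i j → fromℕ j * h i j) ⟩
      antidiagonal k (λ i j → fromℕ (suc j) * h i (suc j)) + 0# * h (suc k) 0
        ≈⟨ trans (+-congˡ (zeroˡ _)) (+-identityʳ _) ⟩
      antidiagonal k (λ i j → fromℕ (suc j) * h i (suc j))
        ≈⟨ antidiagonal-cong k (λ i j → begin
             fromℕ (suc j) * (expTerm x i * expTerm y (suc j))
               ≈⟨ trans (sym (*-assoc _ _ _)) (trans (*-congʳ (*-comm _ _)) (*-assoc _ _ _)) ⟩
             expTerm x i * (fromℕ (suc j) * expTerm y (suc j))   ≈⟨ *-congˡ (expTerm-suc y j) ⟩
             expTerm x i * (y * expTerm y j)
               ≈⟨ trans (sym (*-assoc _ _ _)) (trans (*-congʳ (*-comm _ _)) (*-assoc _ _ _)) ⟩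
             y * h i j                                           ∎) ⟩
      antidiagonal k (λ i j → y * h i j)   ≈⟨ antidiagonal-* k (λ _ → y) h ⟩
      y * antidiagonal k h                 ∎

  expTerm-Bd : ∀ {x b} → Bd x b → ∀ i → Bd (expTerm x i) (expTerm b i)
  expTerm-Bd p zero    = Bd-self (0<⇒0≤ 0<1)
  expTerm-Bd p (suc i) = Bd-* (Bd-self (0≤recip i)) (Bd-* p (expTerm-Bd p i))

  fromℕ-^ : ∀ k i → fromℕ (k ℕ.^ i) ≈ fromℕ k ^ i
  fromℕ-^ k zero    = 1≈
  fromℕ-^ k (suc i) = trans (×1-homo-* k (k ℕ.^ i)) (*-congˡ (fromℕ-^ k i))

  -- Up to exponent k + 1 the power is at most its last value; from then on each new factor k + 1 is
  -- smaller than the new factor of the factorial.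
  k^i≤k^k*i! : ∀ k i → suc k ℕ.^ i ℕ.≤ suc k ℕ.^ suc k ℕ.* i !
  k^i≤k^k*i! k zero    = ℕ.≤-trans (ℕ.m^n>0 (suc k) (suc k)) (ℕ.≤-reflexive (≡.sym (ℕ.*-identityʳ _)))
  k^i≤k^k*i! k (suc i) with suc i ℕ.≤? suc k
  ... | yes i≤k = ℕ.≤-trans (ℕ.^-monoʳ-≤ (suc k) i≤k) (ℕ.m≤m*n _ (suc i !) {{ℕ._!≢0 (suc i)}})
  ... | no  i≰k = ℕ.≤-trans (ℕ.*-mono-≤ (ℕ.<⇒≤ (ℕ.≰⇒> i≰k)) (k^i≤k^k*i! k i))
    (ℕ.≤-reflexive (CommutativeSemigroupProperties.x∙yz≈y∙xz ℕ.*-commutativeSemigroup (suc i) (suc k ℕ.^ suc k) (i !)))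

  abstract
    expTerm-bounded : ∀ x → ∃[ C ] ∀ i → Bd (expTerm x i) (fromℕ C)
    expTerm-bounded x = helper (bounded x)
      where
      !-pos : ∀ i → 0# < fromℕ (i !)
      !-pos i with i ! | ℕ.>-nonZero⁻¹ (i !) {{ℕ._!≢0 i}}
      ... | suc n | _ = fromℕ-pos n
      expand : ∀ a f e → a * f - f * e ≈ f * (a - e)
      expand = solve 3 (λ a f e → a :* f :- f :* e := f :* (a :- e)) refl
      at-most : ∀ k C → (∀ i → suc k ℕ.^ i ℕ.≤ C ℕ.* i !) → ∀ i → 0≤ (fromℕ C - expTerm (fromℕ (suc k)) i)
      at-most k C k^i≤C*i! i = 0≤-*-cancel (!-pos i) (0≤-resp (begin
        fromℕ (C ℕ.* i !) - fromℕ (suc k ℕ.^ i)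
          ≈⟨ +-cong (×1-homo-* C (i !)) (-‿cong (trans (fromℕ-^ (suc k) i) (sym (expTerm-! _ i)))) ⟩
        fromℕ C * fromℕ (i !) - fromℕ (i !) * e   ≈⟨ expand (fromℕ C) (fromℕ (i !)) e ⟩
        fromℕ (i !) * (fromℕ C - e)               ∎) (fromℕ-mono (k^i≤C*i! i)))
        where
        e : Carrier
        e = expTerm (fromℕ (suc k)) i
      helper : ∃[ k ] Bd x (fromℕ k) → ∃[ C ] ∀ i → Bd (expTerm x i) (fromℕ C)
      helper (k , p) = suc k ℕ.^ suc k , λ i →
        Bd-weaken (at-most k (suc k ℕ.^ suc k) (k^i≤k^k*i! k) i) (expTerm-Bd (Bd-weaken (fromℕ-mono (ℕ.n≤1+n k)) p) i)

  -- Base 8 because n ≤ 2ⁿ gives n³ ≤ 8ⁿ: a factor n² counts the terms of the error in the Cauchy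
  -- product, and one more n turns boundedness into decay like 1/n.
  ⅛ : Carrier
  ⅛ = recip 7

  0≤⅛ : 0≤ ⅛
  0≤⅛ = 0≤recip 7

  8*⅛≈1 : fromℕ 8 * ⅛ ≈ 1#
  8*⅛≈1 = suc*recip 7

  ⅛-^ : ∀ i → fromℕ 8 ^ i * ⅛ ^ i ≈ 1#
  ⅛-^ zero    = *-identityˡ 1#
  ⅛-^ (suc i) = begin
    fromℕ 8 * fromℕ 8 ^ i * (⅛ * ⅛ ^ i)       ≈⟨ interchange (fromℕ 8) (fromℕ 8 ^ i) ⅛ (⅛ ^ i) ⟩
    fromℕ 8 * ⅛ * (fromℕ 8 ^ i * ⅛ ^ i)       ≈⟨ *-cong 8*⅛≈1 (⅛-^ i) ⟩
    1# * 1#                                   ≈⟨ *-identityˡ 1# ⟩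
    1#                                        ∎

  abstract
    -- The terms for 8x are bounded, and they are 8ⁱ times those for x.
    expTerm-geometric : ∀ x → ∃[ C ] ∀ i → Bd (expTerm x i) (fromℕ C * ⅛ ^ i)
    expTerm-geometric x = let C , p = expTerm-bounded (fromℕ 8 * x) in C , λ i → Bd-resp (cancel i) refl (Bd-* (p i) (Bd-self (0≤-^ i 0≤⅛)))
      where
      rotate : ∀ a b c → a * b * c ≈ a * c * b
      rotate = solve 3 (λ a b c → a :* b :* c := a :* c :* b) refl
      cancel : ∀ i → expTerm (fromℕ 8 * x) i * ⅛ ^ i ≈ expTerm x i
      cancel i = begin
        expTerm (fromℕ 8 * x) i * ⅛ ^ i         ≈⟨ *-congʳ (expTerm-scale (fromℕ 8) x i) ⟩
        fromℕ 8 ^ i * expTerm x i * ⅛ ^ i       ≈⟨ rotate (fromℕ 8 ^ i) (expTerm x i) (⅛ ^ i) ⟩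
        fromℕ 8 ^ i * ⅛ ^ i * expTerm x i       ≈⟨ *-congʳ (⅛-^ i) ⟩
        1# * expTerm x i                        ≈⟨ *-identityˡ _ ⟩
        expTerm x i                             ∎

  ⅛^-antitone : ∀ {m n} → m ℕ.≤ n → 0≤ (⅛ ^ m - ⅛ ^ n)
  ⅛^-antitone {n = n} z≤n = below-1 n
    where
    below-1 : ∀ n → 0≤ (1# - ⅛ ^ n)
    below-1 zero    = 0≤-resp (sym (-‿inverseʳ 1#)) 0≤0
    below-1 (suc n) = 0≤-resp (begin
      ⅛ * (fromℕ 7 + (1# - ⅛ ^ n))   ≈⟨ lemma ⅛ (⅛ ^ n) ⟩
      fromℕ 8 * ⅛ - ⅛ * ⅛ ^ n        ≈⟨ +-congʳ 8*⅛≈1 ⟩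
      1# - ⅛ * ⅛ ^ n                 ∎) (0≤-* 0≤⅛ (0≤-+ (0≤-fromℕ 7) (below-1 n)))
      where
      lemma : ∀ e p → e * (fromℕ 7 + (1# - p)) ≈ fromℕ 8 * e - e * p
      lemma e p = trans (*-congˡ (+-congˡ (+-congʳ (sym 1≈))))
        (solve 2 (λ e p → e :* (con (+ 7) :+ (con (+ 1) :- p)) := con (+ 8) :* e :- e :* p) refl e p)
  ⅛^-antitone (s≤s p) = 0≤-resp (factor ⅛ _ _) (0≤-* 0≤⅛ (⅛^-antitone p))
    where
    factor : ∀ e a b → e * (a - b) ≈ e * a - e * b
    factor = solve 3 (λ e a b → e :* (a :- b) := e :* a :- e :* b) refl

  n≤2^n : ∀ n → n ℕ.≤ 2 ℕ.^ n
  n≤2^n zero    = z≤n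
  n≤2^n (suc n) = ℕ.+-mono-≤ (ℕ.m^n>0 2 n) (ℕ.≤-trans (n≤2^n n) (ℕ.m≤m+n _ 0))

  n*n*n≤8^n : ∀ n → n ℕ.* (n ℕ.* n) ℕ.≤ 8 ℕ.^ n
  n*n*n≤8^n n = ℕ.≤-trans (ℕ.*-mono-≤ (n≤2^n n) (ℕ.*-mono-≤ (n≤2^n n) (n≤2^n n))) (ℕ.≤-reflexive (eq n))
    where
    eq : ∀ n → 2 ℕ.^ n ℕ.* (2 ℕ.^ n ℕ.* 2 ℕ.^ n) ≡ 8 ℕ.^ n
    eq zero    = ≡.refl
    eq (suc n) = ≡.trans
      (let open ℕSolver.+-*-Solver renaming (solve to solveℕ; _:*_ to _⊗_; _:=_ to _⊜_; con to conℕ) in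
        solveℕ 1 (λ p → (conℕ 2 ⊗ p) ⊗ ((conℕ 2 ⊗ p) ⊗ (conℕ 2 ⊗ p)) ⊜ conℕ 8 ⊗ (p ⊗ (p ⊗ p))) ≡.refl (2 ℕ.^ n))
      (≡.cong (8 ℕ.*_) (eq n))

  -- The two sums differ by fewer than n² terms with i + j ≥ n, each of size O(8⁻ⁿ).
  cauchyProduct : ∀ x y (F : ℕ → Carrier) → (∀ n → Bd (F n) 1#) →
    Null λ n → rectangle n n (λ i j → F (i ℕ.+ j) * (expTerm x i * expTerm y j)) - Σ< n (λ k → F k * expTerm (x + y) k)
  cauchyProduct x y F F≤1 = helper (expTerm-geometric x) (expTerm-geometric y)
    where
    h : ℕ → ℕ → Carrier
    h i j = F (i ℕ.+ j) * (expTerm x i * expTerm y j)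
    s : ℕ → Carrier
    s n = rectangle n n h - Σ< n (λ k → F k * expTerm (x + y) k)

    tri : ∀ n → triangle n h ≈ Σ< n (λ k → F k * expTerm (x + y) k)
    tri n = trans (triangle≈antidiagonals n h) (Σ<-cong n diagonal)
      where
      diagonal : ∀ k → antidiagonal k h ≈ F k * expTerm (x + y) k
      diagonal k = trans (antidiagonal-* k F (λ i j → expTerm x i * expTerm y j)) (*-congˡ {x = F k} (binomial x y k))

    helper : (∃[ C ] ∀ i → Bd (expTerm x i) (fromℕ C * ⅛ ^ i)) → (∃[ C ] ∀ i → Bd (expTerm y i) (fromℕ C * ⅛ ^ i)) → Null s
    helper (C , p) (D , q) = Null-1/n (C ℕ.* D) λ n →
      Bd-resp refl refl (Bd-weaken (slack n) (Bd-* (Bd-self (0≤-fromℕ n)) (total n)))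
      where
      E = fromℕ (C ℕ.* D)
      ⅛^-+ : ∀ i j → ⅛ ^ i * ⅛ ^ j ≈ ⅛ ^ (i ℕ.+ j)
      ⅛^-+ zero    j = *-identityˡ _
      ⅛^-+ (suc i) j = trans (*-assoc _ _ _) (*-congˡ (⅛^-+ i j))
      entry : ∀ i j → Bd (h i j) (E * ⅛ ^ (i ℕ.+ j))
      entry i j = Bd-resp refl (begin
        1# * (fromℕ C * ⅛ ^ i * (fromℕ D * ⅛ ^ j))   ≈⟨ *-identityˡ _ ⟩
        fromℕ C * ⅛ ^ i * (fromℕ D * ⅛ ^ j)          ≈⟨ interchange (fromℕ C) (⅛ ^ i) (fromℕ D) (⅛ ^ j) ⟩
        fromℕ C * fromℕ D * (⅛ ^ i * ⅛ ^ j)          ≈⟨ *-cong (sym (×1-homo-* C D)) (⅛^-+ i j) ⟩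
        E * ⅛ ^ (i ℕ.+ j)                            ∎)
        (Bd-* (F≤1 (i ℕ.+ j)) (Bd-* (p i) (q j)))
      factor : ∀ e a b → e * (a - b) ≈ e * a - e * b
      factor = solve 3 (λ e a b → e :* (a :- b) := e :* a :- e :* b) refl
      total : ∀ n → Bd (s n) (fromℕ (n ℕ.* n) * (E * ⅛ ^ n))
      total n = Bd-resp (+-cong (reflexive (≡.cong (λ k → rectangle n k h) (ℕ.+-identityʳ n))) (-‿cong (tri n)))
        (reflexive (≡.cong (λ k → fromℕ (n ℕ.* k) * (E * ⅛ ^ n)) (ℕ.+-identityʳ n)))
        (rectangle-triangle n 0 (0≤-* (0≤-fromℕ (C ℕ.* D)) (0≤-^ n 0≤⅛)) λ i j n≤ →
          Bd-weaken (0≤-resp (factor E (⅛ ^ n) (⅛ ^ (i ℕ.+ j))) (0≤-* (0≤-fromℕ (C ℕ.* D)) (⅛^-antitone n≤))) (entry i j))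
      slack : ∀ n → 0≤ (E - fromℕ n * (fromℕ (n ℕ.* n) * (E * ⅛ ^ n)))
      slack n = 0≤-resp (begin
        (fromℕ (8 ℕ.^ n) - fromℕ (n ℕ.* (n ℕ.* n))) * (E * ⅛ ^ n)
          ≈⟨ *-congʳ (+-cong (fromℕ-^ 8 n) (-‿cong (×1-homo-* n (n ℕ.* n)))) ⟩
        (fromℕ 8 ^ n - fromℕ n * fromℕ (n ℕ.* n)) * (E * ⅛ ^ n)
          ≈⟨ expand (fromℕ 8 ^ n) (fromℕ n) (fromℕ (n ℕ.* n)) E (⅛ ^ n) ⟩
        E * (fromℕ 8 ^ n * ⅛ ^ n) - fromℕ n * (fromℕ (n ℕ.* n) * (E * ⅛ ^ n))
          ≈⟨ +-congʳ (trans (*-congˡ (⅛-^ n)) (*-identityʳ E)) ⟩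
        E - fromℕ n * (fromℕ (n ℕ.* n) * (E * ⅛ ^ n)) ∎)
        (0≤-* (fromℕ-mono (n*n*n≤8^n n)) (0≤-* (0≤-fromℕ (C ℕ.* D)) (0≤-^ n 0≤⅛)))
        where
        expand : ∀ a b c E e → (a - b * c) * (E * e) ≈ E * (a * e) - b * (c * (E * e))
        expand = solve 5 (λ a b c E e → (a :- b :* c) :* (E :* e) := E :* (a :* e) :- b :* (c :* (E :* e))) refl

-- Addition formulas, parity and congruence of cosine and sine.

module AdditionFormulas {c ℓ₁ ℓ₂} {ℛ : RealNumbers c ℓ₁ ℓ₂} (𝒯 : Trigonometry ℛ) where
  open RealNumbers ℛ hiding (zero)
  open Trigonometry 𝒯
  open PowerSeries ℛ
  open Arithmetic ℛ
  open Bounds ℛ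
  open Sums ℛ
  open ExponentialSeries ℛ
  open SetoidReasoning (CommutativeRing.setoid commutativeRing)

  -- Real and imaginary part of the powers of the imaginary unit.
  re im : ℕ → Carrier
  re zero    = 1#
  re (suc n) = - im n
  im zero    = 0#
  im (suc n) = re n

  re-+ : ∀ i j → re (i ℕ.+ j) ≈ re i * re j - im i * im j
  im-+ : ∀ i j → im (i ℕ.+ j) ≈ im i * re j + re i * im j
  re-+ zero    j = sym (trans (+-cong (*-identityˡ _) (trans (-‿cong (zeroˡ _)) -0#≈0#)) (+-identityʳ _))
  re-+ (suc i) j = trans (-‿cong (im-+ i j))
    (solve 4 (λ a b c d → :- (a :* b :+ c :* d) := :- a :* b :- c :* d) refl (im i) (re j) (re i) (im j))
  im-+ zero    j = sym (trans (+-cong (zeroˡ _) (*-identityˡ _)) (+-identityˡ _))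
  im-+ (suc i) j = trans (re-+ i j)
    (solve 4 (λ a b c d → a :* b :- c :* d := a :* b :+ :- c :* d) refl (re i) (re j) (im i) (im j))

  re-Bd : ∀ n → Bd (re n) 1#
  im-Bd : ∀ n → Bd (im n) 1#
  re-Bd zero    = Bd-self (0<⇒0≤ 0<1)
  re-Bd (suc n) = Bd-neg (im-Bd n)
  im-Bd zero    = Bd-0 (0<⇒0≤ 0<1)
  im-Bd (suc n) = re-Bd n

  -- Real and imaginary part of the partial sums of exp(ix). The vanishing terms are kept, so that
  -- the index is the degree and the Cauchy product applies; after an even number of terms these are
  -- the partial sums of the cosine and sine series.
  C S : Carrier → ℕ → Carrier
  C x n = Σ< n (λ k → re k * expTerm x k)
  S x n = Σ< n (λ k → im k * expTerm x k)

  double : ℕ → ℕ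
  double zero    = zero
  double (suc n) = suc (suc (double n))

  n≤double : ∀ n → n ℕ.≤ double n
  n≤double zero    = z≤n
  n≤double (suc n) = s≤s (ℕ.≤-trans (n≤double n) (ℕ.n≤1+n _))

  double≡2* : ∀ n → double n ≡ 2 ℕ.* n
  double≡2* zero    = ≡.refl
  double≡2* (suc n) = ≡.trans (≡.cong (suc ∘ suc) (double≡2* n)) (≡.cong suc (≡.sym (ℕ.+-suc n (n ℕ.+ 0))))

  Σ<-double : ∀ n f → Σ< (double n) f ≈ Σ< n (λ k → f (double k) + f (suc (double k)))
  Σ<-double zero    f = refl
  Σ<-double (suc n) f = trans (sym (+-assoc _ _ _)) (+-congˡ (Σ<-double n (f ∘ suc ∘ suc)))

  re-double : ∀ k → re (double k) ≈ fromℤ (ℤ.-1ℤ ℤ.^ k)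
  re-double zero    = sym 1≈
  re-double (suc k) = sym (trans (fromℤ-* ℤ.-1ℤ (ℤ.-1ℤ ℤ.^ k)) (trans (*-congˡ (sym (re-double k)))
    (solve 1 (λ x → :- con (+ 1) :* x := :- x) refl (re (double k)))))

  im-double : ∀ k → im (double k) ≈ 0#
  im-double zero    = refl
  im-double (suc k) = trans (-‿cong (im-double k)) -0#≈0#

  fromℚ-/′ : ∀ i n .{{_ : ℕ.NonZero n}} → fromℕ n * fromℚ (i ℚ./ n) ≈ fromℤ i
  fromℚ-/′ i (suc n) = fromℚ-/ i n

  alternatingTerm≈ : ∀ x k n → alternatingTerm x k n ≈ fromℤ (ℤ.-1ℤ ℤ.^ k) * expTerm x n
  alternatingTerm≈ x k n = begin
    q * x ^ n                           ≈⟨ *-congˡ (expTerm-! x n) ⟨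
    q * (fromℕ (n !) * expTerm x n)     ≈⟨ swap q (fromℕ (n !)) (expTerm x n) ⟩
    fromℕ (n !) * q * expTerm x n       ≈⟨ *-congʳ (fromℚ-/′ (ℤ.-1ℤ ℤ.^ k) (n !) {{ℕ._!≢0 n}}) ⟩
    fromℤ (ℤ.-1ℤ ℤ.^ k) * expTerm x n   ∎
    where
    q = fromℚ ((ℤ.-1ℤ ℤ.^ k ℚ./ n !) {{ℕ._!≢0 n}})
    swap : ∀ a b c → a * (b * c) ≈ b * a * c
    swap = solve 3 (λ a b c → a :* (b :* c) := b :* a :* c) refl

  C≈cosPartial : ∀ x n → C x (double n) ≈ cosPartial x n
  C≈cosPartial x n = begin
    C x (double n)   ≈⟨ Σ<-double n (λ k → re k * expTerm x k) ⟩
    Σ< n (λ k → re (double k) * expTerm x (double k) + - im (double k) * expTerm x (suc (double k)))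
      ≈⟨ Σ<-cong n term ⟩
    Σ< n (λ k → alternatingTerm x k (2 ℕ.* k))   ≈⟨ sum≈Σ< n (λ k → alternatingTerm x k (2 ℕ.* k)) ⟨
    cosPartial x n   ∎
    where
    term : ∀ k → re (double k) * expTerm x (double k) + - im (double k) * expTerm x (suc (double k)) ≈ alternatingTerm x k (2 ℕ.* k)
    term k = begin
      re (double k) * expTerm x (double k) + - im (double k) * expTerm x (suc (double k))
        ≈⟨ +-cong (*-congʳ (re-double k)) (trans (*-congʳ (trans (-‿cong (im-double k)) -0#≈0#)) (zeroˡ _)) ⟩
      fromℤ (ℤ.-1ℤ ℤ.^ k) * expTerm x (double k) + 0#   ≈⟨ +-identityʳ _ ⟩
      fromℤ (ℤ.-1ℤ ℤ.^ k) * expTerm x (double k)        ≡⟨ ≡.cong (λ m → fromℤ (ℤ.-1ℤ ℤ.^ k) * expTerm x m) (double≡2* k) ⟩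
      fromℤ (ℤ.-1ℤ ℤ.^ k) * expTerm x (2 ℕ.* k)         ≈⟨ alternatingTerm≈ x k (2 ℕ.* k) ⟨
      alternatingTerm x k (2 ℕ.* k)                     ∎

  S≈sinPartial : ∀ x n → S x (double n) ≈ sinPartial x n
  S≈sinPartial x n = begin
    S x (double n)   ≈⟨ Σ<-double n (λ k → im k * expTerm x k) ⟩
    Σ< n (λ k → im (double k) * expTerm x (double k) + re (double k) * expTerm x (suc (double k)))
      ≈⟨ Σ<-cong n term ⟩
    Σ< n (λ k → alternatingTerm x k (suc (2 ℕ.* k)))   ≈⟨ sum≈Σ< n (λ k → alternatingTerm x k (suc (2 ℕ.* k))) ⟨
    sinPartial x n   ∎
    where
    term : ∀ k → im (double k) * expTerm x (double k) + re (double k) * expTerm x (suc (double k)) ≈ alternatingTerm x k (suc (2 ℕ.* k))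
    term k = begin
      im (double k) * expTerm x (double k) + re (double k) * expTerm x (suc (double k))
        ≈⟨ +-cong (trans (*-congʳ (im-double k)) (zeroˡ _)) (*-congʳ (re-double k)) ⟩
      0# + fromℤ (ℤ.-1ℤ ℤ.^ k) * expTerm x (suc (double k))   ≈⟨ +-identityˡ _ ⟩
      fromℤ (ℤ.-1ℤ ℤ.^ k) * expTerm x (suc (double k))        ≡⟨ ≡.cong (λ m → fromℤ (ℤ.-1ℤ ℤ.^ k) * expTerm x (suc m)) (double≡2* k) ⟩
      fromℤ (ℤ.-1ℤ ℤ.^ k) * expTerm x (suc (2 ℕ.* k))         ≈⟨ alternatingTerm≈ x k (suc (2 ℕ.* k)) ⟨
      alternatingTerm x k (suc (2 ℕ.* k))                     ∎

  cos-limit : ∀ x → Null (λ n → C x (double n) - cos x)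
  cos-limit x = Null-resp (λ n → +-congʳ (sym (C≈cosPartial x n))) (⟶⇒Null (cos-series x))

  sin-limit : ∀ x → Null (λ n → S x (double n) - sin x)
  sin-limit x = Null-resp (λ n → +-congʳ (sym (S≈sinPartial x n))) (⟶⇒Null (sin-series x))

  Null-product : ∀ (s t : ℕ → Carrier) a b → Null (λ n → s n - a) → Null (λ n → t n - b) → Null (λ n → s n * t n - a * b)
  Null-product s t a b p q = Null-resp (λ n → lemma (s n) (t n) a b)
    (Null-+ (Null-* p q) (Null-+ (Null-*ˡ a q) (Null-*ˡ b p)))
    where
    lemma : ∀ s t a b → (s - a) * (t - b) + (a * (t - b) + b * (s - a)) ≈ s * t - a * b
    lemma = solve 4 (λ s t a b → (s :- a) :* (t :- b) :+ (a :* (t :- b) :+ b :* (s :- a)) := s :* t :- a :* b) refl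

  private
    Limit : (ℕ → Carrier) → Carrier → Carrier → Set _
    Limit f x l = Null (λ n → Σ< (double n) (λ k → f k * expTerm x k) - l)

    Limit-neg : ∀ {f x l} → Limit f x l → Limit (λ k → - f k) x (- l)
    Limit-neg {f} {x} {l} p = Null-resp (λ n → trans (sym (-‿+-comm _ _)) (+-congʳ (sym (Σ<-neg (double n))))) (Null-neg p)
      where
      Σ<-neg : ∀ n → Σ< n (λ k → - f k * expTerm x k) ≈ - Σ< n (λ k → f k * expTerm x k)
      Σ<-neg n = trans (Σ<-cong n (λ k → minus (f k) (expTerm x k))) (trans (Σ<-*ˡ n (- 1#) (λ k → f k * expTerm x k))
        (trans (sym (-‿distribˡ-* 1# _)) (-‿cong (*-identityˡ _))))
        where
        minus : ∀ a b → - a * b ≈ - 1# * (a * b)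
        minus a b = trans (sym (-‿distribˡ-* a b)) (trans (-‿cong (sym (*-identityˡ _))) (-‿distribˡ-* 1# _))

    -- Both addition formulas at once: `F` is to be the real or imaginary part of iⁿ, a bounded
    -- weight that depends on the sum of the indices only. Its splitting over i + j decomposes the
    -- square partial sum into products of partial sums.
    addition : ∀ {F f g f′ g′ x y a b a′ b′ l} → (∀ i j → F (i ℕ.+ j) ≈ f i * g j + f′ i * g′ j) → (∀ n → Bd (F n) 1#) →
      Limit f x a → Limit g y b → Limit f′ x a′ → Limit g′ y b′ → Limit F (x + y) l → l ≈ a * b + a′ * b′
    addition {F} {f} {g} {f′} {g′} {x} {y} {a} {b} {a′} {b′} {l} F-+ F≤1 p q p′ q′ r = sym (x-y≈0⇒x≈y (Null-const (Null-resp
      (λ n → cancel (s f x n * s g y n) (s f′ x n * s g′ y n) (s F (x + y) n) (a * b) (a′ * b′) l)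
      (Null-+ (Null-+ partials r) (Null-neg (Null-+ (Null-product (s f x) (s g y) a b p q) (Null-product (s f′ x) (s g′ y) a′ b′ p′ q′)))))))
      where
      s : (ℕ → Carrier) → Carrier → ℕ → Carrier
      s f x n = Σ< (double n) (λ k → f k * expTerm x k)
      cancel : ∀ u v w a b l → u + v - w + (w - l) + - (u - a + (v - b)) ≈ a + b - l
      cancel = solve 6 (λ u v w a b l → u :+ v :- w :+ (w :- l) :+ :- (u :- a :+ (v :- b)) := a :+ b :- l) refl
      expand : ∀ a b c d u v → (a * b + c * d) * (u * v) ≈ a * u * (b * v) + c * u * (d * v)
      expand = solve 6 (λ a b c d u v → (a :* b :+ c :* d) :* (u :* v) := a :* u :* (b :* v) :+ c :* u :* (d :* v)) refl
      split : ∀ n → rectangle n n (λ i j → F (i ℕ.+ j) * (expTerm x i * expTerm y j))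
        ≈ Σ< n (λ i → f i * expTerm x i) * Σ< n (λ j → g j * expTerm y j) + Σ< n (λ i → f′ i * expTerm x i) * Σ< n (λ j → g′ j * expTerm y j)
      split n = trans
        (rectangle-cong n n (λ i j → trans (*-congʳ (F-+ i j)) (expand (f i) (g j) (f′ i) (g′ j) (expTerm x i) (expTerm y j))))
        (trans (rectangle-+ n n (λ i j → f i * expTerm x i * (g j * expTerm y j)) (λ i j → f′ i * expTerm x i * (g′ j * expTerm y j)))
          (+-cong (rectangle-* n n (λ i → f i * expTerm x i) (λ j → g j * expTerm y j))
                  (rectangle-* n n (λ i → f′ i * expTerm x i) (λ j → g′ j * expTerm y j))))
      partials : Null (λ n → s f x n * s g y n + s f′ x n * s g′ y n - s F (x + y) n)
      partials = Null-resp (λ n → +-congʳ (split (double n))) (Null-∘ double n≤double (cauchyProduct x y F F≤1))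

  abstract
    cos-+ : ∀ x y → cos (x + y) ≈ cos x * cos y - sin x * sin y
    -- The minus sign of the formula is absorbed into the sequence `- im`, whose limit is - sin x.
    cos-+ x y = trans (addition (λ i j → trans (re-+ i j) (+-congˡ (-‿distribˡ-* (im i) (im j)))) re-Bd
      (cos-limit x) (cos-limit y) (Limit-neg {im} (sin-limit x)) (sin-limit y) (cos-limit (x + y)))
      (+-congˡ (sym (-‿distribˡ-* (sin x) (sin y))))

    sin-+ : ∀ x y → sin (x + y) ≈ sin x * cos y + cos x * sin y
    sin-+ x y = addition im-+ im-Bd (sin-limit x) (cos-limit y) (cos-limit x) (sin-limit y) (sin-limit (x + y))

  private
    limit-unique : ∀ {s t : ℕ → Carrier} a b → (∀ n → s n ≈ t n) → Null (λ n → s n - a) → Null (λ n → t n - b) → a ≈ b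
    limit-unique {s} {t} a b s≈t p q = sym (x-y≈0⇒x≈y (Null-const (Null-resp
      (λ n → trans (+-congˡ (-‿cong (+-congʳ (sym (s≈t n))))) (lemma (s n) a b)) (Null-+ p (Null-neg q)))))
      where
      lemma : ∀ s a b → s - a + - (s - b) ≈ b - a
      lemma = solve 3 (λ s a b → s :- a :+ :- (s :- b) := b :- a) refl

  -- `cos` is given as a function on representatives; that it respects equality follows from its
  -- series and the uniqueness of limits.
  cos-cong : ∀ {x y} → x ≈ y → cos x ≈ cos y
  cos-cong {x} {y} x≈y = limit-unique (cos x) (cos y)
    (λ n → Σ<-cong (double n) (λ k → *-congˡ {re k} (expTerm-cong x≈y k))) (cos-limit x) (cos-limit y)

  sin-cong : ∀ {x y} → x ≈ y → sin x ≈ sin y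
  sin-cong {x} {y} x≈y = limit-unique (sin x) (sin y)
    (λ n → Σ<-cong (double n) (λ k → *-congˡ {im k} (expTerm-cong x≈y k))) (sin-limit x) (sin-limit y)

  private
    -- `re` vanishes at odd and `im` at even indices, so together they record the sign of (-x)ⁱ. The
    -- two statements need each other because a step of i turns `re` into `- im` and `im` into `re`.
    even : ∀ x i → re i * expTerm (- x) i ≈ re i * expTerm x i
    odd  : ∀ x i → im i * expTerm (- x) i ≈ - im i * expTerm x i
    even x zero    = refl
    even x (suc i) = begin
      - im i * (recip i * (- x * expTerm (- x) i))   ≈⟨ lemma (im i) (recip i) x (expTerm (- x) i) ⟩
      recip i * x * (im i * expTerm (- x) i)         ≈⟨ *-congˡ (odd x i) ⟩
      recip i * x * (- im i * expTerm x i)           ≈⟨ lemma′ (im i) (recip i) x (expTerm x i) ⟩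
      - im i * (recip i * (x * expTerm x i))         ∎
      where
      lemma : ∀ a r x e → - a * (r * (- x * e)) ≈ r * x * (a * e)
      lemma = solve 4 (λ a r x e → :- a :* (r :* (:- x :* e)) := r :* x :* (a :* e)) refl
      lemma′ : ∀ a r x e → r * x * (- a * e) ≈ - a * (r * (x * e))
      lemma′ = solve 4 (λ a r x e → r :* x :* (:- a :* e) := :- a :* (r :* (x :* e))) refl
    odd x zero    = trans (zeroˡ _) (sym (trans (*-congʳ -0#≈0#) (zeroˡ _)))
    odd x (suc i) = begin
      re i * (recip i * (- x * expTerm (- x) i))     ≈⟨ lemma (re i) (recip i) x (expTerm (- x) i) ⟩
      - (recip i * x) * (re i * expTerm (- x) i)     ≈⟨ *-congˡ (even x i) ⟩
      - (recip i * x) * (re i * expTerm x i)         ≈⟨ lemma′ (re i) (recip i) x (expTerm x i) ⟩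
      - re i * (recip i * (x * expTerm x i))         ∎
      where
      lemma : ∀ a r x e → a * (r * (- x * e)) ≈ - (r * x) * (a * e)
      lemma = solve 4 (λ a r x e → a :* (r :* (:- x :* e)) := :- (r :* x) :* (a :* e)) refl
      lemma′ : ∀ a r x e → - (r * x) * (a * e) ≈ - a * (r * (x * e))
      lemma′ = solve 4 (λ a r x e → :- (r :* x) :* (a :* e) := :- a :* (r :* (x :* e))) refl

  cos-neg : ∀ x → cos (- x) ≈ cos x
  cos-neg x = limit-unique (cos (- x)) (cos x) (λ n → Σ<-cong (double n) (even x)) (cos-limit (- x)) (cos-limit x)

  sin-neg : ∀ x → sin (- x) ≈ - sin x
  sin-neg x = limit-unique (sin (- x)) (- sin x) (λ n → Σ<-cong (double n) (odd x)) (sin-limit (- x)) (Limit-neg {im} (sin-limit x))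

  cos-0 : cos 0# ≈ 1#
  -- The index is raised by 1, since the empty partial sum is 0 and not 1.
  cos-0 = sym (x-y≈0⇒x≈y (Null-const (λ ε 0<ε → proj₁ (p ε 0<ε) ℕ.+ 1 , λ n N≤n →
    Bd-resp (+-congʳ (C-0 n (ℕ.≤-trans (ℕ.m≤n+m 1 _) N≤n))) refl (proj₂ (p ε 0<ε) n (ℕ.≤-trans (ℕ.m≤m+n _ 1) N≤n)))))
    where
    p = cos-limit 0#
    C-0 : ∀ n → 1 ℕ.≤ n → C 0# (double n) ≈ 1#
    C-0 (suc n) _ = trans (+-cong (*-identityˡ 1#) (Σ<-0 (suc (double n)) vanishing)) (+-identityʳ 1#)
      where
      vanishing : ∀ i → re (suc i) * expTerm 0# (suc i) ≈ 0#
      vanishing i = trans (*-congˡ (trans (*-congˡ (zeroˡ (expTerm 0# i))) (zeroʳ (recip i)))) (zeroʳ (re (suc i)))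

  sin-0 : sin 0# ≈ 0#
  sin-0 = integral (#⇒≉ (fromℕ-suc#0 1)) (begin
    fromℕ 2 * sin 0#         ≈⟨ solve 1 (λ s → con (+ 2) :* s := s :- :- s) refl (sin 0#) ⟩
    sin 0# - - sin 0#        ≈⟨ +-congˡ (-‿cong (sin-neg 0#)) ⟨
    sin 0# - sin (- 0#)      ≈⟨ +-congˡ (-‿cong (sin-cong -0#≈0#)) ⟩
    sin 0# - sin 0#          ≈⟨ -‿inverseʳ _ ⟩
    0#                       ∎)

  cos²+sin² : ∀ x → cos x * cos x + sin x * sin x ≈ 1#
  cos²+sin² x = begin
    cos x * cos x + sin x * sin x            ≈⟨ solve 2 (λ c s → c :* c :+ s :* s := c :* c :- s :* :- s) refl (cos x) (sin x) ⟩
    cos x * cos x - sin x * - sin x          ≈⟨ +-cong (*-congˡ (cos-neg x)) (-‿cong (*-congˡ (sin-neg x))) ⟨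
    cos x * cos (- x) - sin x * sin (- x)    ≈⟨ cos-+ x (- x) ⟨
    cos (x - x)                              ≈⟨ cos-cong (-‿inverseʳ x) ⟩
    cos 0#                                   ≈⟨ cos-0 ⟩
    1#                                       ∎

-- Algebraic equations for 2 cos and 2 sin at the special angles.

module SpecialAngles {c ℓ₁ ℓ₂} {ℛ : RealNumbers c ℓ₁ ℓ₂} (𝒯 : Trigonometry ℛ) where
  open RealNumbers ℛ hiding (zero)
  open Trigonometry 𝒯
  open Arithmetic ℛ
  open Bounds ℛ
  open AdditionFormulas 𝒯 using (cos-+; sin-+; cos-cong; sin-cong; cos-neg; sin-neg; cos-0; sin-0; cos²+sin²)
  open SetoidReasoning (CommutativeRing.setoid commutativeRing)

  -- `d °` unfolds to `angle 179 d` and 2π/11 to `angle 10 2`; a common denominator reduces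
  -- equalities of angles to sums of numerators.
  angle : ℕ → ℕ → Carrier
  angle n a = (+ a ℚ./ suc n) · π

  angle-+ : ∀ n a b c → a ℕ.+ b ≡ c → angle n a + angle n b ≈ angle n c
  angle-+ n a b c a+b≡c = trans (sym (distribʳ π _ _)) (*-congʳ (#0-cancel (fromℕ-suc#0 n) (begin
    fromℕ (suc n) * (fromℚ (+ a ℚ./ suc n) + fromℚ (+ b ℚ./ suc n))   ≈⟨ distribˡ _ _ _ ⟩
    fromℕ (suc n) * fromℚ (+ a ℚ./ suc n) + fromℕ (suc n) * fromℚ (+ b ℚ./ suc n)
      ≈⟨ +-cong (fromℚ-/ (+ a) n) (fromℚ-/ (+ b) n) ⟩
    fromℕ a + fromℕ b                            ≈⟨ ×-homo-+ 1# a b ⟨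
    fromℕ (a ℕ.+ b)                              ≡⟨ ≡.cong fromℕ a+b≡c ⟩
    fromℕ c                                      ≈⟨ fromℚ-/ (+ c) n ⟨
    fromℕ (suc n) * fromℚ (+ c ℚ./ suc n)        ∎)))

  angle-π : ∀ n → angle n (suc n) ≈ π
  angle-π n = trans (*-congʳ (#0-cancel (fromℕ-suc#0 n) (trans (fromℚ-/ (+ suc n) n) (sym (*-identityʳ _)))))
    (*-identityˡ π)

  angle-0 : ∀ n → angle n 0 ≈ 0#
  angle-0 n = trans (*-congʳ (#0-cancel (fromℕ-suc#0 n) (trans (fromℚ-/ (+ 0) n) (sym (zeroʳ _))))) (zeroˡ π)

  angle-pos : ∀ n a → 0# < angle n (suc a)
  angle-pos n a = *-pos (pos-cancel (<-resp refl (sym (fromℚ-/ (+ suc a) n)) (fromℕ-pos a))) 0<π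
    where
    pos-cancel : ∀ {x} → 0# < fromℕ (suc n) * x → 0# < x
    pos-cancel {x} p = [ (λ 0<x → 0<x) , (λ x<0 → ⊥-elim (<-irrefl (<-trans p
        (<-resp (solve 2 (λ k x → :- (k :* :- x) := k :* x) refl (fromℕ (suc n)) x) refl
                (neg-<′ (*-pos (fromℕ-pos n) (neg-< x<0))))))) ]′
      (Equivalence.to #⇔<⊎> (#0 (#0-inverse (>⇒# p))))
      where
      #0 : (∃[ y ] fromℕ (suc n) * x * y ≈ 1#) → 0# # x
      #0 (y , eq) = #-sym (invertible⇒# (fromℕ (suc n) * y
        , trans (solve 3 (λ k y x → k :* y :* (x :- con (+ 0)) := k :* x :* y) refl (fromℕ (suc n)) y x) eq
        , trans (solve 3 (λ k y x → (x :- con (+ 0)) :* (k :* y) := k :* x :* y) refl (fromℕ (suc n)) y x) eq))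

  angle<π : ∀ n a b → suc a ℕ.+ b ≡ suc n → 0# < angle n b → angle n (suc a) < π
  angle<π n a b eq 0<b = <-resp (+-identityʳ _) (trans (angle-+ n (suc a) b (suc n) eq) (angle-π n))
    (+-monoʳ-< (angle n (suc a)) 0<b)

  sin-angle-pos : ∀ n a b → suc a ℕ.+ suc b ≡ suc n → 0# < sin (angle n (suc a))
  sin-angle-pos n a b eq = sin-pos _ (angle-pos n a) (angle<π n a (suc b) eq (angle-pos n b))

  -- 2 cos and 2 sin satisfy addition formulas over ℤ with monic multiple angle polynomials.
  Y Θ : Carrier → Carrier
  Y x = fromℕ 2 * cos x
  Θ x = fromℕ 2 * sin x

  Y-cong : ∀ {x y} → x ≈ y → Y x ≈ Y y
  Y-cong = *-congˡ ∘ cos-cong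

  Θ-cong : ∀ {x y} → x ≈ y → Θ x ≈ Θ y
  Θ-cong = *-congˡ ∘ sin-cong

  2≉0 : ¬ (fromℕ 2 ≈ 0#)
  2≉0 = #⇒≉ (fromℕ-suc#0 1)

  Y-+ : ∀ x y → fromℕ 2 * Y (x + y) ≈ Y x * Y y - Θ x * Θ y
  Y-+ x y = trans (*-congˡ (*-congˡ (cos-+ x y)))
    (solve 4 (λ a b c d → con (+ 2) :* (con (+ 2) :* (a :* b :- c :* d)) := con (+ 2) :* a :* (con (+ 2) :* b) :- con (+ 2) :* c :* (con (+ 2) :* d))
      refl (cos x) (cos y) (sin x) (sin y))

  Θ-+ : ∀ x y → fromℕ 2 * Θ (x + y) ≈ Θ x * Y y + Y x * Θ y
  Θ-+ x y = trans (*-congˡ (*-congˡ (sin-+ x y)))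
    (solve 4 (λ a b c d → con (+ 2) :* (con (+ 2) :* (a :* b :+ c :* d)) := con (+ 2) :* a :* (con (+ 2) :* b) :+ con (+ 2) :* c :* (con (+ 2) :* d))
      refl (sin x) (cos y) (cos x) (sin y))

  Y²+Θ² : ∀ x → Y x * Y x + Θ x * Θ x ≈ fromℕ 4
  Y²+Θ² x = begin
    Y x * Y x + Θ x * Θ x
      ≈⟨ solve 2 (λ a b → con (+ 2) :* a :* (con (+ 2) :* a) :+ con (+ 2) :* b :* (con (+ 2) :* b) := con (+ 4) :* (a :* a :+ b :* b)) refl (cos x) (sin x) ⟩
    fromℕ 4 * (cos x * cos x + sin x * sin x)   ≈⟨ *-congˡ (cos²+sin² x) ⟩
    fromℕ 4 * 1#                                ≈⟨ *-identityʳ _ ⟩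
    fromℕ 4                                     ∎

  -- Replaces reduction modulo a known relation e ≈ 0: the cofactor k is supplied by hand, and the
  -- remaining polynomial identity is left to the solver.
  modulo : ∀ {l r k e} → e ≈ 0# → l ≈ r + k * e → l ≈ r
  modulo {r = r} {k} e≈0 eq = trans eq (trans (+-congˡ (trans (*-congˡ e≈0) (zeroʳ k))) (+-identityʳ r))

  private
    rel : ∀ x → Y x * Y x + Θ x * Θ x - fromℕ 4 ≈ 0#
    rel x = x≈y⇒x-y≈0 (Y²+Θ² x)

  Y-double : ∀ x → Y (x + x) ≈ Y x * Y x - fromℕ 2
  Y-double x = ≉0-cancel 2≉0 (trans (Y-+ x x) (modulo {k = - 1#} (rel x) (trans
    (solve 2 (λ y t → y :* y :- t :* t := con (+ 2) :* (y :* y :- con (+ 2)) :+ :- con (+ 1) :* (y :* y :+ t :* t :- con (+ 4))) refl (Y x) (Θ x))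
    (+-congˡ (*-congʳ (-‿cong 1≈))))))

  Θ-double : ∀ x → Θ (x + x) ≈ Y x * Θ x
  Θ-double x = ≉0-cancel 2≉0 (trans (Θ-+ x x)
    (solve 2 (λ y t → t :* y :+ y :* t := con (+ 2) :* (y :* t)) refl (Y x) (Θ x)))

  Y-triple : ∀ x → Y (x + x + x) ≈ Y x * Y x * Y x - fromℕ 3 * Y x
  Y-triple x = ≉0-cancel 2≉0 (trans (Y-+ (x + x) x) (trans (+-cong (*-congʳ (Y-double x)) (-‿cong (*-congʳ (Θ-double x))))
    (modulo {k = - Y x} (rel x)
      (solve 2 (λ y t → (y :* y :- con (+ 2)) :* y :- y :* t :* t
                     := con (+ 2) :* (y :* y :* y :- con (+ 3) :* y) :+ :- y :* (y :* y :+ t :* t :- con (+ 4))) refl (Y x) (Θ x)))))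

  Θ-triple : ∀ x → Θ (x + x + x) ≈ fromℕ 3 * Θ x - Θ x * Θ x * Θ x
  Θ-triple x = ≉0-cancel 2≉0 (trans (Θ-+ (x + x) x) (trans (+-cong (*-congʳ (Θ-double x)) (*-congʳ (Y-double x)))
    (modulo {k = fromℕ 2 * Θ x} (rel x)
      (solve 2 (λ y t → y :* t :* y :+ (y :* y :- con (+ 2)) :* t
                     := con (+ 2) :* (con (+ 3) :* t :- t :* t :* t) :+ con (+ 2) :* t :* (y :* y :+ t :* t :- con (+ 4))) refl (Y x) (Θ x)))))

  Y-quintuple : ∀ x → Y (x + x + (x + x + x)) ≈ Y x * Y x * Y x * Y x * Y x - fromℕ 5 * (Y x * Y x * Y x) + fromℕ 5 * Y x
  Y-quintuple x = ≉0-cancel 2≉0 (trans (Y-+ (x + x) (x + x + x))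
    (trans (+-cong (*-cong (Y-double x) (Y-triple x)) (-‿cong (*-cong (Θ-double x) (Θ-triple x))))
    (modulo {k = Y x * (Θ x * Θ x - (Y x * Y x - fromℕ 1))} (rel x)
      (solve 2 (λ y t → (y :* y :- con (+ 2)) :* (y :* y :* y :- con (+ 3) :* y) :- y :* t :* (con (+ 3) :* t :- t :* t :* t)
                     := con (+ 2) :* (y :* y :* y :* y :* y :- con (+ 5) :* (y :* y :* y) :+ con (+ 5) :* y)
                        :+ y :* (t :* t :- (y :* y :- con (+ 1))) :* (y :* y :+ t :* t :- con (+ 4))) refl (Y x) (Θ x)))))

  Θ-pos : ∀ n a b → suc a ℕ.+ suc b ≡ suc n → 0# < Θ (angle n (suc a))
  Θ-pos n a b eq = *-pos (fromℕ-pos 1) (sin-angle-pos n a b eq)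

  0<⇒≉0 : ∀ {x} → 0# < x → ¬ (x ≈ 0#)
  0<⇒≉0 0<x x≈0 = <-irrefl (<-resp refl x≈0 0<x)

  0<-+ : ∀ {x y} → 0# < x → 0# < y → 0# < x + y
  0<-+ {x} {y} 0<x 0<y = <-trans 0<x (<-resp (+-identityʳ x) refl (+-monoʳ-< x 0<y))

  2sinπ≈0 : Θ π ≈ 0#
  2sinπ≈0 = trans (*-congˡ sin-π) (zeroʳ _)

  -- (r + s)(r - s) = 0, and r + s cannot vanish since r = -s would be negative.
  sqrt-unique : ∀ {x r s} → 0≤ r → 0# < s → r * r ≈ x → s * s ≈ x → r ≈ s
  sqrt-unique {x} {r} {s} 0≤r 0<s r² s² = x-y≈0⇒x≈y (integral r+s≉0 (trans
    (solve 2 (λ r s → (r :+ s) :* (r :- s) := r :* r :- s :* s) refl r s) (x≈y⇒x-y≈0 (trans r² (sym s²)))))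
    where
    r+s≉0 : ¬ (r + s ≈ 0#)
    r+s≉0 eq = 0≤r (<-resp (begin
      - s              ≈⟨ +-identityʳ _ ⟨
      - s + 0#         ≈⟨ +-congˡ eq ⟨
      - s + (r + s)    ≈⟨ solve 2 (λ r s → :- s :+ (r :+ s) := r) refl r s ⟩
      r                ∎) refl (neg-<′ 0<s))

  -- Θ(180°) = Y(90°)Θ(90°) vanishes while Θ(90°) is positive.
  Y90≈0 : Y (90 °) ≈ 0#
  Y90≈0 = integral (0<⇒≉0 (Θ-pos 179 89 89 ≡.refl)) (trans (*-comm _ _) (begin
    Y (90 °) * Θ (90 °)     ≈⟨ Θ-double (90 °) ⟨
    Θ (90 ° + 90 °)         ≈⟨ Θ-cong (trans (angle-+ 179 90 90 180 ≡.refl) (angle-π 179)) ⟩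
    Θ π                     ≈⟨ 2sinπ≈0 ⟩
    0#                      ∎))

  √3 : Carrier
  √3 = Θ (60 °)

  0<√3 : 0# < √3
  0<√3 = Θ-pos 179 59 119 ≡.refl

  -- The triple angle formula at 180° = 3 · 60° gives √3(3 - √3²) = 0.
  √3*√3≈3 : √3 * √3 ≈ fromℕ 3
  √3*√3≈3 = sym (x-y≈0⇒x≈y (integral (0<⇒≉0 0<√3) (begin
    √3 * (fromℕ 3 - √3 * √3)             ≈⟨ solve 1 (λ t → t :* (con (+ 3) :- t :* t) := con (+ 3) :* t :- t :* t :* t) refl √3 ⟩
    fromℕ 3 * √3 - √3 * √3 * √3          ≈⟨ Θ-triple (60 °) ⟨
    Θ (60 ° + 60 ° + 60 °)               ≈⟨ Θ-cong (trans (+-congʳ (angle-+ 179 60 60 120 ≡.refl)) (trans (angle-+ 179 120 60 180 ≡.refl) (angle-π 179))) ⟩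
    Θ π                                  ≈⟨ 2sinπ≈0 ⟩
    0#                                   ∎)))

  Θ120≈YΘ : Θ (120 °) ≈ Y (60 °) * √3
  Θ120≈YΘ = trans (Θ-cong (sym (angle-+ 179 60 60 120 ≡.refl))) (Θ-double (60 °))

  -- Y² = 1, and the sign is decided by a sine: Y = -1 would give 2 sin 120° = -√3, whereas both
  -- sines are positive.
  Y60≈1 : Y (60 °) ≈ 1#
  Y60≈1 = x-y≈0⇒x≈y (integral Y+1≉0 (begin
    (Y (60 °) + 1#) * (Y (60 °) - 1#)      ≈⟨ *-cong (+-congˡ (sym 1≈)) (+-congˡ (-‿cong (sym 1≈))) ⟩
    (Y (60 °) + fromℕ 1) * (Y (60 °) - fromℕ 1)
      ≈⟨ solve 2 (λ y t → (y :+ con (+ 1)) :* (y :- con (+ 1)) := y :* y :+ t :- con (+ 4) :- (t :- con (+ 3))) refl (Y (60 °)) (√3 * √3) ⟩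
    Y (60 °) * Y (60 °) + √3 * √3 - fromℕ 4 - (√3 * √3 - fromℕ 3)
      ≈⟨ +-cong (rel (60 °)) (-‿cong (x≈y⇒x-y≈0 √3*√3≈3)) ⟩
    0# - 0#                                ≈⟨ -‿inverseʳ 0# ⟩
    0#                                     ∎))
    where
    Y+1≉0 : ¬ (Y (60 °) + 1# ≈ 0#)
    Y+1≉0 eq = 0<⇒≉0 (0<-+ 0<√3 (Θ-pos 179 119 59 ≡.refl)) (begin
      √3 + Θ (120 °)                ≈⟨ +-congˡ Θ120≈YΘ ⟩
      √3 + Y (60 °) * √3            ≈⟨ solve 2 (λ y t → t :+ y :* t := (y :+ con (+ 1)) :* t) refl (Y (60 °)) √3 ⟩
      (Y (60 °) + fromℕ 1) * √3     ≈⟨ *-congʳ (+-congˡ 1≈) ⟩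
      (Y (60 °) + 1#) * √3          ≈⟨ *-congʳ eq ⟩
      0# * √3                       ≈⟨ zeroˡ _ ⟩
      0#                            ∎)

  Θ120≈√3 : Θ (120 °) ≈ √3
  Θ120≈√3 = trans Θ120≈YΘ (trans (*-congʳ Y60≈1) (*-identityˡ √3))

  Y120≈-1 : Y (120 °) ≈ - 1#
  Y120≈-1 = begin
    Y (120 °)                        ≈⟨ Y-cong (sym (angle-+ 179 60 60 120 ≡.refl)) ⟩
    Y (60 ° + 60 °)                  ≈⟨ Y-double (60 °) ⟩
    Y (60 °) * Y (60 °) - fromℕ 2    ≈⟨ +-congʳ (*-cong (trans Y60≈1 (sym 1≈)) (trans Y60≈1 (sym 1≈))) ⟩
    fromℕ 1 * fromℕ 1 - fromℕ 2      ≈⟨ solve 0 (con (+ 1) :* con (+ 1) :- con (+ 2) := :- con (+ 1)) refl ⟩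
    - fromℕ 1                        ≈⟨ -‿cong 1≈ ⟩
    - 1#                             ∎

  Y240≈-1 : Y (240 °) ≈ - 1#
  Y240≈-1 = begin
    Y (240 °)                          ≈⟨ Y-cong (sym (angle-+ 179 120 120 240 ≡.refl)) ⟩
    Y (120 ° + 120 °)                  ≈⟨ Y-double (120 °) ⟩
    Y (120 °) * Y (120 °) - fromℕ 2    ≈⟨ +-congʳ (*-cong Y120≈-1′ Y120≈-1′) ⟩
    - fromℕ 1 * - fromℕ 1 - fromℕ 2    ≈⟨ solve 0 (:- con (+ 1) :* :- con (+ 1) :- con (+ 2) := :- con (+ 1)) refl ⟩
    - fromℕ 1                          ≈⟨ -‿cong 1≈ ⟩
    - 1#                               ∎
    where
    Y120≈-1′ : Y (120 °) ≈ - fromℕ 1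
    Y120≈-1′ = trans Y120≈-1 (-‿cong (sym 1≈))

  Θ240≈-√3 : Θ (240 °) ≈ - √3
  Θ240≈-√3 = begin
    Θ (240 °)                ≈⟨ Θ-cong (sym (angle-+ 179 120 120 240 ≡.refl)) ⟩
    Θ (120 ° + 120 °)        ≈⟨ Θ-double (120 °) ⟩
    Y (120 °) * Θ (120 °)    ≈⟨ *-cong Y120≈-1 Θ120≈√3 ⟩
    - 1# * √3                ≈⟨ -‿distribˡ-* 1# √3 ⟨
    - (1# * √3)              ≈⟨ -‿cong (*-identityˡ √3) ⟩
    - √3                     ∎

  √2 : Carrier
  √2 = Y (45 °)

  √2*√2≈2 : √2 * √2 ≈ fromℕ 2
  √2*√2≈2 = x-y≈0⇒x≈y (trans (sym (Y-double (45 °)))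
    (trans (Y-cong (angle-+ 179 45 45 90 ≡.refl)) Y90≈0))

  -- The square of the difference is (y² + θ² - 4) - 2(yθ - 2), and yθ = 2 sin 90° = 2. The
  -- positivity of √2, a cosine, is then inherited from the sine.
  Θ45≈√2 : Θ (45 °) ≈ √2
  Θ45≈√2 = x-y≈0⇒x≈y (≈-stable λ ≉0 → ≉0 (integral ≉0 (begin
    (Θ (45 °) - √2) * (Θ (45 °) - √2)
      ≈⟨ solve 2 (λ y t → (t :- y) :* (t :- y) := y :* y :+ t :* t :- con (+ 4) :- con (+ 2) :* (y :* t :- con (+ 2))) refl √2 (Θ (45 °)) ⟩
    √2 * √2 + Θ (45 °) * Θ (45 °) - fromℕ 4 - fromℕ 2 * (√2 * Θ (45 °) - fromℕ 2)
      ≈⟨ +-cong (rel (45 °)) (-‿cong (*-congˡ YΘ≈2)) ⟩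
    0# - fromℕ 2 * 0#                          ≈⟨ solve 1 (λ z → z :- con (+ 2) :* z := :- z) refl 0# ⟩
    - 0#                                       ≈⟨ -0#≈0# ⟩
    0#                                         ∎)))
    where
    Θ90≈2 : Θ (90 °) - fromℕ 2 ≈ 0#
    Θ90≈2 = integral (0<⇒≉0 (0<-+ (Θ-pos 179 89 89 ≡.refl) (fromℕ-pos 1))) (begin
      (Θ (90 °) + fromℕ 2) * (Θ (90 °) - fromℕ 2)
        ≈⟨ solve 2 (λ y t → (t :+ con (+ 2)) :* (t :- con (+ 2)) := y :* y :+ t :* t :- con (+ 4) :- y :* y) refl (Y (90 °)) (Θ (90 °)) ⟩
      Y (90 °) * Y (90 °) + Θ (90 °) * Θ (90 °) - fromℕ 4 - Y (90 °) * Y (90 °)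
        ≈⟨ +-cong (rel (90 °)) (-‿cong (*-congʳ Y90≈0)) ⟩
      0# - 0# * Y (90 °)            ≈⟨ +-congˡ (-‿cong (zeroˡ _)) ⟩
      0# - 0#                       ≈⟨ -‿inverseʳ 0# ⟩
      0#                            ∎)
    YΘ≈2 : √2 * Θ (45 °) - fromℕ 2 ≈ 0#
    YΘ≈2 = trans (+-congʳ (trans (sym (Θ-double (45 °))) (Θ-cong (angle-+ 179 45 45 90 ≡.refl)))) Θ90≈2

  0<√2 : 0# < √2
  0<√2 = <-resp refl Θ45≈√2 (Θ-pos 179 44 134 ≡.refl)

  private
    60°≈ : 20 ° + 20 ° + 20 ° ≈ 60 °
    60°≈ = trans (+-congʳ (angle-+ 179 20 20 40 ≡.refl)) (angle-+ 179 40 20 60 ≡.refl)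

  Y20-cubic : Y (20 °) * Y (20 °) * Y (20 °) - fromℕ 3 * Y (20 °) ≈ 1#
  Y20-cubic = trans (sym (Y-triple (20 °))) (trans (Y-cong 60°≈) Y60≈1)

  Θ20-cubic : fromℕ 3 * Θ (20 °) - Θ (20 °) * Θ (20 °) * Θ (20 °) ≈ √3
  Θ20-cubic = trans (sym (Θ-triple (20 °))) (Θ-cong 60°≈)

  -- From 20° = 60° - 40°.
  √3Θ20 : √3 * Θ (20 °) ≈ fromℕ 2 * (Y (20 °) * Y (20 °) - fromℕ 2) - Y (20 °)
  √3Θ20 = ≉0-cancel y≉0 (x-y≈0⇒x≈y (begin
    y * (√3 * t) - y * (fromℕ 2 * (y * y - fromℕ 2) - y)
      ≈⟨ solve 3 (λ y t s → y :* (s :* t) :- y :* (con (+ 2) :* (y :* y :- con (+ 2)) :- y)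
           := con (+ 1) :* (y :* y :- con (+ 2)) :+ s :* (y :* t) :- con (+ 2) :* y :- con (+ 2) :* (y :* y :* y :- con (+ 3) :* y :- con (+ 1))) refl y t √3 ⟩
    fromℕ 1 * (y * y - fromℕ 2) + √3 * (y * t) - fromℕ 2 * y - fromℕ 2 * (y * y * y - fromℕ 3 * y - fromℕ 1)
      ≈⟨ +-cong (+-congʳ (+-cong (*-cong (trans 1≈ (sym Y60≈1)) (sym (Y-double (20 °)))) (*-congˡ (sym (Θ-double (20 °))))))
                (-‿cong (*-congˡ (x≈y⇒x-y≈0 (trans Y20-cubic (sym 1≈))))) ⟩
    Y (60 °) * Y (20 ° + 20 °) + √3 * Θ (20 ° + 20 °) - fromℕ 2 * y - fromℕ 2 * 0#
      ≈⟨ +-cong (+-congʳ difference) (-‿cong (zeroʳ _)) ⟩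
    fromℕ 2 * y - fromℕ 2 * y - 0#     ≈⟨ +-congʳ (-‿inverseʳ _) ⟩
    0# - 0#                            ≈⟨ -‿inverseʳ 0# ⟩
    0#                                 ∎))
    where
    y = Y (20 °)
    t = Θ (20 °)
    y≉0 : ¬ (y ≈ 0#)
    y≉0 y≈0 = 0<⇒≉0 0<1 (begin
      1#                           ≈⟨ Y20-cubic ⟨
      y * y * y - fromℕ 3 * y      ≈⟨ solve 1 (λ y → y :* y :* y :- con (+ 3) :* y := (y :* y :- con (+ 3)) :* y) refl y ⟩
      (y * y - fromℕ 3) * y        ≈⟨ *-congˡ y≈0 ⟩
      (y * y - fromℕ 3) * 0#       ≈⟨ zeroʳ _ ⟩
      0#                           ∎)
    difference : Y (60 °) * Y (20 ° + 20 °) + √3 * Θ (20 ° + 20 °) ≈ fromℕ 2 * y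
    difference = begin
      Y (60 °) * Y (20 ° + 20 °) + √3 * Θ (20 ° + 20 °)
        ≈⟨ +-cong (*-congˡ (*-congˡ (cos-neg (20 ° + 20 °)))) (*-congˡ (trans (-‿cong (*-congˡ (sin-neg (20 ° + 20 °)))) (solve 1 (λ s → :- (con (+ 2) :* :- s) := con (+ 2) :* s) refl (sin (20 ° + 20 °))))) ⟨
      Y (60 °) * Y (- (20 ° + 20 °)) + √3 * - Θ (- (20 ° + 20 °))
        ≈⟨ +-congˡ (-‿distribʳ-* _ _) ⟨
      Y (60 °) * Y (- (20 ° + 20 °)) - √3 * Θ (- (20 ° + 20 °))
        ≈⟨ Y-+ (60 °) (- (20 ° + 20 °)) ⟨
      fromℕ 2 * Y (60 ° - (20 ° + 20 °))
        ≈⟨ *-congˡ (Y-cong (trans (+-congʳ (sym 60°≈)) (solve 1 (λ a → a :+ a :+ a :- (a :+ a) := a) refl (20 °)))) ⟩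
      fromℕ 2 * y ∎

  α₁₁ : Carrier
  α₁₁ = (+ 2 ℚ./ 11) · π

  0<Θ₁₁ : 0# < Θ α₁₁
  0<Θ₁₁ = Θ-pos 10 1 8 ≡.refl

  -- 6α + 5α = 2π forces Y(6α) = Y(5α), an equation of degree 6 for y. Its trivial root 2 splits
  -- off, and y ≠ 2 since θ² = 4 - y² is positive.
  Y₁₁-quintic : let y = Y α₁₁ in
    y * y * y * y * y + y * y * y * y - fromℕ 4 * (y * y * y) - fromℕ 3 * (y * y) + fromℕ 3 * y + fromℕ 1 ≈ 0#
  Y₁₁-quintic = integral y-2≉0 (trans
    (solve 1 (λ y → (y :- con (+ 2)) :* (y :* y :* y :* y :* y :+ y :* y :* y :* y :- con (+ 4) :* (y :* y :* y) :- con (+ 3) :* (y :* y) :+ con (+ 3) :* y :+ con (+ 1))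
                 := (y :* y :* y :- con (+ 3) :* y) :* (y :* y :* y :- con (+ 3) :* y) :- con (+ 2)
                    :- (y :* y :* y :* y :* y :- con (+ 5) :* (y :* y :* y) :+ con (+ 5) :* y)) refl (Y α₁₁))
    (x≈y⇒x-y≈0 (begin
      (Y α₁₁ * Y α₁₁ * Y α₁₁ - fromℕ 3 * Y α₁₁) * (Y α₁₁ * Y α₁₁ * Y α₁₁ - fromℕ 3 * Y α₁₁) - fromℕ 2
        ≈⟨ +-congʳ (*-cong (Y-triple α₁₁) (Y-triple α₁₁)) ⟨
      Y (3α) * Y (3α) - fromℕ 2    ≈⟨ Y-double (3α) ⟨
      Y (3α + 3α)                  ≈⟨ Y-cong (trans 6α (trans (solve 2 (λ p x → p := p :+ x :- x) refl (angle 10 12) (angle 10 10)) (+-congʳ fullTurn))) ⟩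
      Y (π + π - angle 10 10)      ≈⟨ reflect (angle 10 10) ⟩
      Y (angle 10 10)              ≈⟨ Y-cong 5α ⟨
      Y (α₁₁ + α₁₁ + 3α)           ≈⟨ Y-quintuple α₁₁ ⟩
      Y α₁₁ * Y α₁₁ * Y α₁₁ * Y α₁₁ * Y α₁₁ - fromℕ 5 * (Y α₁₁ * Y α₁₁ * Y α₁₁) + fromℕ 5 * Y α₁₁ ∎)))
    where
    3α : Carrier
    3α = α₁₁ + α₁₁ + α₁₁
    2α≈ : α₁₁ + α₁₁ ≈ angle 10 4
    2α≈ = angle-+ 10 2 2 4 ≡.refl
    3α≈ : 3α ≈ angle 10 6
    3α≈ = trans (+-congʳ 2α≈) (angle-+ 10 4 2 6 ≡.refl)
    6α : 3α + 3α ≈ angle 10 12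
    6α = trans (+-cong 3α≈ 3α≈) (angle-+ 10 6 6 12 ≡.refl)
    5α : α₁₁ + α₁₁ + 3α ≈ angle 10 10
    5α = trans (+-cong 2α≈ 3α≈) (angle-+ 10 4 6 10 ≡.refl)
    fullTurn : angle 10 12 + angle 10 10 ≈ π + π
    fullTurn = trans (angle-+ 10 12 10 22 ≡.refl) (trans (sym (angle-+ 10 11 11 22 ≡.refl)) (+-cong (angle-π 10) (angle-π 10)))
    Y2π≈2 : Y (π + π) ≈ fromℕ 2
    Y2π≈2 = trans (Y-double π) (trans (solve 2 (λ y t → y :* y :- con (+ 2) := y :* y :+ t :* t :- con (+ 4) :+ (con (+ 2) :- t :* t)) refl (Y π) (Θ π))
      (trans (+-cong (rel π) (+-congˡ (trans (-‿cong (trans (*-congʳ 2sinπ≈0) (zeroˡ _))) -0#≈0#))) (trans (+-identityˡ _) (+-identityʳ _))))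
    reflect : ∀ x → Y (π + π - x) ≈ Y x
    reflect x = ≉0-cancel 2≉0 (begin
      fromℕ 2 * Y (π + π - x)                        ≈⟨ Y-+ (π + π) (- x) ⟩
      Y (π + π) * Y (- x) - Θ (π + π) * Θ (- x)      ≈⟨ +-cong (*-cong Y2π≈2 (*-congˡ (cos-neg x))) (-‿cong (*-congʳ (trans (Θ-double π) (trans (*-congˡ 2sinπ≈0) (zeroʳ _))))) ⟩
      fromℕ 2 * Y x - 0# * Θ (- x)                   ≈⟨ +-congˡ (trans (-‿cong (zeroˡ _)) -0#≈0#) ⟩
      fromℕ 2 * Y x + 0#                             ≈⟨ +-identityʳ _ ⟩
      fromℕ 2 * Y x                                  ∎)
    y-2≉0 : ¬ (Y α₁₁ - fromℕ 2 ≈ 0#)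
    y-2≉0 eq = 0<⇒≉0 (*-pos 0<Θ₁₁ 0<Θ₁₁) (begin
      Θ α₁₁ * Θ α₁₁
        ≈⟨ solve 2 (λ y t → t :* t := y :* y :+ t :* t :- con (+ 4) :- (y :+ con (+ 2)) :* (y :- con (+ 2))) refl (Y α₁₁) (Θ α₁₁) ⟩
      Y α₁₁ * Y α₁₁ + Θ α₁₁ * Θ α₁₁ - fromℕ 4 - (Y α₁₁ + fromℕ 2) * (Y α₁₁ - fromℕ 2)
        ≈⟨ +-cong (rel α₁₁) (-‿cong (trans (*-congˡ eq) (zeroʳ _))) ⟩
      0# - 0#     ≈⟨ -‿inverseʳ 0# ⟩
      0#          ∎)

-- Eisenstein's criterion as linear independence of powers.

module Eisenstein {c ℓ₁ ℓ₂} (ℛ : RealNumbers c ℓ₁ ℓ₂) where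
  open RealNumbers ℛ hiding (zero)
  open Arithmetic ℛ
  open Sums ℛ
  open SetoidReasoning (CommutativeRing.setoid commutativeRing)

  -- A prime ϖ of a ring O of real numbers: U is the complement of ϖO, and no nonzero
  -- element of O is divisible by all powers of ϖ.
  record Place : Set (c ⊔ lsuc ℓ₁) where
    field
      O U    : Pred Carrier ℓ₁
      ϖ      : Carrier
      O-resp : ∀ {x y} → x ≈ y → O x → O y
      O-0    : O 0#
      O-+    : ∀ {x y} → O x → O y → O (x + y)
      O-neg  : ∀ {x} → O x → O (- x)
      O-*    : ∀ {x y} → O x → O y → O (x * y)
      O-ϖ    : O ϖ
      ϖ≉0    : ¬ (ϖ ≈ 0#)
      U⇒O    : ∀ {x} → U x → O x
      U-resp : ∀ {x y} → x ≈ y → U x → U y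
      U-*    : ∀ {x y} → U x → U y → U (x * y)

    P : Pred Carrier _
    P x = ∃[ y ] O y × x ≈ ϖ * y

    field
      split : ∀ {x} → O x → P x ⊎ U x
      U∩P   : ∀ {x} → U x → ¬ P x
      order : ∀ {x} → O x → x ≈ 0# ⊎ ∃[ k ] ∃[ u ] U u × x ≈ ϖ ^ k * u

    P-resp : ∀ {x y} → x ≈ y → P x → P y
    P-resp x≈y (z , Oz , eq) = z , Oz , trans (sym x≈y) eq

    P-+ : ∀ {x y} → P x → P y → P (x + y)
    P-+ (z , Oz , eq) (w , Ow , eq′) = z + w , O-+ Oz Ow , trans (+-cong eq eq′) (sym (distribˡ ϖ z w))

    P-neg : ∀ {x} → P x → P (- x)
    P-neg (z , Oz , eq) = - z , O-neg Oz , trans (-‿cong eq) (-‿distribʳ-* ϖ z)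

    P-*ˡ : ∀ {x y} → P x → O y → P (x * y)
    P-*ˡ {y = y} (z , Oz , eq) Oy = z * y , O-* Oz Oy , trans (*-congʳ eq) (*-assoc ϖ z y)

    P-*ʳ : ∀ {x y} → O x → P y → P (x * y)
    P-*ʳ Ox Py = P-resp (*-comm _ _) (P-*ˡ Py Ox)

    U-+ : ∀ {x y} → U x → P y → U (x + y)
    U-+ {x} {y} Ux Py@(z , Oz , eq) with split (O-+ (U⇒O Ux) (O-resp (sym eq) (O-* O-ϖ Oz)))
    ... | inj₂ U[x+y] = U[x+y]
    ... | inj₁ P[x+y] = ⊥-elim (U∩P Ux (P-resp
      (solve 2 (λ x y → x :+ y :+ :- y := x) refl x y) (P-+ P[x+y] (P-neg Py))))

    U⇒≉0 : ∀ {x} → U x → ¬ (x ≈ 0#)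
    U⇒≉0 Ux x≈0 = U∩P Ux (0# , O-0 , trans x≈0 (sym (zeroʳ ϖ)))

  module _ (𝔭 : Place) where
    open Place 𝔭

    -- Modulo ϖ the matrix is upper triangular with units on the diagonal. Elimination by
    -- cross-multiplication with the pivot row needs no division and preserves this shape; since
    -- units are nonzero, v vanishes from the last entry backwards.
    triangular : ∀ n (N : ℕ → ℕ → Carrier) (v : ℕ → Carrier) →
      (∀ i j → O (N i j)) → (∀ i → U (N i i)) → (∀ i j → j ℕ.< i → P (N i j)) →
      (∀ i → Σ< n (λ j → N i j * v j) ≈ 0#) → ∀ i → i ℕ.< n → v i ≈ 0#
    triangular (suc n) N v ON UN PN Nv≈0 = λ
      { zero    _         → v₀≈0
      ; (suc i) (s≤s i<n) → tail i i<n
      }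
      where
      p = N 0 0
      N′ : ℕ → ℕ → Carrier
      N′ i j = p * N (suc i) (suc j) + - (N (suc i) 0 * N 0 (suc j))
      S : ℕ → Carrier
      S i = Σ< n (λ j → N i (suc j) * v (suc j))
      row : ∀ i → Σ< n (λ j → N′ i j * v (suc j)) ≈ 0#
      row i = begin
        Σ< n (λ j → N′ i j * v (suc j))
          ≈⟨ Σ<-cong n (λ j → expand p (N (suc i) (suc j)) (N (suc i) 0) (N 0 (suc j)) (v (suc j))) ⟩
        Σ< n (λ j → p * (N (suc i) (suc j) * v (suc j)) + - N (suc i) 0 * (N 0 (suc j) * v (suc j)))
          ≈⟨ Σ<-+ n (λ j → p * (N (suc i) (suc j) * v (suc j))) (λ j → - N (suc i) 0 * (N 0 (suc j) * v (suc j))) ⟩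
        Σ< n (λ j → p * (N (suc i) (suc j) * v (suc j))) + Σ< n (λ j → - N (suc i) 0 * (N 0 (suc j) * v (suc j)))
          ≈⟨ +-cong (Σ<-*ˡ n p (λ j → N (suc i) (suc j) * v (suc j))) (Σ<-*ˡ n (- N (suc i) 0) (λ j → N 0 (suc j) * v (suc j))) ⟩
        p * S (suc i) + - N (suc i) 0 * S 0
          ≈⟨ combine p (S (suc i)) (N (suc i) 0) (S 0) (v 0) ⟩
        p * (N (suc i) 0 * v 0 + S (suc i)) - N (suc i) 0 * (p * v 0 + S 0)
          ≈⟨ +-cong (*-congˡ (Nv≈0 (suc i))) (-‿cong (*-congˡ (Nv≈0 0))) ⟩
        p * 0# - N (suc i) 0 * 0#
          ≈⟨ +-cong (zeroʳ p) (trans (-‿cong (zeroʳ _)) -0#≈0#) ⟩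
        0# + 0#   ≈⟨ +-identityˡ 0# ⟩
        0#        ∎
        where
        expand : ∀ p a b c v → (p * a + - (b * c)) * v ≈ p * (a * v) + - b * (c * v)
        expand = solve 5 (λ p a b c v → (p :* a :+ :- (b :* c)) :* v := p :* (a :* v) :+ :- b :* (c :* v)) refl
        combine : ∀ p s b s₀ v → p * s + - b * s₀ ≈ p * (b * v + s) - b * (p * v + s₀)
        combine = solve 5 (λ p s b s₀ v → p :* s :+ :- b :* s₀ := p :* (b :* v :+ s) :- b :* (p :* v :+ s₀)) refl
      tail : ∀ i → i ℕ.< n → v (suc i) ≈ 0#
      tail = triangular n N′ (v ∘ suc)
        (λ i j → O-+ (O-* (ON 0 0) (ON (suc i) (suc j))) (O-neg (O-* (ON (suc i) 0) (ON 0 (suc j)))))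
        (λ i → U-+ (U-* (UN 0) (UN (suc i))) (P-neg (P-*ˡ (PN (suc i) 0 (s≤s z≤n)) (ON 0 (suc i)))))
        (λ i j j<i → P-+ (P-*ʳ (ON 0 0) (PN (suc i) (suc j) (s≤s j<i))) (P-neg (P-*ˡ (PN (suc i) 0 (s≤s z≤n)) (ON 0 (suc j)))))
        row
      v₀≈0 : v 0 ≈ 0#
      v₀≈0 = integral (U⇒≉0 (UN 0)) (begin
        p * v 0          ≈⟨ +-identityʳ _ ⟨
        p * v 0 + 0#     ≈⟨ +-congˡ S₀≈0 ⟨
        p * v 0 + S 0    ≈⟨ Nv≈0 0 ⟩
        0#               ∎)
        where
        S₀≈0 : S 0 ≈ 0#
        S₀≈0 = trans (Σ<-cong< n (λ j j<n → trans (*-congˡ (tail j j<n)) (zeroʳ _))) (Σ<-0 n (λ _ → refl))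

    -- The hypotheses make t a root of an Eisenstein polynomial of degree m + 1 at ϖ, with the
    -- factor ϖ of the lower coefficients taken out: `Uu₀` says that ϖ² does not divide the constant
    -- term.
    module Independence (m : ℕ) (t : Carrier) (u : ℕ → Carrier)
      (Ou : ∀ i → O (u i)) (Uu₀ : U (u 0)) (t^n : t ^ suc m ≈ ϖ * Σ< (suc m) (λ i → u i * t ^ i)) where

      Relation : (ℕ → Carrier) → Set _
      Relation a = (∀ i → O (a i)) × Σ< (suc m) (λ i → a i * t ^ i) ≈ 0#

      private
        -- Multiplication of Σ aᵢtⁱ by t, where tᵐ⁺¹ is rewritten by the Eisenstein equation; modulo
        -- ϖ it is a mere shift of coefficients.
        times : (ℕ → Carrier) → ℕ → Carrier
        times a zero    = ϖ * (u 0 * a m)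
        times a (suc j) = a j + ϖ * (u (suc j) * a m)

        times-relation : ∀ {a} → Relation a → Relation (times a)
        times-relation {a} (Oa , eq) = O-times , (begin
          ϖ * (u 0 * a m) * 1# + Σ< m (λ j → (a j + ϖ * (u (suc j) * a m)) * (t * t ^ j))
            ≈⟨ +-cong (lemma₀ ϖ (u 0) (a m) 1#) (trans (Σ<-cong m (λ j → lemma (a j) ϖ (u (suc j)) (a m) t (t ^ j)))
                 (Σ<-+ m (λ j → t * (a j * t ^ j)) (λ j → ϖ * a m * (u (suc j) * (t * t ^ j))))) ⟩
          ϖ * a m * (u 0 * 1#) + (Σ< m (λ j → t * (a j * t ^ j)) + Σ< m (λ j → ϖ * a m * (u (suc j) * (t * t ^ j))))
            ≈⟨ +-congˡ (+-cong (Σ<-*ˡ m t (λ j → a j * t ^ j)) (Σ<-*ˡ m (ϖ * a m) (λ j → u (suc j) * (t * t ^ j)))) ⟩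
          ϖ * a m * (u 0 * 1#) + (t * A + ϖ * a m * B)
            ≈⟨ lemma₁ (ϖ) (a m) (u 0 * 1#) t A B ⟩
          t * A + a m * (ϖ * (u 0 * 1# + B))
            ≈⟨ +-congˡ (*-congˡ t^n) ⟨
          t * A + a m * (t * t ^ m)
            ≈⟨ lemma₂ t A (a m) (t ^ m) ⟩
          t * (A + a m * t ^ m)
            ≈⟨ *-congˡ (trans (sym (Σ<-last m (λ i → a i * t ^ i))) eq) ⟩
          t * 0#    ≈⟨ zeroʳ t ⟩
          0#        ∎)
          where
          A = Σ< m (λ j → a j * t ^ j)
          B = Σ< m (λ j → u (suc j) * (t * t ^ j))
          O-times : ∀ i → O (times a i)
          O-times zero    = O-* O-ϖ (O-* (Ou 0) (Oa m))
          O-times (suc j) = O-+ (Oa j) (O-* O-ϖ (O-* (Ou (suc j)) (Oa m)))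
          lemma₀ : ∀ p u a x → p * (u * a) * x ≈ p * a * (u * x)
          lemma₀ = solve 4 (λ p u a x → p :* (u :* a) :* x := p :* a :* (u :* x)) refl
          lemma : ∀ a p u b t s → (a + p * (u * b)) * (t * s) ≈ t * (a * s) + p * b * (u * (t * s))
          lemma = solve 6 (λ a p u b t s → (a :+ p :* (u :* b)) :* (t :* s) := t :* (a :* s) :+ p :* b :* (u :* (t :* s))) refl
          lemma₁ : ∀ p a u t x y → p * a * u + (t * x + p * a * y) ≈ t * x + a * (p * (u + y))
          lemma₁ = solve 6 (λ p a u t x y → p :* a :* u :+ (t :* x :+ p :* a :* y) := t :* x :+ a :* (p :* (u :+ y))) refl
          lemma₂ : ∀ t x a s → t * x + a * (t * s) ≈ t * (x + a * s)
          lemma₂ = solve 4 (λ t x a s → t :* x :+ a :* (t :* s) := t :* (x :+ a :* s)) refl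

        P-carry : ∀ {a} → Relation a → ∀ j → P (ϖ * (u j * a m))
        P-carry {a} (Oa , _) j = u j * a m , O-* (Ou j) (Oa m) , refl

        -- Modulo ϖ, the rows tⁱa form an upper triangular matrix annihilating the powers of t.
        unit-constant : ∀ {a} → Relation a → ¬ U (a 0)
        unit-constant {a} rel Ua₀ = ¬1≈0 (triangular (suc m) N (t ^_)
          (λ i → proj₁ (N-rel i)) N-diagonal N-lower (λ i → proj₂ (N-rel i)) 0 (s≤s z≤n))
          where
          ¬1≈0 : ¬ (1# ≈ 0#)
          ¬1≈0 = #⇒≉ (>⇒# 0<1)
          N : ℕ → ℕ → Carrier
          N zero    = a
          N (suc i) = times (N i)
          N-rel : ∀ i → Relation (N i)
          N-rel zero    = rel
          N-rel (suc i) = times-relation (N-rel i)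
          N-diagonal : ∀ i → U (N i i)
          N-diagonal zero    = Ua₀
          N-diagonal (suc i) = U-+ (N-diagonal i) (P-carry (N-rel i) (suc i))
          N-lower : ∀ i j → j ℕ.< i → P (N i j)
          N-lower (suc i) zero    _         = P-carry (N-rel i) 0
          N-lower (suc i) (suc j) (s≤s j<i) = P-+ (N-lower i j j<i) (P-carry (N-rel i) (suc j))

        quotient : ∀ {a} → Relation a → (∀ i → i ℕ.< suc m → P (a i)) →
          ∃[ b ] Relation b × (∀ i → i ℕ.< suc m → a i ≈ ϖ * b i)
        quotient {a} (Oa , eq) Pa = b , (Ob , integral ϖ≉0 (begin
          ϖ * Σ< (suc m) (λ i → b i * t ^ i)      ≈⟨ Σ<-*ˡ (suc m) ϖ (λ i → b i * t ^ i) ⟨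
          Σ< (suc m) (λ i → ϖ * (b i * t ^ i))
            ≈⟨ Σ<-cong< (suc m) (λ i i<n → trans (sym (*-assoc ϖ (b i) (t ^ i))) (*-congʳ (sym (a≈ϖb i i<n)))) ⟩
          Σ< (suc m) (λ i → a i * t ^ i)          ≈⟨ eq ⟩
          0#                                      ∎)) , a≈ϖb
          where
          b : ℕ → Carrier
          b i with i ℕ.<? suc m
          ... | yes i<n = proj₁ (Pa i i<n)
          -- Beyond the range nothing is known about `a`, but a relation asks for coefficients in O
          -- at every index.
          ... | no  _   = 0#
          Ob : ∀ i → O (b i)
          Ob i with i ℕ.<? suc m
          ... | yes i<n = proj₁ (proj₂ (Pa i i<n))
          ... | no  _   = O-0
          a≈ϖb : ∀ i → i ℕ.< suc m → a i ≈ ϖ * b i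
          a≈ϖb i i<n with i ℕ.<? suc m
          ... | yes p = proj₂ (proj₂ (Pa i p))
          ... | no  p = ⊥-elim (p i<n)

        -- Multiplying by t moves the first unit coefficient up, and finally to the constant term
        -- of a relation divisible by ϖ.
        no-first-unit : ∀ d k {a} → k ℕ.+ d ≡ m → Relation a → (∀ j → j ℕ.< k → P (a j)) → ¬ U (a k)
        no-first-unit zero k {a} k+0≡m rel Pa Ua with ≡.trans (≡.sym (ℕ.+-identityʳ k)) k+0≡m
        ... | ≡.refl = unit-constant (proj₁ (proj₂ q))
            (U-resp (≉0-cancel ϖ≉0 (proj₂ (proj₂ q) 0 (s≤s z≤n))) (U-* Uu₀ Ua))
          where
          q = quotient (times-relation rel) λ
            { zero    _         → P-carry rel 0
            ; (suc j) (s≤s j<k) → P-+ (Pa j j<k) (P-carry rel (suc j))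
            }
        no-first-unit (suc d) k {a} eq rel Pa Ua = no-first-unit d (suc k) (≡.trans (≡.sym (ℕ.+-suc k d)) eq)
          (times-relation rel)
          (λ { zero    _         → P-carry rel 0
             ; (suc j) (s≤s j<k) → P-+ (Pa j j<k) (P-carry rel (suc j)) })
          (U-+ Ua (P-carry rel (suc k)))

        -- Along the coefficients, the first one not divisible by ϖ would be a first unit, which is
        -- excluded.
        divisible : ∀ {a} → Relation a → ∀ k → k ℕ.≤ suc m → ∀ j → j ℕ.< k → P (a j)
        divisible rel (suc k) (s≤s k≤m) j j<k with ℕ.m<1+n⇒m<n∨m≡n j<k
        ... | inj₁ j<k′ = divisible rel k (ℕ.m≤n⇒m≤1+n k≤m) j j<k′
        ... | inj₂ ≡.refl with split (proj₁ rel j)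
        ...   | inj₁ Pa = Pa
        ...   | inj₂ Ua = ⊥-elim (no-first-unit (m ℕ.∸ k) k (ℕ.m+[n∸m]≡n k≤m) rel
                            (divisible rel k (ℕ.m≤n⇒m≤1+n k≤m)) Ua)

        -- All relations are divisible by ϖ. After k divisions the unit x would be a coefficient of
        -- a relation, hence divisible once more.
        descent : ∀ k {a j x} → Relation a → j ℕ.< suc m → U x → ¬ (a j ≈ ϖ ^ k * x)
        descent zero {j = j} rel j<n Ux eq =
          U∩P Ux (P-resp (trans eq (*-identityˡ _)) (divisible rel (suc m) ℕ.≤-refl j j<n))
        descent (suc k) {j = j} rel j<n Ux eq = descent k (proj₁ (proj₂ q)) j<n Ux
          (≉0-cancel ϖ≉0 (trans (sym (proj₂ (proj₂ q) j j<n)) (trans eq (*-assoc _ _ _))))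
          where q = quotient rel (divisible rel (suc m) ℕ.≤-refl)

      independent : ∀ {a} → Relation a → ∀ j → j ℕ.< suc m → a j ≈ 0#
      independent rel j j<n with order (proj₁ rel j)
      ... | inj₁ a≈0                = a≈0
      ... | inj₂ (k , x , Ux , eq) = ⊥-elim (descent k rel j<n Ux eq)

-- Arithmetic of the residue map a + b√3 ↦ a + 5b from ℤ[√3] to ℤ/11, where 5² = 3.
module Residues where
  private
    module ℤS = ℤSolver.+-*-Solver

  residue : ℤ → ℤ → ℤ
  residue a b = a ℤ.+ + 5 ℤ.* b

  size : ℤ → ℤ → ℕ
  size a b = ℤ.∣ a ∣ ℕ.+ ℤ.∣ b ∣

  -- 11(b - q) = 6b - a and 11(2q - b) = 2a - b
  smaller : ∀ a b q → residue a b ≡ q ℤ.* + 11 → .{{ℕ.NonZero (size a b)}} →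
    size (b ℤ.- q) (+ 2 ℤ.* q ℤ.- b) ℕ.< size a b
  smaller a b q eq = ℕ.≰⇒> λ s≤ → ℕ.<⇒≱ (ℕ.*-monoˡ-< (size a b) {7} {11} (from-yes (7 ℕ.<? 11))) (begin
    11 ℕ.* size a b                            ≤⟨ ℕ.*-monoʳ-≤ 11 s≤ ⟩
    11 ℕ.* size e f                            ≡⟨ ℕ.*-distribˡ-+ 11 ℤ.∣ e ∣ ℤ.∣ f ∣ ⟩
    11 ℕ.* ℤ.∣ e ∣ ℕ.+ 11 ℕ.* ℤ.∣ f ∣          ≡⟨ ≡.cong₂ ℕ._+_ (ℤ.abs-* (+ 11) e) (ℤ.abs-* (+ 11) f) ⟨
    ℤ.∣ + 11 ℤ.* e ∣ ℕ.+ ℤ.∣ + 11 ℤ.* f ∣      ≡⟨ ≡.cong₂ (λ i j → ℤ.∣ i ∣ ℕ.+ ℤ.∣ j ∣) 11c 11d ⟩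
    ℤ.∣ + 6 ℤ.* b ℤ.- a ∣ ℕ.+ ℤ.∣ + 2 ℤ.* a ℤ.- b ∣
      ≤⟨ ℕ.+-mono-≤ (ℤ.∣i-j∣≤∣i∣+∣j∣ (+ 6 ℤ.* b) a) (ℤ.∣i-j∣≤∣i∣+∣j∣ (+ 2 ℤ.* a) b) ⟩
    (ℤ.∣ + 6 ℤ.* b ∣ ℕ.+ A) ℕ.+ (ℤ.∣ + 2 ℤ.* a ∣ ℕ.+ B)
      ≡⟨ ≡.cong₂ (λ i j → (i ℕ.+ A) ℕ.+ (j ℕ.+ B)) (ℤ.abs-* (+ 6) b) (ℤ.abs-* (+ 2) a) ⟩
    (6 ℕ.* B ℕ.+ A) ℕ.+ (2 ℕ.* A ℕ.+ B)        ≤⟨ ℕ.m≤m+n _ (4 ℕ.* A) ⟩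
    (6 ℕ.* B ℕ.+ A) ℕ.+ (2 ℕ.* A ℕ.+ B) ℕ.+ 4 ℕ.* A  ≡⟨ collect A B ⟩
    7 ℕ.* size a b                             ∎)
    where
    open ℕ.≤-Reasoning
    open ℤS using () renaming (con to con′; _:*_ to _⊗_; _:+_ to _⊕_; _:-_ to _⊖_; _:=_ to _⊜_)
    e f : ℤ
    e = b ℤ.- q
    f = + 2 ℤ.* q ℤ.- b
    A B : ℕ
    A = ℤ.∣ a ∣
    B = ℤ.∣ b ∣
    collect : ∀ A B → (6 ℕ.* B ℕ.+ A) ℕ.+ (2 ℕ.* A ℕ.+ B) ℕ.+ 4 ℕ.* A ≡ 7 ℕ.* (A ℕ.+ B)
    collect = ℕS.solve 2 (λ A B → (ℕS.con 6 ℕS.:* B ℕS.:+ A) ℕS.:+ (ℕS.con 2 ℕS.:* A ℕS.:+ B) ℕS.:+ ℕS.con 4 ℕS.:* A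
                          ℕS.:= ℕS.con 7 ℕS.:* (A ℕS.:+ B)) ≡.refl
      where module ℕS = ℕSolver.+-*-Solver
    11c : + 11 ℤ.* e ≡ + 6 ℤ.* b ℤ.- a
    11c = ≡.trans (ℤS.solve 2 (λ b q → con′ (+ 11) ⊗ (b ⊖ q) ⊜ con′ (+ 11) ⊗ b ⊖ q ⊗ con′ (+ 11)) ≡.refl b q)
      (≡.trans (≡.cong (λ i → + 11 ℤ.* b ℤ.- i) (≡.sym eq))
        (ℤS.solve 2 (λ a b → con′ (+ 11) ⊗ b ⊖ (a ⊕ con′ (+ 5) ⊗ b) ⊜ con′ (+ 6) ⊗ b ⊖ a) ≡.refl a b))
    11d : + 11 ℤ.* f ≡ + 2 ℤ.* a ℤ.- b
    11d = ≡.trans (ℤS.solve 2 (λ b q → con′ (+ 11) ⊗ (con′ (+ 2) ⊗ q ⊖ b) ⊜ con′ (+ 2) ⊗ (q ⊗ con′ (+ 11)) ⊖ con′ (+ 11) ⊗ b) ≡.refl b q)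
      (≡.trans (≡.cong (λ i → + 2 ℤ.* i ℤ.- + 11 ℤ.* b) (≡.sym eq))
        (ℤS.solve 2 (λ a b → con′ (+ 2) ⊗ (a ⊕ con′ (+ 5) ⊗ b) ⊖ con′ (+ 11) ⊗ b ⊜ con′ (+ 2) ⊗ a ⊖ b) ≡.refl a b))

  -- The residue is multiplicative modulo 11; the correction term comes from 5² = 3 + 2 · 11.
  residue-* : ∀ a b c d → residue a b ℤ.* residue c d
    ≡ residue (a ℤ.* c ℤ.+ + 3 ℤ.* (b ℤ.* d)) (a ℤ.* d ℤ.+ b ℤ.* c) ℤ.+ + 2 ℤ.* (b ℤ.* d) ℤ.* + 11
  residue-* = ℤS.solve 4 (λ a b c d → (a ⊕ con′ (+ 5) ⊗ b) ⊗ (c ⊕ con′ (+ 5) ⊗ d)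
    ⊜ (a ⊗ c ⊕ con′ (+ 3) ⊗ (b ⊗ d)) ⊕ con′ (+ 5) ⊗ (a ⊗ d ⊕ b ⊗ c) ⊕ con′ (+ 2) ⊗ (b ⊗ d) ⊗ con′ (+ 11)) ≡.refl
    where open ℤS using () renaming (con to con′; _:*_ to _⊗_; _:+_ to _⊕_; _:=_ to _⊜_)

  -- The arguments are the coordinates of (1 + 2√3)(c + d√3), so multiples of the prime have residue
  -- 0.
  residue-multiple : ∀ c d → residue (c ℤ.+ + 6 ℤ.* d) (d ℤ.+ + 2 ℤ.* c) ≡ (c ℤ.+ d) ℤ.* + 11
  residue-multiple = ℤS.solve 2 (λ c d → c ⊕ con′ (+ 6) ⊗ d ⊕ con′ (+ 5) ⊗ (d ⊕ con′ (+ 2) ⊗ c) ⊜ (c ⊕ d) ⊗ con′ (+ 11)) ≡.refl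
    where open ℤS using () renaming (con to con′; _:*_ to _⊗_; _:+_ to _⊕_; _:=_ to _⊜_)

-- The places given by a prime p of ℤ and by 1 + 2√3 in ℤ[√3].

module Places {c ℓ₁ ℓ₂} (ℛ : RealNumbers c ℓ₁ ℓ₂) where
  open RealNumbers ℛ hiding (zero)
  open Arithmetic ℛ
  open Eisenstein ℛ
  open Residues
  open SetoidReasoning (CommutativeRing.setoid commutativeRing)

  private
    euclid : ∀ {p} → Prime p → ∀ i j → + p ∣ i ℤ.* j → + p ∣ i ⊎ + p ∣ j
    euclid {p} p-prime i j p∣ij = [ inj₁ ∘ ∣ᵤ⇒∣ , inj₂ ∘ ∣ᵤ⇒∣ ]′
      (euclidsLemma ℤ.∣ i ∣ ℤ.∣ j ∣ p-prime (≡.subst (p ℕ.∣_) (ℤ.abs-* i j) (∣⇒∣ᵤ p∣ij)))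

  module _ (p : ℕ) (p-prime : Prime p) where
    private
      instance
        p-nonZero : ℕ.NonZero p
        p-nonZero = prime⇒nonZero p-prime
        p-nonTrivial : ℕ.NonTrivial p
        p-nonTrivial = prime⇒nonTrivial p-prime

      quotient-smaller : ∀ q .{{_ : ℤ.NonZero q}} → ℤ.∣ q ∣ ℕ.< ℤ.∣ q ℤ.* + p ∣
      quotient-smaller q = ≡.subst (ℤ.∣ q ∣ ℕ.<_) (≡.sym (ℤ.abs-* q (+ p)))
        (ℕ.m<m*n ℤ.∣ q ∣ p (ℕ.nonTrivial⇒n>1 p))

      Unit : Carrier → Set _
      Unit x = ∃[ z ] x ≈ fromℤ z × ¬ (+ p ∣ z)

      Ordered : Carrier → Set _
      Ordered x = x ≈ 0# ⊎ ∃[ k ] ∃[ u ] Unit u × x ≈ fromℕ p ^ k * u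

      fromℤ-multiple : ∀ z q → z ≡ q ℤ.* + p → fromℤ z ≈ fromℕ p * fromℤ q
      fromℤ-multiple z q eq = trans (reflexive (≡.cong fromℤ eq)) (trans (fromℤ-* q (+ p)) (*-comm _ _))

      -- The bound n on the absolute value drives the recursion, in which z is replaced by z/p.
      ord : ∀ n z → ℤ.∣ z ∣ ℕ.≤ n → Ordered (fromℤ z)
      ord zero    z ≤0 = inj₁ (reflexive (≡.cong fromℤ (ℤ.∣i∣≡0⇒i≡0 {z} (ℕ.n≤0⇒n≡0 ≤0))))
      ord (suc n) z ≤n = go (z ℤ.≟ ℤ.0ℤ) (+ p ∣? z)
        where
        go : Dec (z ≡ ℤ.0ℤ) → Dec (+ p ∣ z) → Ordered (fromℤ z)
        go (yes z≡0) _        = inj₁ (reflexive (≡.cong fromℤ z≡0))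
        go (no z≢0)  (no p∤z) = inj₂ (0 , fromℤ z , (z , refl , p∤z) , sym (*-identityˡ _))
        go (no z≢0)  (yes (divides q z≡qp)) =
          [ (λ q≈0 → inj₁ (trans (fromℤ-multiple z q z≡qp) (trans (*-congˡ q≈0) (zeroʳ _))))
          , (λ { (k , u , Uu , eq) → inj₂ (suc k , u , Uu
               , trans (fromℤ-multiple z q z≡qp) (trans (*-congˡ eq) (sym (*-assoc _ _ _)))) })
          ]′ (ord n q (ℕ.≤-pred (ℕ.≤-trans
            (quotient-smaller q {{ℤ.≢-nonZero λ q≡0 → z≢0 (≡.trans z≡qp (≡.cong (ℤ._* + p) {q} {ℤ.0ℤ} q≡0))}})
            (≡.subst (λ i → ℤ.∣ i ∣ ℕ.≤ suc n) z≡qp ≤n))))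

    ℤ-place : Place
    ℤ-place = record
      { O      = λ x → ∃[ z ] x ≈ fromℤ z
      ; U      = Unit
      ; ϖ      = fromℕ p
      ; O-resp = λ { x≈y (z , eq) → z , trans (sym x≈y) eq }
      ; O-0    = + 0 , refl
      ; O-+    = λ { (z , eq) (w , eq′) → z ℤ.+ w , trans (+-cong eq eq′) (sym (fromℤ-+ z w)) }
      ; O-neg  = λ { (z , eq) → ℤ.- z , trans (-‿cong eq) (sym (fromℤ-neg z)) }
      ; O-*    = λ { (z , eq) (w , eq′) → z ℤ.* w , trans (*-cong eq eq′) (sym (fromℤ-* z w)) }
      ; O-ϖ    = + p , refl
      ; ϖ≉0    = λ p≈0 → ℕ.≢-nonZero⁻¹ p (ℤ.+-injective (fromℤ-injective₀ (+ p) p≈0))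
      ; U⇒O    = λ { (z , eq , _) → z , eq }
      ; U-resp = λ { x≈y (z , eq , p∤z) → z , trans (sym x≈y) eq , p∤z }
      ; U-*    = λ { (z , eq , p∤z) (w , eq′ , p∤w) → z ℤ.* w , trans (*-cong eq eq′) (sym (fromℤ-* z w))
                 , λ p∣zw → [ p∤z , p∤w ]′ (euclid p-prime z w p∣zw) }
      ; split  = λ { (z , eq) → split z eq }
      ; U∩P    = λ { (z , eq , p∤z) (y , (w , y≈w) , eq′) → p∤z (divides w (fromℤ-injective z (w ℤ.* + p)
                 (trans (sym eq) (trans eq′ (trans (*-congˡ y≈w) (sym (fromℤ-multiple (w ℤ.* + p) w ≡.refl))))))) }
      ; order  = λ { (z , eq) → order z eq }
      }
      where
      split : ∀ {x} z → x ≈ fromℤ z → (∃[ y ] (∃[ w ] y ≈ fromℤ w) × x ≈ fromℕ p * y) ⊎ Unit x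
      split z eq with + p ∣? z
      ... | no p∤z = inj₂ (z , eq , p∤z)
      ... | yes (divides q z≡qp) = inj₁ (fromℤ q , (q , refl) , trans eq (fromℤ-multiple z q z≡qp))
      order : ∀ {x} z → x ≈ fromℤ z → Ordered x
      order z eq = [ (λ z≈0 → inj₁ (trans eq z≈0)) , (λ { (k , u , Uu , eq′) → inj₂ (k , u , Uu , trans eq eq′) }) ]′
        (ord ℤ.∣ z ∣ z ℕ.≤-refl)

  -- In ℤ[√3] the element 1 + 2√3 has norm -11, and a + b√3 is divisible by it iff 11 ∣ a + 5b.
  module _ (√3 : Carrier) (√3*√3≈3 : √3 * √3 ≈ fromℕ 3)
           (irrational : ∀ a b → fromℤ a + fromℤ b * √3 ≈ 0# → a ≡ + 0 × b ≡ + 0) where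
    private
      module ℤS = ℤSolver.+-*-Solver

      11-prime : Prime 11
      11-prime = from-yes (prime? 11)

      ϖ : Carrier
      ϖ = 1# + fromℕ 2 * √3

      -- Divisibility by the prime is read off from coordinates; irrationality of √3 makes it a
      -- property of the number itself.
      unique : ∀ a b c d → fromℤ a + fromℤ b * √3 ≈ fromℤ c + fromℤ d * √3 → a ≡ c × b ≡ d
      unique a b c d eq = ℤ.i-j≡0⇒i≡j a c (proj₁ differences) , ℤ.i-j≡0⇒i≡j b d (proj₂ differences)
        where
        minus : ∀ i j → fromℤ (i ℤ.- j) ≈ fromℤ i - fromℤ j
        minus i j = trans (fromℤ-+ i (ℤ.- j)) (+-congˡ (fromℤ-neg j))
        rearrange : ∀ a b c d r → (a - c) + (b - d) * r ≈ (a + b * r) - (c + d * r)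
        rearrange = solve 5 (λ a b c d r → (a :- c) :+ (b :- d) :* r := (a :+ b :* r) :- (c :+ d :* r)) refl
        differences : a ℤ.- c ≡ + 0 × b ℤ.- d ≡ + 0
        differences = irrational (a ℤ.- c) (b ℤ.- d) (begin
          fromℤ (a ℤ.- c) + fromℤ (b ℤ.- d) * √3
            ≈⟨ +-cong (minus a c) (*-congʳ (minus b d)) ⟩
          (fromℤ a - fromℤ c) + (fromℤ b - fromℤ d) * √3
            ≈⟨ rearrange (fromℤ a) (fromℤ b) (fromℤ c) (fromℤ d) √3 ⟩
          (fromℤ a + fromℤ b * √3) - (fromℤ c + fromℤ d * √3)
            ≈⟨ x≈y⇒x-y≈0 eq ⟩
          0# ∎)

      product : ∀ a b c d → (fromℤ a + fromℤ b * √3) * (fromℤ c + fromℤ d * √3)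
        ≈ fromℤ (a ℤ.* c ℤ.+ + 3 ℤ.* (b ℤ.* d)) + fromℤ (a ℤ.* d ℤ.+ b ℤ.* c) * √3
      product a b c d = begin
        (A + B * √3) * (C + D * √3)
          ≈⟨ expand A B C D √3 ⟩
        A * C + √3 * √3 * (B * D) + (A * D + B * C) * √3
          ≈⟨ +-congʳ (+-congˡ (*-congʳ √3*√3≈3)) ⟩
        A * C + fromℕ 3 * (B * D) + (A * D + B * C) * √3
          ≈⟨ +-cong (+-cong (fromℤ-* a c) (trans (fromℤ-* (+ 3) (b ℤ.* d)) (*-congˡ (fromℤ-* b d))))
                    (*-congʳ (+-cong (fromℤ-* a d) (fromℤ-* b c))) ⟨
        fromℤ (a ℤ.* c) + fromℤ (+ 3 ℤ.* (b ℤ.* d)) + (fromℤ (a ℤ.* d) + fromℤ (b ℤ.* c)) * √3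
          ≈⟨ +-cong (fromℤ-+ (a ℤ.* c) (+ 3 ℤ.* (b ℤ.* d))) (*-congʳ (fromℤ-+ (a ℤ.* d) (b ℤ.* c))) ⟨
        fromℤ (a ℤ.* c ℤ.+ + 3 ℤ.* (b ℤ.* d)) + fromℤ (a ℤ.* d ℤ.+ b ℤ.* c) * √3 ∎
        where
        A = fromℤ a
        B = fromℤ b
        C = fromℤ c
        D = fromℤ d
        expand : ∀ a b c d r → (a + b * r) * (c + d * r) ≈ a * c + r * r * (b * d) + (a * d + b * c) * r
        expand = solve 5 (λ a b c d r → (a :+ b :* r) :* (c :+ d :* r) := a :* c :+ r :* r :* (b :* d) :+ (a :* d :+ b :* c) :* r) refl

      ϖ≈ : ϖ ≈ fromℤ (+ 1) + fromℤ (+ 2) * √3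
      ϖ≈ = +-congʳ (sym 1≈)

      ϖ-multiple : ∀ c d → ϖ * (fromℤ c + fromℤ d * √3) ≈ fromℤ (c ℤ.+ + 6 ℤ.* d) + fromℤ (d ℤ.+ + 2 ℤ.* c) * √3
      ϖ-multiple c d = trans (*-congʳ ϖ≈) (trans (product (+ 1) (+ 2) c d)
        (reflexive (≡.cong₂ (λ i j → fromℤ i + fromℤ j * √3)
          (ℤS.solve 2 (λ c d → con′ (+ 1) ⊗ c ⊕ con′ (+ 3) ⊗ (con′ (+ 2) ⊗ d) ⊜ c ⊕ con′ (+ 6) ⊗ d) ≡.refl c d)
          (ℤS.solve 2 (λ c d → con′ (+ 1) ⊗ d ⊕ con′ (+ 2) ⊗ c ⊜ d ⊕ con′ (+ 2) ⊗ c) ≡.refl c d))))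
        where open ℤS using () renaming (con to con′; _:*_ to _⊗_; _:+_ to _⊕_; _:=_ to _⊜_)

      -- The quotient of a + b√3 by ϖ when a + 5b = 11q.
      divide : ∀ a b q → residue a b ≡ q ℤ.* + 11 →
        fromℤ a + fromℤ b * √3 ≈ ϖ * (fromℤ (b ℤ.- q) + fromℤ (+ 2 ℤ.* q ℤ.- b) * √3)
      divide a b q eq = sym (trans (ϖ-multiple (b ℤ.- q) (+ 2 ℤ.* q ℤ.- b))
        (reflexive (≡.cong₂ (λ i j → fromℤ i + fromℤ j * √3)
          (≡.trans (ℤS.solve 2 (λ b q → b ⊖ q ⊕ con′ (+ 6) ⊗ (con′ (+ 2) ⊗ q ⊖ b) ⊜ q ⊗ con′ (+ 11) ⊖ con′ (+ 5) ⊗ b) ≡.refl b q)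
            (≡.trans (≡.cong (λ i → i ℤ.- + 5 ℤ.* b) (≡.sym eq))
              (ℤS.solve 2 (λ a b → a ⊕ con′ (+ 5) ⊗ b ⊖ con′ (+ 5) ⊗ b ⊜ a) ≡.refl a b)))
          (ℤS.solve 2 (λ b q → con′ (+ 2) ⊗ q ⊖ b ⊕ con′ (+ 2) ⊗ (b ⊖ q) ⊜ b) ≡.refl b q))))
        where open ℤS using () renaming (con to con′; _:*_ to _⊗_; _:+_ to _⊕_; _:-_ to _⊖_; _:=_ to _⊜_)

      Unit : Carrier → Set _
      Unit x = ∃[ a ] ∃[ b ] x ≈ fromℤ a + fromℤ b * √3 × ¬ (+ 11 ∣ residue a b)

      Ordered : Carrier → Set _
      Ordered x = x ≈ 0# ⊎ ∃[ k ] ∃[ u ] Unit u × x ≈ ϖ ^ k * u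

      size-0 : ∀ a b → size a b ≡ 0 → fromℤ a + fromℤ b * √3 ≈ 0#
      size-0 a b s≡0 = trans (+-cong (reflexive (≡.cong fromℤ (ℤ.∣i∣≡0⇒i≡0 {a} (ℕ.m+n≡0⇒m≡0 ℤ.∣ a ∣ s≡0))))
                             (*-congʳ (reflexive (≡.cong fromℤ (ℤ.∣i∣≡0⇒i≡0 {b} (ℕ.m+n≡0⇒n≡0 ℤ.∣ a ∣ s≡0))))))
        (trans (+-identityˡ _) (zeroˡ √3))

      -- As for ℤ, with |a| + |b| as measure: the quotient by ϖ has size at most (3|a| + 7|b|)/11.
      ord : ∀ n a b → size a b ℕ.≤ n → Ordered (fromℤ a + fromℤ b * √3)
      ord zero    a b ≤0 = inj₁ (size-0 a b (ℕ.n≤0⇒n≡0 ≤0))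
      ord (suc n) a b ≤n = go (size a b ℕ.≟ 0) (+ 11 ∣? residue a b)
        where
        go : Dec (size a b ≡ 0) → Dec (+ 11 ∣ residue a b) → Ordered (fromℤ a + fromℤ b * √3)
        go (yes s≡0) _                   = inj₁ (size-0 a b s≡0)
        go (no s≢0)  (no ∤)              = inj₂ (0 , _ , (a , b , refl , ∤) , sym (*-identityˡ _))
        go (no s≢0)  (yes (divides q eq)) =
          [ (λ ≈0 → inj₁ (trans (divide a b q eq) (trans (*-congˡ ≈0) (zeroʳ ϖ))))
          , (λ { (k , u , Uu , eq′) → inj₂ (suc k , u , Uu
               , trans (divide a b q eq) (trans (*-congˡ eq′) (sym (*-assoc _ _ _)))) })
          ]′ (ord n (b ℤ.- q) (+ 2 ℤ.* q ℤ.- b)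
               (ℕ.≤-pred (ℕ.≤-trans (smaller a b q eq {{ℕ.≢-nonZero s≢0}}) ≤n)))

    ℤ[√3]-place : Place
    ℤ[√3]-place = record
      { O      = λ x → ∃[ a ] ∃[ b ] x ≈ fromℤ a + fromℤ b * √3
      ; U      = Unit
      ; ϖ      = ϖ
      ; O-resp = λ { x≈y (a , b , eq) → a , b , trans (sym x≈y) eq }
      ; O-0    = + 0 , + 0 , sym (trans (+-identityˡ _) (zeroˡ √3))
      ; O-+    = λ { (a , b , eq) (c , d , eq′) → a ℤ.+ c , b ℤ.+ d , trans (+-cong eq eq′)
                 (trans (addition (fromℤ a) (fromℤ b) (fromℤ c) (fromℤ d) √3)
                   (sym (+-cong (fromℤ-+ a c) (*-congʳ (fromℤ-+ b d))))) }
      ; O-neg  = λ { (a , b , eq) → ℤ.- a , ℤ.- b , trans (-‿cong eq)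
                 (trans (negative (fromℤ a) (fromℤ b) √3) (sym (+-cong (fromℤ-neg a) (*-congʳ (fromℤ-neg b))))) }
      ; O-*    = λ { (a , b , eq) (c , d , eq′) → a ℤ.* c ℤ.+ + 3 ℤ.* (b ℤ.* d) , a ℤ.* d ℤ.+ b ℤ.* c
                 , trans (*-cong eq eq′) (product a b c d) }
      ; O-ϖ    = + 1 , + 2 , ϖ≈
      ; ϖ≉0    = λ ϖ≈0 → 1≢0 (proj₁ (irrational (+ 1) (+ 2) (trans (sym ϖ≈) ϖ≈0)))
      ; U⇒O    = λ { (a , b , eq , _) → a , b , eq }
      ; U-resp = λ { x≈y (a , b , eq , ∤) → a , b , trans (sym x≈y) eq , ∤ }
      ; U-*    = λ { (a , b , eq , ∤) (c , d , eq′ , ∤′) → a ℤ.* c ℤ.+ + 3 ℤ.* (b ℤ.* d) , a ℤ.* d ℤ.+ b ℤ.* c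
                 , trans (*-cong eq eq′) (product a b c d)
                 , λ 11∣ → [ ∤ , ∤′ ]′ (euclid 11-prime (residue a b) (residue c d)
                     (≡.subst (+ 11 ∣_) (≡.sym (residue-* a b c d)) (∣m∣n⇒∣m+n 11∣ (divides (+ 2 ℤ.* (b ℤ.* d)) ≡.refl)))) }
      ; split  = λ { (a , b , eq) → split a b eq }
      ; U∩P    = λ { (a , b , eq , ∤) (y , (c , d , y≈) , x≈ϖy) → ∤ (multiple a b c d
                 (trans (sym eq) (trans x≈ϖy (trans (*-congˡ y≈) (ϖ-multiple c d))))) }
      ; order  = λ { (a , b , eq) → order a b eq }
      }
      where
      1≢0 : + 1 ≢ + 0
      1≢0 ()
      addition : ∀ a b c d r → (a + b * r) + (c + d * r) ≈ a + c + (b + d) * r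
      addition = solve 5 (λ a b c d r → (a :+ b :* r) :+ (c :+ d :* r) := a :+ c :+ (b :+ d) :* r) refl
      negative : ∀ a b r → - (a + b * r) ≈ - a + - b * r
      negative = solve 3 (λ a b r → :- (a :+ b :* r) := :- a :+ :- b :* r) refl
      split : ∀ {x} a b → x ≈ fromℤ a + fromℤ b * √3 →
        (∃[ y ] (∃[ e ] ∃[ f ] y ≈ fromℤ e + fromℤ f * √3) × x ≈ ϖ * y) ⊎ Unit x
      split a b eq with + 11 ∣? residue a b
      ... | no ∤ = inj₂ (a , b , eq , ∤)
      ... | yes (divides q eq′) = inj₁ (_ , (b ℤ.- q , + 2 ℤ.* q ℤ.- b , refl) , trans eq (divide a b q eq′))
      multiple : ∀ a b c d → fromℤ a + fromℤ b * √3 ≈ fromℤ (c ℤ.+ + 6 ℤ.* d) + fromℤ (d ℤ.+ + 2 ℤ.* c) * √3 → + 11 ∣ residue a b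
      multiple a b c d eq = ≡.subst₂ (λ i j → + 11 ∣ residue i j)
        (≡.sym (proj₁ (unique a b (c ℤ.+ + 6 ℤ.* d) (d ℤ.+ + 2 ℤ.* c) eq)))
        (≡.sym (proj₂ (unique a b (c ℤ.+ + 6 ℤ.* d) (d ℤ.+ + 2 ℤ.* c) eq)))
        (divides (c ℤ.+ d) (residue-multiple c d))
      order : ∀ {x} a b → x ≈ fromℤ a + fromℤ b * √3 → Ordered x
      order a b eq = [ (λ ≈0 → inj₁ (trans eq ≈0)) , (λ { (k , u , Uu , eq′) → inj₂ (k , u , Uu , trans eq eq′) }) ]′
        (ord (size a b) a b ℕ.≤-refl)

-- Linear algebra over ℚ, finite-dimensional subalgebras and degrees.

module LinearAlgebra {c ℓ₁ ℓ₂} (ℛ : RealNumbers c ℓ₁ ℓ₂) where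
  open RealNumbers ℛ hiding (zero)
  open Fields ℛ
  open Arithmetic ℛ
  open Sums ℛ
  open SemiringSum (CommutativeRing.semiring commutativeRing) using (*-distribˡ-sum)
  open SumProperties (CommutativeRing.+-commutativeMonoid commutativeRing) using (sum-remove; sum-cong-≋)
  open SetoidReasoning (CommutativeRing.setoid commutativeRing)

  -- Integer coefficients suit arguments by divisibility; rational ones are handled by clearing
  -- denominators.
  Independent : ℕ → (ℕ → Carrier) → Set _
  Independent n v = ∀ (a : ℕ → ℤ) → Σ< n (λ i → fromℤ (a i) * v i) ≈ 0# → ∀ i → i ℕ.< n → a i ≡ + 0

  private
    common-denominator : ∀ n (q : ℕ → ℚ) →
      ∃[ d ] Σ[ z ∈ (ℕ → ℤ) ] ∀ i → i ℕ.< n → fromℕ (suc d) * fromℚ (q i) ≈ fromℤ (z i)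
    common-denominator zero    q = 0 , (λ _ → + 0) , λ _ ()
    common-denominator (suc n) q = helper (common-denominator n (q ∘ suc)) (q 0) ≡.refl
      where
      helper : ∃[ d ] Σ[ z ∈ (ℕ → ℤ) ] (∀ i → i ℕ.< n → fromℕ (suc d) * fromℚ (q (suc i)) ≈ fromℤ (z i)) → ∀ q₀ → q 0 ≡ q₀ →
        ∃[ d ] Σ[ z ∈ (ℕ → ℤ) ] ∀ i → i ℕ.< suc n → fromℕ (suc d) * fromℚ (q i) ≈ fromℤ (z i)
      -- e + d(e + 1) is the predecessor of (d + 1)(e + 1).
      helper (d , z , eq) q₀@record{} q0≡q₀ = e ℕ.+ d ℕ.* suc e , z′ , clear
        where
        e = ℚ.denominator-1 q₀
        z′ : ℕ → ℤ
        z′ zero    = ℚ.↥ q₀ ℤ.* + suc d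
        z′ (suc i) = z i ℤ.* + suc e
        swap₁ : ∀ a b c → a * b * c ≈ b * c * a
        swap₁ = solve 3 (λ a b c → a :* b :* c := b :* c :* a) refl
        swap₂ : ∀ a b c → a * b * c ≈ a * c * b
        swap₂ = solve 3 (λ a b c → a :* b :* c := a :* c :* b) refl
        clear : ∀ i → i ℕ.< suc n → fromℕ (suc d ℕ.* suc e) * fromℚ (q i) ≈ fromℤ (z′ i)
        clear zero _ = begin
          fromℕ (suc d ℕ.* suc e) * fromℚ (q 0)         ≡⟨ ≡.cong (λ r → fromℕ (suc d ℕ.* suc e) * fromℚ r) q0≡q₀ ⟩
          fromℕ (suc d ℕ.* suc e) * fromℚ q₀            ≈⟨ *-congʳ (×1-homo-* (suc d) (suc e)) ⟩
          fromℕ (suc d) * fromℕ (suc e) * fromℚ q₀      ≈⟨ swap₁ (fromℕ (suc d)) (fromℕ (suc e)) (fromℚ q₀) ⟩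
          fromℕ (suc e) * fromℚ q₀ * fromℕ (suc d)      ≈⟨ *-congʳ (fromℚ-↥ q₀) ⟩
          fromℤ (ℚ.↥ q₀) * fromℕ (suc d)                ≈⟨ fromℤ-* (ℚ.↥ q₀) (+ suc d) ⟨
          fromℤ (ℚ.↥ q₀ ℤ.* + suc d)                    ∎
        clear (suc i) (s≤s i<n) = begin
          fromℕ (suc d ℕ.* suc e) * fromℚ (q (suc i))         ≈⟨ *-congʳ (×1-homo-* (suc d) (suc e)) ⟩
          fromℕ (suc d) * fromℕ (suc e) * fromℚ (q (suc i))   ≈⟨ swap₂ (fromℕ (suc d)) (fromℕ (suc e)) (fromℚ (q (suc i))) ⟩
          fromℕ (suc d) * fromℚ (q (suc i)) * fromℕ (suc e)   ≈⟨ *-congʳ (eq i i<n) ⟩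
          fromℤ (z i) * fromℕ (suc e)                         ≈⟨ fromℤ-* (z i) (+ suc e) ⟨
          fromℤ (z i ℤ.* + suc e)                             ∎

  independent-ℚ : ∀ {n v} → Independent n v → ∀ (q : ℕ → ℚ) →
    Σ< n (λ i → q i · v i) ≈ 0# → ∀ i → i ℕ.< n → q i ≡ 0ℚ
  independent-ℚ {n} {v} ind q eq i i<n = helper (common-denominator n q)
    where
    helper : ∃[ d ] Σ[ z ∈ (ℕ → ℤ) ] (∀ i → i ℕ.< n → fromℕ (suc d) * fromℚ (q i) ≈ fromℤ (z i)) → q i ≡ 0ℚ
    helper (d , z , clear) = fromℚ-injective₀ (q i) (integral (#⇒≉ (fromℕ-suc#0 d)) (begin
      fromℕ (suc d) * fromℚ (q i)    ≈⟨ clear i i<n ⟩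
      fromℤ (z i)                    ≡⟨ ≡.cong fromℤ (ind z z-relation i i<n) ⟩
      0#                             ∎))
      where
      z-relation : Σ< n (λ i → fromℤ (z i) * v i) ≈ 0#
      z-relation = begin
        Σ< n (λ i → fromℤ (z i) * v i)
          ≈⟨ Σ<-cong< n (λ i i<n → trans (*-congʳ (sym (clear i i<n))) (*-assoc (fromℕ (suc d)) (fromℚ (q i)) (v i))) ⟩
        Σ< n (λ i → fromℕ (suc d) * (q i · v i))    ≈⟨ Σ<-*ˡ n (fromℕ (suc d)) (λ i → q i · v i) ⟩
        fromℕ (suc d) * Σ< n (λ i → q i · v i)      ≈⟨ *-congˡ eq ⟩
        fromℕ (suc d) * 0#                          ≈⟨ zeroʳ _ ⟩
        0#                                          ∎

  -- The coefficients are data, so that pivots can be found by the decidable equality of ℚ although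
  -- equality of reals is undecidable.
  record Span (n : ℕ) (v : ℕ → Carrier) (x : Carrier) : Set ℓ₁ where
    constructor combination-of
    field
      coefficient : ℕ → ℚ
      equation    : x ≈ Σ< n (λ i → coefficient i · v i)

  open Span

  span-resp : ∀ {n v x y} → x ≈ y → Span n v x → Span n v y
  span-resp x≈y (combination-of q eq) = combination-of q $ trans (sym x≈y) eq

  span-+ : ∀ {n v x y} → Span n v x → Span n v y → Span n v (x + y)
  span-+ {n} {v} (combination-of p eq) (combination-of q eq′) = combination-of (λ i → p i ℚ.+ q i) $ trans (+-cong eq eq′) (sym (trans
    (Σ<-cong n (λ i → trans (*-congʳ (fromℚ-+ (p i) (q i))) (distribʳ (v i) _ _)))
    (Σ<-+ n (λ i → p i · v i) (λ i → q i · v i))))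

  span-· : ∀ {n v x} r → Span n v x → Span n v (r · x)
  span-· {n} {v} r (combination-of q eq) = combination-of (λ i → r ℚ.* q i) $ trans (*-congˡ eq) (sym (trans
    (Σ<-cong n (λ i → trans (*-congʳ (fromℚ-* r (q i))) (*-assoc _ _ _))) (Σ<-*ˡ n (fromℚ r) (λ i → q i · v i))))

  span-0 : ∀ {n v} → Span n v 0#
  span-0 {n} = combination-of (λ _ → 0ℚ) $ sym (Σ<-0 n (λ _ → trans (*-congʳ fromℚ-0) (zeroˡ _)))

  span-vec : ∀ {n v} i → i ℕ.< n → Span n v (v i)
  span-vec {suc n} {v} zero    _         = combination-of q $ sym (trans (+-cong (trans (*-congʳ fromℚ-1) (*-identityˡ _))
    (Σ<-0 n (λ _ → trans (*-congʳ fromℚ-0) (zeroˡ _)))) (+-identityʳ _))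
    where
    q : ℕ → ℚ
    q zero    = 1ℚ
    q (suc _) = 0ℚ
  span-vec {suc n} {v} (suc i) (s≤s i<n) = prepend (span-vec {n} {v ∘ suc} i i<n)
    where
    prepend : ∀ {x} → Span n (v ∘ suc) x → Span (suc n) v x
    prepend (combination-of q eq) = combination-of (λ { zero → 0ℚ ; (suc j) → q j }) $
      trans eq (sym (trans (+-congʳ (trans (*-congʳ fromℚ-0) (zeroˡ _))) (+-identityˡ _)))

  span-Σ : ∀ {n v} m (q : ℕ → ℚ) {f : ℕ → Carrier} → (∀ i → i ℕ.< m → Span n v (f i)) → Span n v (Σ< m (λ i → q i · f i))
  span-Σ zero    q p = span-0
  span-Σ (suc m) q p = span-+ (span-· (q 0) (p 0 (s≤s z≤n))) (span-Σ m (q ∘ suc) (λ i i<m → p (suc i) (s≤s i<m)))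

  span-*ˡ : ∀ {n v m w} y → (∀ i → i ℕ.< m → Span n v (y * w i)) → ∀ {x} → Span m w x → Span n v (y * x)
  span-*ˡ {m = m} {w} y p (combination-of q eq) = span-resp
    (sym (trans (*-congˡ eq) (trans (sym (Σ<-*ˡ m y (λ i → q i · w i))) (Σ<-cong m (λ i → x∙yz≈y∙xz y (fromℚ (q i)) (w i))))))
    (span-Σ m q {λ i → y * w i} p)

  Dependent : ∀ {n} → Vector Carrier n → Set _
  Dependent {n} w = Σ[ q ∈ (Fin n → ℚ) ] (∃[ k ] q k ≢ 0ℚ) × sum (λ i → q i · w i) ≈ 0#

  -- Gaussian elimination on the coefficient of `v 0`, steered by the rational coefficients alone.
  dependent : ∀ n v (w : Vector Carrier (suc n)) → (∀ i → Span n v (w i)) → Dependent w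
  dependent zero    v w p = (λ _ → 1ℚ) , (fzero , λ ()) ,
    trans (+-identityʳ _) (trans (*-congˡ (equation (p fzero))) (zeroʳ _))
  dependent (suc n) v w p with any? (λ i → ¬? (coefficient (p i) 0 ℚ.≟ 0ℚ))
  -- Without a pivot all vectors lie in the span of the other n generators, and one of them may be
  -- dropped.
  ... | no ¬pivot = extend (dependent n (v ∘ suc) (w ∘ fsuc) λ i → combination-of (coefficient (p (fsuc i)) ∘ suc) (begin
        w (fsuc i)                              ≈⟨ equation (p (fsuc i)) ⟩
        coefficient (p (fsuc i)) 0 · v 0 + _          ≈⟨ +-congʳ (trans (*-congʳ (trans (reflexive (≡.cong fromℚ (no-pivot i))) fromℚ-0)) (zeroˡ _)) ⟩
        0# + _                                  ≈⟨ +-identityˡ _ ⟩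
        Σ< n (λ j → coefficient (p (fsuc i)) (suc j) · v (suc j)) ∎))
    where
    no-pivot : ∀ i → coefficient (p (fsuc i)) 0 ≡ 0ℚ
    no-pivot i = decidable-stable (_ ℚ.≟ _) (λ ≢0 → ¬pivot (fsuc i , ≢0))
    extend : Dependent (w ∘ fsuc) → Dependent w
    extend (q , (k , qk≢0) , eq) = (λ { fzero → 0ℚ ; (fsuc i) → q i }) , (fsuc k , qk≢0) ,
      trans (+-cong (trans (*-congʳ fromℚ-0) (zeroˡ _)) eq) (+-identityˡ 0#)
  ... | yes (k , pk≢0) = extend (dependent n (v ∘ suc) w′ w′-span)
    where
    instance
      pivot-nonZero : ℚ.NonZero (coefficient (p k) 0)
      pivot-nonZero = ℚ.≢-nonZero pk≢0
    m : Fin (suc n) → ℚ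
    m i = ℚ.- (coefficient (p (punchIn k i)) 0 ℚ.* ℚ.1/ coefficient (p k) 0)
    w′ : Vector Carrier (suc n)
    w′ i = w (punchIn k i) + m i · w k
    eliminated : ∀ i → coefficient (p (punchIn k i)) 0 ℚ.+ m i ℚ.* coefficient (p k) 0 ≡ 0ℚ
    eliminated i = ≡.trans (≡.cong (a ℚ.+_) (≡.trans (≡.sym (ℚ.neg-distribˡ-* (a ℚ.* ℚ.1/ b) b))
        (≡.cong ℚ.-_ (≡.trans (ℚ.*-assoc a (ℚ.1/ b) b) (≡.trans (≡.cong (a ℚ.*_) (ℚ.*-inverseˡ b)) (ℚ.*-identityʳ a))))))
      (ℚ.+-inverseʳ a)
      where
      a b : ℚ
      a = coefficient (p (punchIn k i)) 0
      b = coefficient (p k) 0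
    w′-span : ∀ i → Span n (v ∘ suc) (w′ i)
    w′-span i = span-tail (span-+ (p (punchIn k i)) (span-· (m i) (p k))) (eliminated i)
      where
      span-tail : ∀ {x} (s : Span (suc n) v x) → coefficient s 0 ≡ 0ℚ → Span n (v ∘ suc) x
      span-tail (combination-of q eq) q0≡0 = combination-of (q ∘ suc) $ trans eq (trans (+-congʳ
        (trans (*-congʳ (trans (reflexive (≡.cong fromℚ q0≡0)) fromℚ-0)) (zeroˡ _))) (+-identityˡ _))
    extend : Dependent w′ → Dependent w
    -- A relation Σ qᵢ(wᵢ + mᵢwₖ) = 0 gives wₖ the coefficient Σ qᵢmᵢ and leaves the nonzero qⱼ in
    -- place.
    extend (q , (j , qj≢0) , eq) = q′ , (punchIn k j , qj≢0 ∘ ≡.trans (≡.sym (insertAt-punchIn q k s j))) , (begin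
      sum (λ i → q′ i · w i)
        ≈⟨ sum-remove {i = k} (λ i → q′ i · w i) ⟩
      q′ k · w k + sum (λ i → q′ (punchIn k i) · w (punchIn k i))
        ≈⟨ +-cong (*-congʳ (reflexive (≡.cong fromℚ (insertAt-lookup q k s))))
                  (sum-cong-≋ (λ i → *-congʳ {w (punchIn k i)} (reflexive (≡.cong fromℚ (insertAt-punchIn q k s i))))) ⟩
      s · w k + sum (λ i → q i · w (punchIn k i))
        ≈⟨ trans (+-comm _ _) (+-congˡ (*-congʳ (s≈ q m))) ⟩
      sum (λ i → q i · w (punchIn k i)) + sum (λ i → fromℚ (q i) * fromℚ (m i)) * w k
        ≈⟨ collect q m (w ∘ punchIn k) (w k) ⟩
      sum (λ i → q i · w′ i)   ≈⟨ eq ⟩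
      0# ∎)
      where
      total : ∀ {n} → (Fin n → ℚ) → (Fin n → ℚ) → ℚ
      total {zero}  q m = 0ℚ
      total {suc n} q m = q fzero ℚ.* m fzero ℚ.+ total (q ∘ fsuc) (m ∘ fsuc)
      s≈ : ∀ {n} (q m : Fin n → ℚ) → fromℚ (total q m) ≈ sum (λ i → fromℚ (q i) * fromℚ (m i))
      s≈ {zero}  q m = fromℚ-0
      s≈ {suc n} q m = trans (fromℚ-+ (q fzero ℚ.* m fzero) (total (q ∘ fsuc) (m ∘ fsuc)))
        (+-cong (fromℚ-* (q fzero) (m fzero)) (s≈ (q ∘ fsuc) (m ∘ fsuc)))
      collect : ∀ {n} (q m : Fin n → ℚ) (u : Fin n → Carrier) z →
        sum (λ i → q i · u i) + sum (λ i → fromℚ (q i) * fromℚ (m i)) * z ≈ sum (λ i → q i · (u i + m i · z))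
      collect {zero}  q m u z = trans (+-identityˡ _) (zeroˡ z)
      collect {suc n} q m u z = trans (step (fromℚ (q fzero)) (fromℚ (m fzero)) (u fzero) z _ _)
        (+-congˡ (collect (q ∘ fsuc) (m ∘ fsuc) (u ∘ fsuc) z))
        where
        step : ∀ a b c z s s′ → a * c + s + (a * b + s′) * z ≈ a * (c + b * z) + (s + s′ * z)
        step = solve 6 (λ a b c z s s′ → a :* c :+ s :+ (a :* b :+ s′) :* z := a :* (c :+ b :* z) :+ (s :+ s′ :* z)) refl
      s : ℚ
      s = total q m
      q′ : Fin (suc (suc n)) → ℚ
      q′ = insertAt q k s

  record IsSubalgebra {a} (A : Pred Carrier a) : Set (a ⊔ c ⊔ ℓ₁) where
    field
      A-resp : ∀ {x y} → x ≈ y → A x → A y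
      A-1    : A 1#
      A-+    : ∀ {x y} → A x → A y → A (x + y)
      A-·    : ∀ {x} q → A x → A (q · x)
      A-*    : ∀ {x y} → A x → A y → A (x * y)

    A-0 : A 0#
    A-0 = A-resp (trans (*-congʳ fromℚ-0) (zeroˡ _)) (A-· 0ℚ A-1)

    A-neg : ∀ {x} → A x → A (- x)
    A-neg {x} a = A-resp (begin
      fromℚ (ℚ.- 1ℚ) * x     ≈⟨ *-congʳ (trans (fromℚ-neg 1ℚ) (-‿cong fromℚ-1)) ⟩
      - 1# * x               ≈⟨ -‿distribˡ-* 1# x ⟨
      - (1# * x)             ≈⟨ -‿cong (*-identityˡ x) ⟩
      - x                    ∎) (A-· (ℚ.- 1ℚ) a)

    A-^ : ∀ {x} n → A x → A (x ^ n)
    A-^ zero    a = A-1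
    A-^ (suc n) a = A-* a (A-^ n a)

    private
      factor : ∀ {x} n (q : Fin n → ℚ) → sum (λ i → q i · (x * x ^ toℕ i)) ≈ x * sum (λ i → q i · x ^ toℕ i)
      factor {x} n q = trans (sum-cong-≋ (λ i → x∙yz≈y∙xz (fromℚ (q i)) x (x ^ toℕ i))) (sym (*-distribˡ-sum x (λ i → q i · x ^ toℕ i)))

    A-poly : ∀ {x} n (q : Fin n → ℚ) → A x → A (sum (λ i → q i · x ^ toℕ i))
    A-poly zero    q a = A-0
    A-poly (suc n) q a = A-+ (A-· (q fzero) A-1) (A-resp (sym (factor n (q ∘ fsuc))) (A-* a (A-poly n (q ∘ fsuc) a)))

    -- Dividing a polynomial relation by the power of x of lowest order exhibits 1/x as a polynomial in x.
    inverse-from-relation : ∀ {x} n (q : Fin n → ℚ) → A x → ¬ (x ≈ 0#) → (∃[ k ] q k ≢ 0ℚ) →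
      sum (λ i → q i · x ^ toℕ i) ≈ 0# → ∃[ z ] A z × x * z ≈ 1#
    inverse-from-relation {x} (suc n) q a x≉0 (k , qk≢0) eq = go (q fzero ℚ.≟ 0ℚ) k qk≢0
      where
      R : Carrier
      R = sum (λ i → q (fsuc i) · x ^ toℕ i)
      eq′ : fromℚ (q fzero) + x * R ≈ 0#
      eq′ = trans (sym (+-cong (*-identityʳ _) (factor n (q ∘ fsuc)))) eq
      go : Dec (q fzero ≡ 0ℚ) → ∀ k → q k ≢ 0ℚ → ∃[ z ] A z × x * z ≈ 1#
      go (yes q₀≡0) fzero    qk≢0 = ⊥-elim (qk≢0 q₀≡0)
      go (yes q₀≡0) (fsuc k) qk≢0 = inverse-from-relation n (q ∘ fsuc) a x≉0 (k , qk≢0) (integral x≉0 (begin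
        x * R                          ≈⟨ +-identityˡ _ ⟨
        0# + x * R                     ≈⟨ +-congʳ (trans (reflexive (≡.cong fromℚ q₀≡0)) fromℚ-0) ⟨
        fromℚ (q fzero) + x * R        ≈⟨ eq′ ⟩
        0#                             ∎))
      go (no q₀≢0) _ _ = r · R , A-· r (A-poly n (q ∘ fsuc) a) , (begin
        x * (fromℚ r * R)              ≈⟨ trans (x∙yz≈y∙xz x (fromℚ r) R) (*-congʳ (fromℚ-neg (ℚ.1/ q fzero))) ⟩
        - i * (x * R)                  ≈⟨ rearrange i (x * R) (fromℚ (q fzero)) ⟩
        i * fromℚ (q fzero) - i * (fromℚ (q fzero) + x * R)
          ≈⟨ +-cong (trans (sym (fromℚ-* (ℚ.1/ q fzero) (q fzero))) (trans (reflexive (≡.cong fromℚ (ℚ.*-inverseˡ (q fzero)))) fromℚ-1)) (-‿cong (trans (*-congˡ eq′) (zeroʳ i))) ⟩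
        1# - 0#                        ≈⟨ +-congˡ -0#≈0# ⟩
        1# + 0#                        ≈⟨ +-identityʳ 1# ⟩
        1#                             ∎)
        where
        instance
          q₀-nonZero : ℚ.NonZero (q fzero)
          q₀-nonZero = ℚ.≢-nonZero q₀≢0
        r : ℚ
        r = ℚ.- ℚ.1/ q fzero
        i : Carrier
        i = fromℚ (ℚ.1/ q fzero)
        rearrange : ∀ i y q → - i * y ≈ i * q - i * (q + y)
        rearrange = solve 3 (λ i y q → :- i :* y := i :* q :- i :* (q :+ y)) refl

    -- In finite dimension the powers 1, x, ..., xⁿ are dependent, which yields an inverse of x
    -- inside A; inverses being unique, it is y.
    A-inverse : ∀ {n v x y} → (∀ {z} → A z → Span n v z) → A x → x * y ≈ 1# → A y
    A-inverse {n} {v} {x} {y} A⊆Span a xy≈1 =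
      from-relation (dependent n v (λ i → x ^ toℕ i) (λ i → A⊆Span (A-^ (toℕ i) a)))
      where
      x≉0 : ¬ (x ≈ 0#)
      x≉0 x≈0 = #⇒≉ (>⇒# 0<1) (trans (sym xy≈1) (trans (*-congʳ x≈0) (zeroˡ y)))
      from-inverse : ∃[ z ] A z × x * z ≈ 1# → A y
      from-inverse (z , Az , xz≈1) = A-resp (≉0-cancel x≉0 (trans xz≈1 (sym xy≈1))) Az
      from-relation : Dependent (λ (i : Fin (suc n)) → x ^ toℕ i) → A y
      from-relation (q , q≢0 , eq) = from-inverse (inverse-from-relation (suc n) q a x≉0 q≢0 eq)

  -- Finite dimension enters through the constructor `inv` alone.
  field⊆subalgebra : ∀ {a s n v} {S : Pred Carrier s} {A : Pred Carrier a} → IsSubalgebra A →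
    (∀ {z} → A z → Span n v z) → S ⊆ A → ℚ⟨ S ⟩ ⊆ A
  field⊆subalgebra {S = S} {A} sub A⊆Span S⊆A = go
    where
    open IsSubalgebra sub
    go : ℚ⟨ S ⟩ ⊆ A
    go (gen p)      = S⊆A p
    go (resp eq p)  = A-resp eq (go p)
    go zer          = A-0
    go one          = A-1
    go (add p q)    = A-+ (go p) (go q)
    go (neg p)      = A-neg (go p)
    go (mul p q)    = A-* (go p) (go q)
    go (inv p eq)   = A-inverse A⊆Span (go p) eq

  basis : ∀ {s} {K : Pred Carrier s} {n v} → (∀ i → i ℕ.< n → v i ∈ K) → Independent n v →
    (∀ {x} → x ∈ K → Span n v x) → [ K :ℚ]≡ n
  basis {n = n} {v} v∈K ind K⊆Span = record
    { vec         = v ∘ toℕ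
    ; vec∈K       = λ i → v∈K (toℕ i) (toℕ<n i)
    ; independent = λ q eq i → ≡.trans (≡.sym (extend-toℕ q i))
        (independent-ℚ ind (extend q) (trans (sym (sum≈ q v)) eq) (toℕ i) (toℕ<n i))
    ; spanning    = λ x x∈K → coefficient (K⊆Span x∈K) ∘ toℕ
                  , trans (equation (K⊆Span x∈K)) (sym (sum≈Σ< n (λ i → coefficient (K⊆Span x∈K) i · v i)))
    }
    where
    extend : ∀ {n} → (Fin n → ℚ) → ℕ → ℚ
    extend {zero}  q _       = 0ℚ
    extend {suc n} q zero    = q fzero
    extend {suc n} q (suc i) = extend (q ∘ fsuc) i
    extend-toℕ : ∀ {n} (q : Fin n → ℚ) i → extend q (toℕ i) ≡ q i
    extend-toℕ q fzero    = ≡.refl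
    extend-toℕ q (fsuc i) = extend-toℕ (q ∘ fsuc) i
    sum≈ : ∀ {n} (q : Fin n → ℚ) (v : ℕ → Carrier) → sum (λ i → q i · v (toℕ i)) ≈ Σ< n (λ i → extend q i · v i)
    sum≈ {zero}  q v = refl
    sum≈ {suc n} q v = +-congˡ (sum≈ (q ∘ fsuc) (v ∘ suc))

  -- A single relation for tⁿ makes the span of the lower powers stable under multiplication by t,
  -- hence a ring.
  module Powers {n t} (t^n : Span n (t ^_) (t ^ n)) (0<n : 0 ℕ.< n) where

    t*-span : ∀ {x} → Span n (t ^_) x → Span n (t ^_) (t * x)
    t*-span = span-*ˡ t λ i i<n → [ span-vec (suc i) , (λ { ≡.refl → t^n }) ]′ (ℕ.m≤n⇒m<n∨m≡n i<n)

    t^*-span : ∀ i {x} → Span n (t ^_) x → Span n (t ^_) (t ^ i * x)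
    t^*-span zero    p = span-resp (sym (*-identityˡ _)) p
    t^*-span (suc i) p = span-resp (sym (*-assoc _ _ _)) (t*-span (t^*-span i p))

    isSubalgebra : IsSubalgebra (Span n (t ^_))
    isSubalgebra = record
      { A-resp = span-resp
      ; A-1    = span-vec 0 0<n
      ; A-+    = span-+
      ; A-·    = span-·
      ; A-*    = λ {x} p q → span-*ˡ x (λ i _ → span-resp (*-comm _ _) (t^*-span i p)) q
      }

    t∈ : Span n (t ^_) t
    t∈ = span-resp (*-identityʳ t) (t*-span (span-vec 0 0<n))

  evalℤ : List ℤ → Carrier → Carrier
  evalℤ []       y = 0#
  evalℤ (z ∷ zs) y = fromℤ z + y * evalℤ zs y

  eval-poly : ∀ zs y → eval (poly zs) y ≈ evalℤ zs y
  eval-poly []       y = refl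
  eval-poly (z ∷ zs) y = +-cong (fromℚ-/1 z) (*-congˡ (eval-poly zs y))

  -- A monic g of degree below n would be a relation among 1, y, ..., yⁿ⁻¹, so its leading
  -- coefficient would be 0.
  minimal : ∀ {f y n} → length f ≡ suc n → Monic f → eval f y ≈ 0# → Independent n (y ^_) → IsMinimalPolynomial f y
  minimal {f} {y} {n} len monic root ind = record
    { monic = monic
    ; root  = root
    ; least = λ g g-monic g-root → ℕ.≮⇒≥ λ g<f →
        leading g g-monic (independent-ℚ ind (coeff g)
          (trans (sym (eval≈ n g (ℕ.≤-pred (ℕ.≤-trans g<f (ℕ.≤-reflexive len))))) g-root))
          (ℕ.≤-pred (ℕ.≤-trans g<f (ℕ.≤-reflexive len)))
    }
    where
    coeff : List ℚ → ℕ → ℚ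
    coeff []      _       = 0ℚ
    coeff (a ∷ g) zero    = a
    coeff (a ∷ g) (suc i) = coeff g i
    eval≈ : ∀ n g → length g ℕ.≤ n → eval g y ≈ Σ< n (λ i → coeff g i · y ^ i)
    eval≈ n       []      _         = sym (Σ<-0 n (λ _ → trans (*-congʳ fromℚ-0) (zeroˡ _)))
    eval≈ (suc n) (a ∷ g) (s≤s g≤n) = +-cong (sym (*-identityʳ _)) (trans (*-congˡ (eval≈ n g g≤n))
      (trans (sym (Σ<-*ˡ n y (λ i → coeff g i · y ^ i))) (Σ<-cong n (λ i → x∙yz≈y∙xz y (fromℚ (coeff g i)) (y ^ i)))))
    leading : ∀ {n} g → Monic g → (∀ i → i ℕ.< n → coeff g i ≡ 0ℚ) → ¬ (length g ℕ.≤ n)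
    leading (a ∷ [])    ≡.refl  z (s≤s _)   with z 0 (s≤s z≤n)
    ... | ()
    leading (a ∷ b ∷ g) g-monic z (s≤s g≤n) = leading (b ∷ g) g-monic (λ i i<n → z (suc i) (s≤s i<n)) g≤n

  fromℕ∈ : ∀ {s} {S : Pred Carrier s} n → fromℕ n ∈ ℚ⟨ S ⟩
  fromℕ∈ zero    = zer
  fromℕ∈ (suc n) = add one (fromℕ∈ n)

  fromℤ∈ : ∀ {s} {S : Pred Carrier s} i → fromℤ i ∈ ℚ⟨ S ⟩
  fromℤ∈ (+ n)    = fromℕ∈ n
  fromℤ∈ -[1+ n ] = neg (fromℕ∈ (suc n))

  divide∈ : ∀ {s} {S : Pred Carrier s} n {x} → fromℕ (suc n) * x ∈ ℚ⟨ S ⟩ → x ∈ ℚ⟨ S ⟩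
  divide∈ n {x} p = resp (trans (sym (*-assoc _ _ _)) (trans (*-congʳ (trans (*-comm _ _) (fromℕ-*-1/suc n))) (*-identityˡ x)))
    (mul (inv (fromℕ∈ (suc n)) (fromℕ-*-1/suc n)) p)

  ^∈ : ∀ {s} {S : Pred Carrier s} {x} n → x ∈ ℚ⟨ S ⟩ → x ^ n ∈ ℚ⟨ S ⟩
  ^∈ zero    p = one
  ^∈ (suc n) p = mul p (^∈ n p)

  field-⊆ : ∀ {s s′} {S : Pred Carrier s} {S′ : Pred Carrier s′} → S ⊆ ℚ⟨ S′ ⟩ → ℚ⟨ S ⟩ ⊆ ℚ⟨ S′ ⟩
  field-⊆ {S = S} {S′} S⊆ = go
    where
    go : ℚ⟨ S ⟩ ⊆ ℚ⟨ S′ ⟩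
    go (gen p)     = S⊆ p
    go (resp eq p) = resp eq (go p)
    go zer         = zer
    go one         = one
    go (add p q)   = add (go p) (go q)
    go (neg p)     = neg (go p)
    go (mul p q)   = mul (go p) (go q)
    go (inv p eq)  = inv (go p) eq

-- Distances in the Minkowski realization and its coordinate field.

module Geometry {c ℓ₁ ℓ₂} {ℛ : RealNumbers c ℓ₁ ℓ₂} (𝒯 : Trigonometry ℛ) where
  open Realizations 𝒯 hiding (zero)
  open Arithmetic ℛ
  open Bounds ℛ
  open AdditionFormulas 𝒯 using (cos-0; sin-0)
  open SpecialAngles 𝒯
  open LinearAlgebra ℛ
  open SetoidReasoning (CommutativeRing.setoid commutativeRing)

  abstract
    R : Carrier
    R = 1/suc 2 * √3

    3R≈√3 : fromℕ 3 * R ≈ √3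
    3R≈√3 = trans (sym (*-assoc _ _ _)) (trans (*-congʳ (fromℕ-*-1/suc 2)) (*-identityˡ √3))

  R*√3≈1 : R * √3 ≈ 1#
  R*√3≈1 = #0-cancel (fromℕ-suc#0 2) (begin
    fromℕ 3 * (R * √3)    ≈⟨ *-assoc _ _ _ ⟨
    fromℕ 3 * R * √3      ≈⟨ *-congʳ 3R≈√3 ⟩
    √3 * √3               ≈⟨ √3*√3≈3 ⟩
    fromℕ 3               ≈⟨ *-identityʳ _ ⟨
    fromℕ 3 * 1#          ∎)

  3R²≈1 : fromℕ 3 * (R * R) ≈ 1#
  3R²≈1 = trans (sym (*-assoc _ _ _)) (trans (*-congʳ 3R≈√3) (trans (*-comm √3 R) R*√3≈1))

  -- 2 cos 120k° = C k and 2 sin 120k° = S k √3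
  C S : Fin 3 → ℤ
  C 0F = + 2
  C 1F = -[1+ 0 ]
  C 2F = -[1+ 0 ]
  S 0F = + 0
  S 1F = + 1
  S 2F = -[1+ 0 ]

  private
    fromℤ-[-1] : - 1# ≈ fromℤ -[1+ 0 ]
    fromℤ-[-1] = -‿cong (sym 1≈)

    0°≈0 : 0 ° ≈ 0#
    0°≈0 = angle-0 179

    Y0≈2 : Y 0# ≈ fromℕ 2
    Y0≈2 = trans (*-congˡ cos-0) (*-identityʳ _)

    Θ0≈0 : Θ 0# ≈ 0#
    Θ0≈0 = trans (*-congˡ sin-0) (zeroʳ _)

  δ : Fin 3 → Carrier
  δ k = (120 ℕ.* toℕ k) °

  Y-δ : ∀ k → Y (δ k) ≈ fromℤ (C k)
  Y-δ 0F = trans (Y-cong 0°≈0) Y0≈2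
  Y-δ 1F = trans Y120≈-1 fromℤ-[-1]
  Y-δ 2F = trans Y240≈-1 fromℤ-[-1]

  Θ-δ : ∀ k → Θ (δ k) ≈ fromℤ (S k) * √3
  Θ-δ 0F = trans (Θ-cong 0°≈0) (trans Θ0≈0 (sym (zeroˡ √3)))
  Θ-δ 1F = trans Θ120≈√3 (sym (trans (*-congʳ 1≈) (*-identityˡ √3)))
  Θ-δ 2F = trans Θ240≈-√3 (sym (trans (sym (-‿distribˡ-* (fromℕ 1) √3)) (-‿cong (trans (*-congʳ 1≈) (*-identityˡ √3)))))

  -- 4 T_β[k] / R
  W : Carrier → Carrier → Carrier → Vector Carrier 2
  W β a b 0F = Y β * a - Θ β * (b * √3)
  W β a b 1F = Θ β * a + Y β * (b * √3)

  4T : ∀ β k i → fromℕ 4 * T R β k i ≈ R * W β (fromℤ (C k)) (fromℤ (S k)) i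
  4T β k 0F = trans (solve 2 (λ r x → con (+ 4) :* (r :* x) := r :* (con (+ 2) :* (con (+ 2) :* x))) refl R (cos (β + δ k)))
    (*-congˡ (trans (Y-+ β (δ k)) (+-cong (*-congˡ (Y-δ k)) (-‿cong (*-congˡ (Θ-δ k))))))
  4T β k 1F = trans (solve 2 (λ r x → con (+ 4) :* (r :* x) := r :* (con (+ 2) :* (con (+ 2) :* x))) refl R (sin (β + δ k)))
    (*-congˡ (trans (Θ-+ β (δ k)) (+-cong (*-congˡ (Y-δ k)) (*-congˡ (Θ-δ k)))))

  A B : Fin 3 → Fin 3 → ℤ
  A k l = C k ℤ.- C l
  B k l = S k ℤ.- S l

  -- Scalar and (up to √3) vector product of differences of vertices, scaled by 12.
  E F : (k l k′ l′ : Fin 3) → ℤ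
  E k l k′ l′ = A k l ℤ.* A k′ l′ ℤ.+ + 3 ℤ.* (B k l ℤ.* B k′ l′)
  F k l k′ l′ = B k l ℤ.* A k′ l′ ℤ.- A k l ℤ.* B k′ l′

  N : Fin 3 → Fin 3 → ℤ
  N k l = E k l k l

  private
    a b : Fin 3 → Fin 3 → Carrier
    a k l = fromℤ (A k l)
    b k l = fromℤ (B k l)

    fromℤ-minus : ∀ i j → fromℤ (i ℤ.- j) ≈ fromℤ i - fromℤ j
    fromℤ-minus i j = trans (fromℤ-+ i (ℤ.- j)) (+-congˡ (fromℤ-neg j))

    fromℤ-E : ∀ k l k′ l′ → a k l * a k′ l′ + fromℕ 3 * (b k l * b k′ l′) ≈ fromℤ (E k l k′ l′)
    fromℤ-E k l k′ l′ = sym (trans (fromℤ-+ (A k l ℤ.* A k′ l′) (+ 3 ℤ.* (B k l ℤ.* B k′ l′)))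
      (+-cong (fromℤ-* (A k l) (A k′ l′)) (trans (fromℤ-* (+ 3) (B k l ℤ.* B k′ l′)) (*-congˡ (fromℤ-* (B k l) (B k′ l′))))))

    fromℤ-F : ∀ k l k′ l′ → b k l * a k′ l′ - a k l * b k′ l′ ≈ fromℤ (F k l k′ l′)
    fromℤ-F k l k′ l′ = sym (trans (fromℤ-minus (B k l ℤ.* A k′ l′) (A k l ℤ.* B k′ l′))
      (+-cong (fromℤ-* (B k l) (A k′ l′)) (-‿cong (fromℤ-* (A k l) (B k′ l′)))))

    W-linear : ∀ β a b a′ b′ i → W β a b i - W β a′ b′ i ≈ W β (a - a′) (b - b′) i
    W-linear β a b a′ b′ 0F = solve 7 (λ y t s a b a′ b′ →
      y :* a :- t :* (b :* s) :- (y :* a′ :- t :* (b′ :* s)) := y :* (a :- a′) :- t :* ((b :- b′) :* s)) refl (Y β) (Θ β) √3 a b a′ b′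
    W-linear β a b a′ b′ 1F = solve 7 (λ y t s a b a′ b′ →
      t :* a :+ y :* (b :* s) :- (t :* a′ :+ y :* (b′ :* s)) := t :* (a :- a′) :+ y :* ((b :- b′) :* s)) refl (Y β) (Θ β) √3 a b a′ b′

    W-cong : ∀ β {a b a′ b′} → a ≈ a′ → b ≈ b′ → ∀ i → W β a b i ≈ W β a′ b′ i
    W-cong β a≈ b≈ 0F = +-cong (*-congˡ a≈) (-‿cong (*-congˡ (*-congʳ b≈)))
    W-cong β a≈ b≈ 1F = +-cong (*-congˡ a≈) (*-congˡ (*-congʳ b≈))

    4ΔT : ∀ β k l i → fromℕ 4 * (T R β k i - T R β l i) ≈ R * W β (a k l) (b k l) i
    4ΔT β k l i = begin
      fromℕ 4 * (T R β k i - T R β l i)                ≈⟨ spread (fromℕ 4) (T R β k i) (T R β l i) ⟩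
      fromℕ 4 * T R β k i - fromℕ 4 * T R β l i        ≈⟨ +-cong (4T β k i) (-‿cong (4T β l i)) ⟩
      R * W β (fromℤ (C k)) (fromℤ (S k)) i - R * W β (fromℤ (C l)) (fromℤ (S l)) i
        ≈⟨ spread R _ _ ⟨
      R * (W β (fromℤ (C k)) (fromℤ (S k)) i - W β (fromℤ (C l)) (fromℤ (S l)) i)
        ≈⟨ *-congˡ (W-linear β (fromℤ (C k)) (fromℤ (S k)) (fromℤ (C l)) (fromℤ (S l)) i) ⟩
      R * W β (fromℤ (C k) - fromℤ (C l)) (fromℤ (S k) - fromℤ (S l)) i
        ≈⟨ *-congˡ (W-cong β (fromℤ-minus (C k) (C l)) (fromℤ-minus (S k) (S l)) i) ⟨
      R * W β (a k l) (b k l) i ∎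
      where
      spread : ∀ c x y → c * (x - y) ≈ c * x - c * y
      spread = solve 3 (λ c x y → c :* (x :- y) := c :* x :- c :* y) refl

    -- Real and imaginary part of 4 e^{i(γ-β)}.
    cosΔ sinΔ : Carrier → Carrier → Carrier
    cosΔ β γ = Y β * Y γ + Θ β * Θ γ
    sinΔ β γ = Y β * Θ γ - Θ β * Y γ

    scalar : ∀ β γ k l k′ l′ →
      W β (a k l) (b k l) 0F * W γ (a k′ l′) (b k′ l′) 0F + W β (a k l) (b k l) 1F * W γ (a k′ l′) (b k′ l′) 1F
      ≈ fromℤ (E k l k′ l′) * cosΔ β γ + fromℤ (F k l k′ l′) * (√3 * sinΔ β γ)
    scalar β γ k l k′ l′ = begin
      W β (a k l) (b k l) 0F * W γ (a k′ l′) (b k′ l′) 0F + W β (a k l) (b k l) 1F * W γ (a k′ l′) (b k′ l′) 1F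
        ≈⟨ expand (Y β) (Θ β) (Y γ) (Θ γ) (a k l) (b k l) (a k′ l′) (b k′ l′) √3 ⟩
      (a k l * a k′ l′ + √3 * √3 * (b k l * b k′ l′)) * cosΔ β γ + (b k l * a k′ l′ - a k l * b k′ l′) * (√3 * sinΔ β γ)
        ≈⟨ +-cong (*-congʳ (trans (+-congˡ (*-congʳ √3*√3≈3)) (fromℤ-E k l k′ l′))) (*-congʳ (fromℤ-F k l k′ l′)) ⟩
      fromℤ (E k l k′ l′) * cosΔ β γ + fromℤ (F k l k′ l′) * (√3 * sinΔ β γ) ∎
      where
      expand : ∀ y t y′ t′ a b a′ b′ s →
        (y * a - t * (b * s)) * (y′ * a′ - t′ * (b′ * s)) + (t * a + y * (b * s)) * (t′ * a′ + y′ * (b′ * s))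
        ≈ (a * a′ + s * s * (b * b′)) * (y * y′ + t * t′) + (b * a′ - a * b′) * (s * (y * t′ - t * y′))
      expand = solve 9 (λ y t y′ t′ a b a′ b′ s →
        (y :* a :- t :* (b :* s)) :* (y′ :* a′ :- t′ :* (b′ :* s)) :+ (t :* a :+ y :* (b :* s)) :* (t′ :* a′ :+ y′ :* (b′ :* s))
        := (a :* a′ :+ s :* s :* (b :* b′)) :* (y :* y′ :+ t :* t′) :+ (b :* a′ :- a :* b′) :* (s :* (y :* t′ :- t :* y′))) refl

    square : ∀ β k l → W β (a k l) (b k l) 0F * W β (a k l) (b k l) 0F + W β (a k l) (b k l) 1F * W β (a k l) (b k l) 1F
      ≈ fromℤ (N k l) * fromℕ 4
    square β k l = begin
      W β (a k l) (b k l) 0F * W β (a k l) (b k l) 0F + W β (a k l) (b k l) 1F * W β (a k l) (b k l) 1F   ≈⟨ scalar β β k l k l ⟩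
      fromℤ (N k l) * cosΔ β β + fromℤ (F k l k l) * (√3 * sinΔ β β)
        ≈⟨ +-cong (*-congˡ (Y²+Θ² β)) (trans (*-congˡ (trans (*-congˡ (vanish (Y β) (Θ β))) (zeroʳ √3))) (zeroʳ _)) ⟩
      fromℤ (N k l) * fromℕ 4 + 0#   ≈⟨ +-identityʳ _ ⟩
      fromℤ (N k l) * fromℕ 4        ∎
      where
      vanish : ∀ y t → y * t - t * y ≈ 0#
      vanish = solve 2 (λ y t → y :* t :- t :* y := con (+ 0)) refl

  module _ (α : Carrier) where
    private
      y θ y′ θ′ : Carrier
      y  = Y α
      θ  = Θ α
      y′ = Y (α + α)
      θ′ = Θ (α + α)

      cosΔ₀ : ∀ γ → cosΔ 0# γ ≈ fromℕ 2 * Y γ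
      cosΔ₀ γ = trans (+-cong (*-congʳ Y0≈2) (trans (*-congʳ Θ0≈0) (zeroˡ _))) (+-identityʳ _)

      sinΔ₀ : ∀ γ → sinΔ 0# γ ≈ fromℕ 2 * Θ γ
      sinΔ₀ γ = trans (+-cong (*-congʳ Y0≈2) (trans (-‿cong (trans (*-congʳ Θ0≈0) (zeroˡ _))) -0#≈0#)) (+-identityʳ _)

      cosΔ₁ : cosΔ α (α + α) ≈ fromℕ 2 * y
      cosΔ₁ = trans (+-cong (*-congˡ (Y-double α)) (*-congˡ (Θ-double α)))
        (modulo {k = y} (x≈y⇒x-y≈0 (Y²+Θ² α))
          (solve 2 (λ y t → y :* (y :* y :- con (+ 2)) :+ t :* (y :* t) := con (+ 2) :* y :+ y :* (y :* y :+ t :* t :- con (+ 4))) refl y θ))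

      sinΔ₁ : sinΔ α (α + α) ≈ fromℕ 2 * θ
      sinΔ₁ = trans (+-cong (*-congˡ (Θ-double α)) (-‿cong (*-congˡ (Y-double α))))
        (solve 2 (λ y t → y :* (y :* t) :- t :* (y :* y :- con (+ 2)) := con (+ 2) :* t) refl y θ)

    distance : Vec (Fin 3) 3 → Vec (Fin 3) 3 → Carrier
    distance u v = sum λ i → (minkowski R α u i - minkowski R α v i) * (minkowski R α u i - minkowski R α v i)

    -- Relative to one another the triangles are turned by α, α and 2α, whence only 2 cos and 2 sin
    -- of α and 2α occur. Scalar products bring the cosines, vector products √3 times the sines,
    -- with integer coefficients after scaling by 12.
    distance-formula : ∀ j k l j′ k′ l′ → fromℕ 12 * distance (j ∷ k ∷ l ∷ []) (j′ ∷ k′ ∷ l′ ∷ [])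
      ≈ fromℤ (N j j′ ℤ.+ N k k′ ℤ.+ N l l′)
      + fromℤ (E j j′ k k′ ℤ.+ E k k′ l l′) * y + fromℤ (F j j′ k k′ ℤ.+ F k k′ l l′) * (√3 * θ)
      + fromℤ (E j j′ l l′) * y′ + fromℤ (F j j′ l l′) * (√3 * θ′)
    -- Coordinates are scaled by 4 and R² = 1/3, so the natural scale is 3 · 4² = 4 · 12; the
    -- surplus 4 is cancelled.
    distance-formula j k l j′ k′ l′ = #0-cancel (fromℕ-suc#0 3) (begin
      fromℕ 4 * (fromℕ 12 * (dx * dx + (dy * dy + 0#)))
        ≈⟨ scale dx dy ⟩
      fromℕ 3 * ((fromℕ 4 * dx) * (fromℕ 4 * dx) + (fromℕ 4 * dy) * (fromℕ 4 * dy))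
        ≈⟨ *-congˡ (+-cong (*-cong (4Δ 0F) (4Δ 0F)) (*-cong (4Δ 1F) (4Δ 1F))) ⟩
      fromℕ 3 * (R * (x₀ + x₁ + x₂) * (R * (x₀ + x₁ + x₂)) + R * (z₀ + z₁ + z₂) * (R * (z₀ + z₁ + z₂)))
        ≈⟨ extract R (x₀ + x₁ + x₂) (z₀ + z₁ + z₂) ⟩
      fromℕ 3 * (R * R) * ((x₀ + x₁ + x₂) * (x₀ + x₁ + x₂) + (z₀ + z₁ + z₂) * (z₀ + z₁ + z₂))
        ≈⟨ trans (*-congʳ 3R²≈1) (*-identityˡ _) ⟩
      (x₀ + x₁ + x₂) * (x₀ + x₁ + x₂) + (z₀ + z₁ + z₂) * (z₀ + z₁ + z₂)
        ≈⟨ squares x₀ x₁ x₂ z₀ z₁ z₂ ⟩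
      (x₀ * x₀ + z₀ * z₀) + (x₁ * x₁ + z₁ * z₁) + (x₂ * x₂ + z₂ * z₂)
        + fromℕ 2 * ((x₀ * x₁ + z₀ * z₁) + (x₁ * x₂ + z₁ * z₂) + (x₀ * x₂ + z₀ * z₂))
        ≈⟨ +-cong (+-cong (+-cong (square 0# j j′) (square α k k′)) (square (α + α) l l′))
             (*-congˡ (+-cong (+-cong
               (trans (scalar 0# α j j′ k k′) (+-cong (*-congˡ (cosΔ₀ α)) (*-congˡ (*-congˡ (sinΔ₀ α)))))
               (trans (scalar α (α + α) k k′ l l′) (+-cong (*-congˡ cosΔ₁) (*-congˡ (*-congˡ sinΔ₁)))))
               (trans (scalar 0# (α + α) j j′ l l′) (+-cong (*-congˡ (cosΔ₀ (α + α))) (*-congˡ (*-congˡ (sinΔ₀ (α + α)))))))) ⟩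
      fromℤ (N j j′) * fromℕ 4 + fromℤ (N k k′) * fromℕ 4 + fromℤ (N l l′) * fromℕ 4
        + fromℕ 2 * (fromℤ (E j j′ k k′) * (fromℕ 2 * y) + fromℤ (F j j′ k k′) * (√3 * (fromℕ 2 * θ))
          + (fromℤ (E k k′ l l′) * (fromℕ 2 * y) + fromℤ (F k k′ l l′) * (√3 * (fromℕ 2 * θ)))
          + (fromℤ (E j j′ l l′) * (fromℕ 2 * y′) + fromℤ (F j j′ l l′) * (√3 * (fromℕ 2 * θ′))))
        ≈⟨ collect (fromℤ (N j j′)) (fromℤ (N k k′)) (fromℤ (N l l′))
             (fromℤ (E j j′ k k′)) (fromℤ (E k k′ l l′)) (fromℤ (E j j′ l l′))
             (fromℤ (F j j′ k k′)) (fromℤ (F k k′ l l′)) (fromℤ (F j j′ l l′)) √3 y θ y′ θ′ ⟩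
      fromℕ 4 * (fromℤ (N j j′) + fromℤ (N k k′) + fromℤ (N l l′)
        + (fromℤ (E j j′ k k′) + fromℤ (E k k′ l l′)) * y + (fromℤ (F j j′ k k′) + fromℤ (F k k′ l l′)) * (√3 * θ)
        + fromℤ (E j j′ l l′) * y′ + fromℤ (F j j′ l l′) * (√3 * θ′))
        ≈⟨ *-congˡ (+-congʳ (+-congʳ (+-cong (+-cong
             (trans (fromℤ-+ (N j j′ ℤ.+ N k k′) (N l l′)) (+-congʳ (fromℤ-+ (N j j′) (N k k′))))
             (*-congʳ (fromℤ-+ (E j j′ k k′) (E k k′ l l′)))) (*-congʳ (fromℤ-+ (F j j′ k k′) (F k k′ l l′)))))) ⟨
      fromℕ 4 * (fromℤ (N j j′ ℤ.+ N k k′ ℤ.+ N l l′)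
      + fromℤ (E j j′ k k′ ℤ.+ E k k′ l l′) * y + fromℤ (F j j′ k k′ ℤ.+ F k k′ l l′) * (√3 * θ)
      + fromℤ (E j j′ l l′) * y′ + fromℤ (F j j′ l l′) * (√3 * θ′)) ∎)
      where
      dx dy x₀ x₁ x₂ z₀ z₁ z₂ : Carrier
      dx = minkowski R α (j ∷ k ∷ l ∷ []) 0F - minkowski R α (j′ ∷ k′ ∷ l′ ∷ []) 0F
      dy = minkowski R α (j ∷ k ∷ l ∷ []) 1F - minkowski R α (j′ ∷ k′ ∷ l′ ∷ []) 1F
      x₀ = W 0# (a j j′) (b j j′) 0F
      x₁ = W α (a k k′) (b k k′) 0F
      x₂ = W (α + α) (a l l′) (b l l′) 0F
      z₀ = W 0# (a j j′) (b j j′) 1F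
      z₁ = W α (a k k′) (b k k′) 1F
      z₂ = W (α + α) (a l l′) (b l l′) 1F
      scale : ∀ x z → fromℕ 4 * (fromℕ 12 * (x * x + (z * z + 0#))) ≈ fromℕ 3 * ((fromℕ 4 * x) * (fromℕ 4 * x) + (fromℕ 4 * z) * (fromℕ 4 * z))
      scale = solve 2 (λ x z → con (+ 4) :* (con (+ 12) :* (x :* x :+ (z :* z :+ con (+ 0))))
        := con (+ 3) :* ((con (+ 4) :* x) :* (con (+ 4) :* x) :+ (con (+ 4) :* z) :* (con (+ 4) :* z))) refl
      differences : ∀ q x y z x′ y′ z′ → q * (x + y + z - (x′ + y′ + z′)) ≈ q * (x - x′) + q * (y - y′) + q * (z - z′)
      differences = solve 7 (λ q x y z x′ y′ z′ → q :* (x :+ y :+ z :- (x′ :+ y′ :+ z′)) := q :* (x :- x′) :+ q :* (y :- y′) :+ q :* (z :- z′)) refl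
      factor : ∀ r x y z → r * x + r * y + r * z ≈ r * (x + y + z)
      factor = solve 4 (λ r x y z → r :* x :+ r :* y :+ r :* z := r :* (x :+ y :+ z)) refl
      4Δ : ∀ i → fromℕ 4 * (minkowski R α (j ∷ k ∷ l ∷ []) i - minkowski R α (j′ ∷ k′ ∷ l′ ∷ []) i)
        ≈ R * (W 0# (a j j′) (b j j′) i + W α (a k k′) (b k k′) i + W (α + α) (a l l′) (b l l′) i)
      4Δ i = trans (differences (fromℕ 4) (T R 0# j i) (T R α k i) (T R (α + α) l i) (T R 0# j′ i) (T R α k′ i) (T R (α + α) l′ i))
        (trans (+-cong (+-cong (4ΔT 0# j j′ i) (4ΔT α k k′ i)) (4ΔT (α + α) l l′ i)) (factor R _ _ _))
      extract : ∀ r x z → fromℕ 3 * (r * x * (r * x) + r * z * (r * z)) ≈ fromℕ 3 * (r * r) * (x * x + z * z)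
      extract = solve 3 (λ r x z → con (+ 3) :* (r :* x :* (r :* x) :+ r :* z :* (r :* z)) := con (+ 3) :* (r :* r) :* (x :* x :+ z :* z)) refl
      squares : ∀ x₀ x₁ x₂ z₀ z₁ z₂ → (x₀ + x₁ + x₂) * (x₀ + x₁ + x₂) + (z₀ + z₁ + z₂) * (z₀ + z₁ + z₂)
        ≈ (x₀ * x₀ + z₀ * z₀) + (x₁ * x₁ + z₁ * z₁) + (x₂ * x₂ + z₂ * z₂)
        + fromℕ 2 * ((x₀ * x₁ + z₀ * z₁) + (x₁ * x₂ + z₁ * z₂) + (x₀ * x₂ + z₀ * z₂))
      squares = solve 6 (λ x₀ x₁ x₂ z₀ z₁ z₂ → (x₀ :+ x₁ :+ x₂) :* (x₀ :+ x₁ :+ x₂) :+ (z₀ :+ z₁ :+ z₂) :* (z₀ :+ z₁ :+ z₂)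
        := (x₀ :* x₀ :+ z₀ :* z₀) :+ (x₁ :* x₁ :+ z₁ :* z₁) :+ (x₂ :* x₂ :+ z₂ :* z₂)
        :+ con (+ 2) :* ((x₀ :* x₁ :+ z₀ :* z₁) :+ (x₁ :* x₂ :+ z₁ :* z₂) :+ (x₀ :* x₂ :+ z₀ :* z₂))) refl
      collect : ∀ n₀ n₁ n₂ e₀ e₁ e₂ f₀ f₁ f₂ s y t y′ t′ →
        n₀ * fromℕ 4 + n₁ * fromℕ 4 + n₂ * fromℕ 4
        + fromℕ 2 * (e₀ * (fromℕ 2 * y) + f₀ * (s * (fromℕ 2 * t)) + (e₁ * (fromℕ 2 * y) + f₁ * (s * (fromℕ 2 * t))) + (e₂ * (fromℕ 2 * y′) + f₂ * (s * (fromℕ 2 * t′))))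
        ≈ fromℕ 4 * (n₀ + n₁ + n₂ + (e₀ + e₁) * y + (f₀ + f₁) * (s * t) + e₂ * y′ + f₂ * (s * t′))
      collect = solve 14 (λ n₀ n₁ n₂ e₀ e₁ e₂ f₀ f₁ f₂ s y t y′ t′ →
        n₀ :* con (+ 4) :+ n₁ :* con (+ 4) :+ n₂ :* con (+ 4)
        :+ con (+ 2) :* (e₀ :* (con (+ 2) :* y) :+ f₀ :* (s :* (con (+ 2) :* t)) :+ (e₁ :* (con (+ 2) :* y) :+ f₁ :* (s :* (con (+ 2) :* t))) :+ (e₂ :* (con (+ 2) :* y′) :+ f₂ :* (s :* (con (+ 2) :* t′))))
        := con (+ 4) :* (n₀ :+ n₁ :+ n₂ :+ (e₀ :+ e₁) :* y :+ (f₀ :+ f₁) :* (s :* t) :+ e₂ :* y′ :+ f₂ :* (s :* t′))) refl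

    -- To be applied to 12 times a squared distance minus 12d, whose constant term is 12 times the
    -- Hamming distance minus 12d: a squared distance d forces Hamming distance d.
    Separated : Set _
    Separated = ∀ m q₁ q₂ q₃ q₄ →
      fromℤ m + fromℤ q₁ * y + fromℤ q₂ * (√3 * θ) + fromℤ q₃ * y′ + fromℤ q₄ * (√3 * θ′) ≈ 0# → m ≡ + 0

    N-≡ : ∀ k → N k k ≡ + 0
    N-≡ 0F = ≡.refl
    N-≡ 1F = ≡.refl
    N-≡ 2F = ≡.refl

    N-≢ : ∀ {k l} → k ≢ l → N k l ≡ + 12
    N-≢ {0F} {0F} k≢l = ⊥-elim (k≢l ≡.refl)
    N-≢ {0F} {1F} k≢l = ≡.refl
    N-≢ {0F} {2F} k≢l = ≡.refl
    N-≢ {1F} {0F} k≢l = ≡.refl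
    N-≢ {1F} {1F} k≢l = ⊥-elim (k≢l ≡.refl)
    N-≢ {1F} {2F} k≢l = ≡.refl
    N-≢ {2F} {0F} k≢l = ≡.refl
    N-≢ {2F} {1F} k≢l = ≡.refl
    N-≢ {2F} {2F} k≢l = ⊥-elim (k≢l ≡.refl)

    private
      A-≡ : ∀ k → A k k ≡ + 0
      A-≡ k = ℤ.+-inverseʳ (C k)

      B-≡ : ∀ k → B k k ≡ + 0
      B-≡ k = ℤ.+-inverseʳ (S k)

      E-≡ˡ : ∀ k k′ l′ → E k k k′ l′ ≡ + 0
      E-≡ˡ k k′ l′ = ≡.cong₂ (λ i j → i ℤ.* A k′ l′ ℤ.+ + 3 ℤ.* (j ℤ.* B k′ l′)) (A-≡ k) (B-≡ k)

      F-≡ˡ : ∀ k k′ l′ → F k k k′ l′ ≡ + 0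
      F-≡ˡ k k′ l′ = ≡.cong₂ (λ i j → j ℤ.* A k′ l′ ℤ.- i ℤ.* B k′ l′) (A-≡ k) (B-≡ k)

      E-≡ʳ : ∀ k l k′ → E k l k′ k′ ≡ + 0
      E-≡ʳ k l k′ = ≡.trans (≡.cong₂ (λ i j → A k l ℤ.* i ℤ.+ + 3 ℤ.* (B k l ℤ.* j)) (A-≡ k′) (B-≡ k′))
        (≡.cong₂ (λ i j → i ℤ.+ + 3 ℤ.* j) (ℤ.*-zeroʳ (A k l)) (ℤ.*-zeroʳ (B k l)))

      F-≡ʳ : ∀ k l k′ → F k l k′ k′ ≡ + 0
      F-≡ʳ k l k′ = ≡.trans (≡.cong₂ (λ i j → B k l ℤ.* i ℤ.- A k l ℤ.* j) (A-≡ k′) (B-≡ k′))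
        (≡.cong₂ ℤ._-_ (ℤ.*-zeroʳ (B k l)) (ℤ.*-zeroʳ (A k l)))

      p : Vec (Fin 3) 3 → Vector Carrier 2
      p = minkowski R α

      -- Twelve times the Hamming distance.
      12h : Vec (Fin 3) 3 → Vec (Fin 3) 3 → ℤ
      12h (j ∷ k ∷ l ∷ []) (j′ ∷ k′ ∷ l′ ∷ []) = N j j′ ℤ.+ N k k′ ℤ.+ N l l′

      unit : ∀ u v → DifferOnce u v → distance u v ≈ 1#
      unit (j ∷ k ∷ l ∷ []) (j′ ∷ k′ ∷ l′ ∷ []) (i , u≢v , u≡v) =
        #0-cancel (fromℕ-suc#0 11) (trans (distance-formula j k l j′ k′ l′) (trans (value i u≢v u≡v) (sym (*-identityʳ _))))
        where
        formula : (n e₁ f₁ e₂ f₂ : ℤ) → Carrier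
        formula n e₁ f₁ e₂ f₂ = fromℤ n + fromℤ e₁ * y + fromℤ f₁ * (√3 * θ) + fromℤ e₂ * y′ + fromℤ f₂ * (√3 * θ′)
        formula-cong : ∀ {n e₁ f₁ e₂ f₂} → n ≡ + 12 → e₁ ≡ + 0 → f₁ ≡ + 0 → e₂ ≡ + 0 → f₂ ≡ + 0 →
          formula n e₁ f₁ e₂ f₂ ≈ fromℕ 12
        formula-cong ≡.refl ≡.refl ≡.refl ≡.refl ≡.refl = solve 4 (λ y s y′ s′ →
          con (+ 12) :+ con (+ 0) :* y :+ con (+ 0) :* s :+ con (+ 0) :* y′ :+ con (+ 0) :* s′ := con (+ 12)) refl y (√3 * θ) y′ (√3 * θ′)
        value : ∀ i → lookup (j ∷ k ∷ l ∷ []) i ≢ lookup (j′ ∷ k′ ∷ l′ ∷ []) i →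
          (∀ i′ → i′ ≢ i → lookup (j ∷ k ∷ l ∷ []) i′ ≡ lookup (j′ ∷ k′ ∷ l′ ∷ []) i′) →
          formula (N j j′ ℤ.+ N k k′ ℤ.+ N l l′) (E j j′ k k′ ℤ.+ E k k′ l l′) (F j j′ k k′ ℤ.+ F k k′ l l′)
            (E j j′ l l′) (F j j′ l l′) ≈ fromℕ 12
        value 0F u≢v u≡v with u≡v 1F (λ ()) | u≡v 2F (λ ())
        ... | ≡.refl | ≡.refl = formula-cong (≡.cong₂ ℤ._+_ (≡.cong₂ ℤ._+_ (N-≢ u≢v) (N-≡ k)) (N-≡ l))
          (≡.cong₂ ℤ._+_ (E-≡ʳ j j′ k) (E-≡ˡ k l l)) (≡.cong₂ ℤ._+_ (F-≡ʳ j j′ k) (F-≡ˡ k l l)) (E-≡ʳ j j′ l) (F-≡ʳ j j′ l)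
        value 1F u≢v u≡v with u≡v 0F (λ ()) | u≡v 2F (λ ())
        ... | ≡.refl | ≡.refl = formula-cong (≡.cong₂ ℤ._+_ (≡.cong₂ ℤ._+_ (N-≡ j) (N-≢ u≢v)) (N-≡ l))
          (≡.cong₂ ℤ._+_ (E-≡ˡ j k k′) (E-≡ʳ k k′ l)) (≡.cong₂ ℤ._+_ (F-≡ˡ j k k′) (F-≡ʳ k k′ l)) (E-≡ˡ j l l) (F-≡ˡ j l l)
        value 2F u≢v u≡v with u≡v 0F (λ ()) | u≡v 1F (λ ())
        ... | ≡.refl | ≡.refl = formula-cong (≡.cong₂ ℤ._+_ (≡.cong₂ ℤ._+_ (N-≡ j) (N-≡ k)) (N-≢ u≢v))
          (≡.cong₂ ℤ._+_ (E-≡ˡ j k k) (E-≡ˡ k l l′)) (≡.cong₂ ℤ._+_ (F-≡ˡ j k k) (F-≡ˡ k l l′)) (E-≡ˡ j l l′) (F-≡ˡ j l l′)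

      hamming : Separated → ∀ u v d → distance u v ≈ fromℕ d → 12h u v ≡ + (12 ℕ.* d)
      hamming separated (j ∷ k ∷ l ∷ []) (j′ ∷ k′ ∷ l′ ∷ []) d eq =
        ℤ.i-j≡0⇒i≡j n (+ (12 ℕ.* d)) (separated (n ℤ.- + (12 ℕ.* d)) e₁ f₁ e₂ f₂ (begin
          fromℤ (n ℤ.- + (12 ℕ.* d)) + fromℤ e₁ * y + fromℤ f₁ * (√3 * θ) + fromℤ e₂ * y′ + fromℤ f₂ * (√3 * θ′)
            ≈⟨ +-congʳ (+-congʳ (+-congʳ (+-congʳ (trans (fromℤ-minus n (+ (12 ℕ.* d))) (+-congˡ (-‿cong (×1-homo-* 12 d))))))) ⟩
          (fromℤ n - fromℕ 12 * fromℕ d) + fromℤ e₁ * y + fromℤ f₁ * (√3 * θ) + fromℤ e₂ * y′ + fromℤ f₂ * (√3 * θ′)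
            ≈⟨ regroup (fromℤ n) (fromℕ 12 * fromℕ d) (fromℤ e₁ * y) (fromℤ f₁ * (√3 * θ)) (fromℤ e₂ * y′) (fromℤ f₂ * (√3 * θ′)) ⟩
          (fromℤ n + fromℤ e₁ * y + fromℤ f₁ * (√3 * θ) + fromℤ e₂ * y′ + fromℤ f₂ * (√3 * θ′)) - fromℕ 12 * fromℕ d
            ≈⟨ x≈y⇒x-y≈0 (trans (sym (distance-formula j k l j′ k′ l′)) (*-congˡ eq)) ⟩
          0# ∎))
        where
        n e₁ f₁ e₂ f₂ : ℤ
        n  = N j j′ ℤ.+ N k k′ ℤ.+ N l l′
        e₁ = E j j′ k k′ ℤ.+ E k k′ l l′
        f₁ = F j j′ k k′ ℤ.+ F k k′ l l′
        e₂ = E j j′ l l′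
        f₂ = F j j′ l l′
        regroup : ∀ n d a b c e → (n - d) + a + b + c + e ≈ (n + a + b + c + e) - d
        regroup = solve 6 (λ n d a b c e → (n :- d) :+ a :+ b :+ c :+ e := (n :+ a :+ b :+ c :+ e) :- d) refl

      -- Pairs the comparison of two letters with their contribution to `12h`, so that impossible
      -- totals are refuted by computation.
      Coordinate : Fin 3 → Fin 3 → ℤ → Set
      Coordinate k l n = (k ≡ l × n ≡ + 0) ⊎ (k ≢ l × n ≡ + 12)

      compare : ∀ k l → Coordinate k l (N k l)
      compare k l with k Fin.≟ l
      ... | yes ≡.refl = inj₁ (≡.refl , N-≡ k)
      ... | no  k≢l    = inj₂ (k≢l , N-≢ k≢l)

      12h-0 : ∀ u v → 12h u v ≡ + 0 → u ≡ v
      12h-0 (j ∷ k ∷ l ∷ []) (j′ ∷ k′ ∷ l′ ∷ []) = go (compare j j′) (compare k k′) (compare l l′)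
        where
        go : ∀ {j k l j′ k′ l′ : Fin 3} {a b c} → Coordinate j j′ a → Coordinate k k′ b → Coordinate l l′ c →
          a ℤ.+ b ℤ.+ c ≡ + 0 → _≡_ {A = Vec (Fin 3) 3} (j ∷ k ∷ l ∷ []) (j′ ∷ k′ ∷ l′ ∷ [])
        go (inj₁ (≡.refl , _)) (inj₁ (≡.refl , _)) (inj₁ (≡.refl , _)) _ = ≡.refl
        go (inj₁ (_ , ≡.refl)) (inj₁ (_ , ≡.refl)) (inj₂ (_ , ≡.refl)) ()
        go (inj₁ (_ , ≡.refl)) (inj₂ (_ , ≡.refl)) (inj₁ (_ , ≡.refl)) ()
        go (inj₁ (_ , ≡.refl)) (inj₂ (_ , ≡.refl)) (inj₂ (_ , ≡.refl)) ()
        go (inj₂ (_ , ≡.refl)) (inj₁ (_ , ≡.refl)) (inj₁ (_ , ≡.refl)) ()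
        go (inj₂ (_ , ≡.refl)) (inj₁ (_ , ≡.refl)) (inj₂ (_ , ≡.refl)) ()
        go (inj₂ (_ , ≡.refl)) (inj₂ (_ , ≡.refl)) (inj₁ (_ , ≡.refl)) ()
        go (inj₂ (_ , ≡.refl)) (inj₂ (_ , ≡.refl)) (inj₂ (_ , ≡.refl)) ()

      12h-12 : ∀ u v → 12h u v ≡ + 12 → DifferOnce u v
      12h-12 (j ∷ k ∷ l ∷ []) (j′ ∷ k′ ∷ l′ ∷ []) = go (compare j j′) (compare k k′) (compare l l′)
        where
        go : ∀ {j k l j′ k′ l′ : Fin 3} {a b c} → Coordinate j j′ a → Coordinate k k′ b → Coordinate l l′ c →
          a ℤ.+ b ℤ.+ c ≡ + 12 → DifferOnce (j ∷ k ∷ l ∷ []) (j′ ∷ k′ ∷ l′ ∷ [])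
        go (inj₂ (j≢ , _)) (inj₁ (k≡ , _)) (inj₁ (l≡ , _)) _ = 0F , j≢ , λ { 0F i≢i → ⊥-elim (i≢i ≡.refl) ; 1F _ → k≡ ; 2F _ → l≡ }
        go (inj₁ (j≡ , _)) (inj₂ (k≢ , _)) (inj₁ (l≡ , _)) _ = 1F , k≢ , λ { 0F _ → j≡ ; 1F i≢i → ⊥-elim (i≢i ≡.refl) ; 2F _ → l≡ }
        go (inj₁ (j≡ , _)) (inj₁ (k≡ , _)) (inj₂ (l≢ , _)) _ = 2F , l≢ , λ { 0F _ → j≡ ; 1F _ → k≡ ; 2F i≢i → ⊥-elim (i≢i ≡.refl) }
        go (inj₁ (_ , ≡.refl)) (inj₁ (_ , ≡.refl)) (inj₁ (_ , ≡.refl)) ()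
        go (inj₁ (_ , ≡.refl)) (inj₂ (_ , ≡.refl)) (inj₂ (_ , ≡.refl)) ()
        go (inj₂ (_ , ≡.refl)) (inj₁ (_ , ≡.refl)) (inj₂ (_ , ≡.refl)) ()
        go (inj₂ (_ , ≡.refl)) (inj₂ (_ , ≡.refl)) (inj₁ (_ , ≡.refl)) ()
        go (inj₂ (_ , ≡.refl)) (inj₂ (_ , ≡.refl)) (inj₂ (_ , ≡.refl)) ()

    faithful : Separated → IsFaithful (H 3 3) (minkowski R α)
    faithful separated = record
      { injective    = λ {u} {v} pu≈pv → 12h-0 u v (hamming separated u v 0 (coincide u v pu≈pv))
      ; unitDistance = λ u v → mk⇔
          (λ { (_ , eq) → 12h-12 u v (hamming separated u v 1 (trans (sym eq) (trans (*-identityˡ 1#) (sym 1≈)))) })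
          (λ adj → 0<⇒0≤ 0<1 , trans (*-identityˡ 1#) (sym (unit u v adj)))
      }
      where
      coincide : ∀ u v → (∀ i → p u i ≈ p v i) → distance u v ≈ 0#
      coincide u v eq = begin
        Δ 0F * Δ 0F + (Δ 1F * Δ 1F + 0#)   ≈⟨ +-cong (*-congˡ (x≈y⇒x-y≈0 (eq 0F))) (+-congʳ (*-congˡ (x≈y⇒x-y≈0 (eq 1F)))) ⟩
        Δ 0F * 0# + (Δ 1F * 0# + 0#)       ≈⟨ +-cong (zeroʳ _) (+-congʳ (zeroʳ _)) ⟩
        0# + (0# + 0#)                     ≈⟨ trans (+-identityˡ _) (+-identityˡ _) ⟩
        0#                                 ∎
        where
        Δ : Fin 2 → Carrier
        Δ i = p u i - p v i

    isMinkowski : IsMinkowski α (minkowski R α)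
    isMinkowski = record
      { √3        = √3
      ; R         = R
      ; √3-sqrt   = 0<⇒0≤ 0<√3 , √3*√3≈3
      ; R≈1/√3    = R*√3≈1
      ; placement = λ _ _ → refl
      }

    private
      K : Pred Carrier _
      K = coordinateField (minkowski R α)

      p∈K : ∀ v i → p v i ∈ K
      p∈K v i = gen (v , i , refl)

      difference∈K : ∀ u v i → p u i - p v i ∈ K
      difference∈K u v i = add (p∈K u i) (neg (p∈K v i))

    -- The triangle T₀ has horizontal extent 3R/2 = √3/2. The other two letters are fixed, so the
    -- contributions of their triangles cancel.
    √3∈K : √3 ∈ K
    √3∈K = resp (#0-cancel (fromℕ-suc#0 1) (begin
      fromℕ 2 * (fromℕ 2 * (p (0F ∷ 0F ∷ 0F ∷ []) 0F - p (1F ∷ 0F ∷ 0F ∷ []) 0F))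
        ≈⟨ cancel (T R 0# 0F 0F) (T R α 0F 0F) (T R (α + α) 0F 0F) (T R 0# 1F 0F) ⟩
      fromℕ 4 * (T R 0# 0F 0F - T R 0# 1F 0F)    ≈⟨ 4ΔT 0# 0F 1F 0F ⟩
      R * (Y 0# * fromℕ 3 - Θ 0# * (- fromℕ 1 * √3))
        ≈⟨ *-congˡ (+-cong (*-congʳ Y0≈2) (-‿cong (trans (*-congʳ Θ0≈0) (zeroˡ _)))) ⟩
      R * (fromℕ 2 * fromℕ 3 - 0#)               ≈⟨ solve 1 (λ r → r :* (con (+ 2) :* con (+ 3) :- con (+ 0)) := con (+ 2) :* (con (+ 3) :* r)) refl R ⟩
      fromℕ 2 * (fromℕ 3 * R)                    ≈⟨ *-congˡ 3R≈√3 ⟩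
      fromℕ 2 * √3                               ∎))
      (mul (fromℕ∈ 2) (difference∈K (0F ∷ 0F ∷ 0F ∷ []) (1F ∷ 0F ∷ 0F ∷ []) 0F))
      where
      cancel : ∀ x y z x′ → fromℕ 2 * (fromℕ 2 * ((x + y + z) - (x′ + y + z))) ≈ fromℕ 4 * (x - x′)
      cancel = solve 4 (λ x y z x′ → con (+ 2) :* (con (+ 2) :* ((x :+ y :+ z) :- (x′ :+ y :+ z))) := con (+ 4) :* (x :- x′)) refl

    private
      cancel : ∀ x y z y′ → fromℕ 2 * (fromℕ 2 * ((x + y + z) - (x + y′ + z))) ≈ fromℕ 4 * (y - y′)
      cancel = solve 4 (λ x y z y′ → con (+ 2) :* (con (+ 2) :* ((x :+ y :+ z) :- (x :+ y′ :+ z))) := con (+ 4) :* (y :- y′)) refl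

    -- The side T₀[1] - T₀[2] is the vertical unit vector, so the corresponding side of the triangle
    -- turned by α is (-sin α, cos α). Its second coordinate is used here; the first, with the side
    -- reversed, gives sin α.
    Y∈K : Y α ∈ K
    Y∈K = resp (#0-cancel (fromℕ-suc#0 1) (begin
      fromℕ 2 * (fromℕ 2 * (p (0F ∷ 1F ∷ 0F ∷ []) 1F - p (0F ∷ 2F ∷ 0F ∷ []) 1F))
        ≈⟨ cancel (T R 0# 0F 1F) (T R α 1F 1F) (T R (α + α) 0F 1F) (T R α 2F 1F) ⟩
      fromℕ 4 * (T R α 1F 1F - T R α 2F 1F)      ≈⟨ 4ΔT α 1F 2F 1F ⟩
      R * (Θ α * 0# + Y α * (fromℕ 2 * √3))
        ≈⟨ solve 4 (λ r t y s → r :* (t :* con (+ 0) :+ y :* (con (+ 2) :* s)) := con (+ 2) :* (r :* s :* y)) refl R θ y √3 ⟩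
      fromℕ 2 * (R * √3 * Y α)                   ≈⟨ *-congˡ (trans (*-congʳ R*√3≈1) (*-identityˡ _)) ⟩
      fromℕ 2 * Y α                              ∎))
      (mul (fromℕ∈ 2) (difference∈K (0F ∷ 1F ∷ 0F ∷ []) (0F ∷ 2F ∷ 0F ∷ []) 1F))

    Θ∈K : Θ α ∈ K
    Θ∈K = resp (#0-cancel (fromℕ-suc#0 1) (begin
      fromℕ 2 * (fromℕ 2 * (p (0F ∷ 2F ∷ 0F ∷ []) 0F - p (0F ∷ 1F ∷ 0F ∷ []) 0F))
        ≈⟨ cancel (T R 0# 0F 0F) (T R α 2F 0F) (T R (α + α) 0F 0F) (T R α 1F 0F) ⟩
      fromℕ 4 * (T R α 2F 0F - T R α 1F 0F)      ≈⟨ 4ΔT α 2F 1F 0F ⟩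
      R * (Y α * 0# - Θ α * (- fromℕ 2 * √3))
        ≈⟨ solve 4 (λ r t y s → r :* (y :* con (+ 0) :- t :* (:- con (+ 2) :* s)) := con (+ 2) :* (r :* s :* t)) refl R θ y √3 ⟩
      fromℕ 2 * (R * √3 * Θ α)                   ≈⟨ *-congˡ (trans (*-congʳ R*√3≈1) (*-identityˡ _)) ⟩
      fromℕ 2 * Θ α                              ∎))
      (mul (fromℕ∈ 2) (difference∈K (0F ∷ 2F ∷ 0F ∷ []) (0F ∷ 1F ∷ 0F ∷ []) 0F))

    -- The triangle at 2α needs no further generator, by the double angle formulas.
    K⊆ : ∀ {s} {S : Pred Carrier s} → √3 ∈ ℚ⟨ S ⟩ → Y α ∈ ℚ⟨ S ⟩ → Θ α ∈ ℚ⟨ S ⟩ → K ⊆ ℚ⟨ S ⟩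
    K⊆ {S = S′} √3∈ Y∈ Θ∈ = field-⊆ λ { (v , i , x≈) → resp (sym x≈) (coordinate v i) }
      where
      R∈ : R ∈ ℚ⟨ S′ ⟩
      R∈ = divide∈ 2 (resp (sym 3R≈√3) √3∈)
      T∈ : ∀ {β} → Y β ∈ ℚ⟨ S′ ⟩ → Θ β ∈ ℚ⟨ S′ ⟩ → ∀ k i → T R β k i ∈ ℚ⟨ S′ ⟩
      T∈ {β} Yβ∈ Θβ∈ k i = divide∈ 3 (resp (sym (4T β k i)) (mul R∈ (W∈ i)))
        where
        W∈ : ∀ i → W β (fromℤ (C k)) (fromℤ (S k)) i ∈ ℚ⟨ S′ ⟩
        W∈ 0F = add (mul Yβ∈ (fromℤ∈ (C k))) (neg (mul Θβ∈ (mul (fromℤ∈ (S k)) √3∈)))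
        W∈ 1F = add (mul Θβ∈ (fromℤ∈ (C k))) (mul Yβ∈ (mul (fromℤ∈ (S k)) √3∈))
      coordinate : ∀ v i → p v i ∈ ℚ⟨ S′ ⟩
      coordinate (j ∷ k ∷ l ∷ []) i = add (add
        (T∈ (resp (sym Y0≈2) (fromℕ∈ 2)) (resp (sym Θ0≈0) zer) j i)
        (T∈ Y∈ Θ∈ k i))
        (T∈ (resp (sym (Y-double α)) (add (mul Y∈ Y∈) (neg (fromℕ∈ 2)))) (resp (sym (Θ-double α)) (mul Y∈ Θ∈)) l i)

-- Integer polynomials, translation, and adjunction of a square root.

module Polynomials {c ℓ₁ ℓ₂} (ℛ : RealNumbers c ℓ₁ ℓ₂) where
  open RealNumbers ℛ hiding (zero)
  open Fields ℛ
  open Arithmetic ℛ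
  open Sums ℛ
  open Eisenstein ℛ
  open Places ℛ
  open LinearAlgebra ℛ
  open SetoidReasoning (CommutativeRing.setoid commutativeRing)

  -- It denotes `evalℤ zs` by definition, so an integer polynomial is written once as a list and
  -- used both as data and inside the solver.
  horner : ∀ {n} → List ℤ → Solver.Polynomial n → Solver.Polynomial n
  horner []       x = con (+ 0)
  horner (z ∷ zs) x = con z :+ x :* horner zs x

  coeff : List ℤ → ℕ → ℤ
  coeff []       _       = + 0
  coeff (z ∷ zs) zero    = z
  coeff (z ∷ zs) (suc i) = coeff zs i

  evalℤ-Σ : ∀ n zs t → length zs ℕ.≤ n → evalℤ zs t ≈ Σ< n (λ i → fromℤ (coeff zs i) * t ^ i)
  evalℤ-Σ n       []       t _         = sym (Σ<-0 n (λ _ → zeroˡ _))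
  evalℤ-Σ (suc n) (z ∷ zs) t (s≤s zs≤n) = +-cong (sym (*-identityʳ _)) (trans (*-congˡ (evalℤ-Σ n zs t zs≤n))
    (trans (sym (Σ<-*ˡ n t (λ i → fromℤ (coeff zs i) * t ^ i))) (Σ<-cong n (λ i → x∙yz≈y∙xz t (fromℤ (coeff zs i)) (t ^ i)))))

  span-evalℤ : ∀ {n} zs {t} → length zs ℕ.≤ n → Span n (t ^_) (evalℤ zs t)
  span-evalℤ {n} zs {t} zs≤n = combination-of (λ i → coeff zs i ℚ./ 1)
    (trans (evalℤ-Σ n zs t zs≤n) (Σ<-cong n (λ i → *-congʳ (sym (fromℚ-/1 (coeff zs i))))))

  independent-evalℤ : ∀ {n t} → Independent n (t ^_) → ∀ zs → length zs ℕ.≤ n → evalℤ zs t ≈ 0# →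
    ∀ i → i ℕ.< n → coeff zs i ≡ + 0
  independent-evalℤ {n} {t} ind zs zs≤n eq = ind (coeff zs) (trans (sym (evalℤ-Σ n zs t zs≤n)) eq)

  module _ {x t : Carrier} (r : ℤ) (t≈x+r : t ≈ x + fromℤ r) where
    private
      -- The coefficients of z + (x + r) · evalℤ bs x.
      step : ℤ → List ℤ → List ℤ
      step z []       = z ∷ []
      step z (b ∷ bs) = z ℤ.+ r ℤ.* b ∷ step b bs

      shift : List ℤ → List ℤ
      shift []       = []
      shift (z ∷ zs) = step z (shift zs)

      evalℤ-step : ∀ z bs → evalℤ (step z bs) x ≈ fromℤ z + (x + fromℤ r) * evalℤ bs x
      evalℤ-step z []       = +-congˡ (trans (zeroʳ x) (sym (zeroʳ _)))
      evalℤ-step z (b ∷ bs) = trans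
        (+-cong (trans (fromℤ-+ z (r ℤ.* b)) (+-congˡ (fromℤ-* r b))) (*-congˡ (evalℤ-step b bs)))
        (solve 5 (λ z r b x e → z :+ r :* b :+ x :* (b :+ (x :+ r) :* e) := z :+ (x :+ r) :* (b :+ x :* e)) refl
          (fromℤ z) (fromℤ r) (fromℤ b) x (evalℤ bs x))

      evalℤ-shift : ∀ zs → evalℤ (shift zs) x ≈ evalℤ zs t
      evalℤ-shift []       = refl
      evalℤ-shift (z ∷ zs) = trans (evalℤ-step z (shift zs)) (+-congˡ (*-cong (sym t≈x+r) (evalℤ-shift zs)))

      length-step : ∀ z bs → length (step z bs) ≡ suc (length bs)
      length-step z []       = ≡.refl
      length-step z (b ∷ bs) = ≡.cong suc (length-step b bs)

      length-shift : ∀ zs → length (shift zs) ≡ length zs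
      length-shift []       = ≡.refl
      length-shift (z ∷ zs) = ≡.trans (length-step z (shift zs)) (≡.cong suc (length-shift zs))

      -- Translation is unitriangular on coefficients: the leading one is unchanged, and zeros
      -- propagate downwards from it.
      step-0 : ∀ z bs → (∀ i → coeff (step z bs) i ≡ + 0) → z ≡ + 0 × (∀ i → coeff bs i ≡ + 0)
      step-0 z []       zeros = zeros 0 , λ _ → ≡.refl
      step-0 z (b ∷ bs) zeros = helper (step-0 b bs (zeros ∘ suc)) (zeros 0)
        where
        helper : b ≡ + 0 × (∀ i → coeff bs i ≡ + 0) → z ℤ.+ r ℤ.* b ≡ + 0 → z ≡ + 0 × (∀ i → coeff (b ∷ bs) i ≡ + 0)
        helper (≡.refl , bs≡0) eq = ≡.trans (≡.sym (≡.trans (≡.cong (λ j → z ℤ.+ j) (ℤ.*-zeroʳ r)) (ℤ.+-identityʳ z))) eq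
          , λ { zero → ≡.refl ; (suc i) → bs≡0 i }

      shift-0 : ∀ zs → (∀ i → coeff (shift zs) i ≡ + 0) → ∀ i → coeff zs i ≡ + 0
      shift-0 []       zeros i       = ≡.refl
      shift-0 (z ∷ zs) zeros zero    = proj₁ (step-0 z (shift zs) zeros)
      shift-0 (z ∷ zs) zeros (suc i) = shift-0 zs (proj₂ (step-0 z (shift zs) zeros)) i

      coeff-≥ : ∀ zs i → length zs ℕ.≤ i → coeff zs i ≡ + 0
      coeff-≥ []       i       _          = ≡.refl
      coeff-≥ (z ∷ zs) (suc i) (s≤s zs≤i) = coeff-≥ zs i zs≤i

      coeff-applyUpTo : ∀ (a : ℕ → ℤ) n i → i ℕ.< n → coeff (applyUpTo a n) i ≡ a i
      coeff-applyUpTo a (suc n) zero    _         = ≡.refl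
      coeff-applyUpTo a (suc n) (suc i) (s≤s i<n) = coeff-applyUpTo (a ∘ suc) n i i<n

    -- Since translation by an integer is injective on coefficients, Eisenstein's criterion may be
    -- applied to t - r in place of t.
    independent-shift : ∀ {n} → Independent n (x ^_) → Independent n (t ^_)
    independent-shift {n} ind a eq i i<n = ≡.trans (≡.sym (coeff-applyUpTo a n i i<n)) (shift-0 zs shifted i)
      where
      zs : List ℤ
      zs = applyUpTo a n
      bound : length (shift zs) ≡ n
      bound = ≡.trans (length-shift zs) (length-applyUpTo a n)
      root : evalℤ (shift zs) x ≈ 0#
      root = trans (evalℤ-shift zs) (trans (evalℤ-Σ n zs t (ℕ.≤-reflexive (length-applyUpTo a n)))
        (trans (Σ<-cong< n (λ j j<n → *-congʳ (reflexive (≡.cong fromℤ (coeff-applyUpTo a n j j<n))))) eq))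
      shifted : ∀ j → coeff (shift zs) j ≡ + 0
      shifted j = [ independent-evalℤ ind (shift zs) (ℕ.≤-reflexive bound) root j
                  , (λ n≤j → coeff-≥ (shift zs) j (≡.subst (ℕ._≤ j) (≡.sym bound) n≤j)) ]′ (ℕ.<-≤-connex j n)

  -- `z ∷ zs` are the lower coefficients, moved to the other side and freed of the common factor p,
  -- so the condition on p² reads p ∤ z.
  eisenstein : ∀ {p} → Prime p → ∀ {z} zs {t} → ¬ (+ p ∣ z) → t ^ suc (length zs) ≈ fromℕ p * evalℤ (z ∷ zs) t →
    Independent (suc (length zs)) (t ^_)
  eisenstein {p} p-prime {z} zs {t} p∤z eq a rel i i<n = fromℤ-injective₀ (a i)
    (Independence.independent (ℤ-place p p-prime) (length zs) t (λ i → fromℤ (coeff (z ∷ zs) i))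
      (λ i → coeff (z ∷ zs) i , refl) (z , refl , p∤z)
      (trans eq (*-congˡ (evalℤ-Σ (suc (length zs)) (z ∷ zs) t ℕ.≤-refl)))
      ((λ i → a i , refl) , rel) i i<n)

  Adjoin : ∀ {a} → Pred Carrier a → Carrier → Pred Carrier _
  Adjoin A r x = ∃[ x₁ ] ∃[ x₂ ] A x₁ × A x₂ × x ≈ x₁ + r * x₂

  module _ {a} {A : Pred Carrier a} (sub : IsSubalgebra A) where
    open IsSubalgebra sub

    A-fromℤ : ∀ z → A (fromℤ z)
    A-fromℤ z = A-resp (trans (*-identityʳ _) (fromℚ-/1 z)) (A-· (z ℚ./ 1) A-1)

    A-evalℤ : ∀ zs {t} → A t → A (evalℤ zs t)
    A-evalℤ []       t∈ = A-0
    A-evalℤ (z ∷ zs) t∈ = A-+ (A-fromℤ z) (A-* t∈ (A-evalℤ zs t∈))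

    A-divide : ∀ n {x} → A (fromℕ (suc n) * x) → A x
    A-divide n {x} p = A-resp (trans (sym (*-assoc _ _ _)) (trans (*-congʳ (trans (*-comm _ _)
      (trans (fromℚ-/ (+ 1) n) 1≈))) (*-identityˡ x))) (A-· (+ 1 ℚ./ suc n) p)

    adjoin-isSubalgebra : ∀ {r} → A (r * r) → IsSubalgebra (Adjoin A r)
    adjoin-isSubalgebra {r} r² = record
      { A-resp = λ { x≈y (x₁ , x₂ , a₁ , a₂ , eq) → x₁ , x₂ , a₁ , a₂ , trans (sym x≈y) eq }
      ; A-1    = 1# , 0# , A-1 , A-0 , sym (trans (+-congˡ (zeroʳ r)) (+-identityʳ 1#))
      ; A-+    = λ { (x₁ , x₂ , a₁ , a₂ , eq) (y₁ , y₂ , b₁ , b₂ , eq′) → x₁ + y₁ , x₂ + y₂ , A-+ a₁ b₁ , A-+ a₂ b₂ , trans (+-cong eq eq′) (sum₂ x₁ x₂ y₁ y₂ r) }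
      ; A-·    = λ { q (x₁ , x₂ , a₁ , a₂ , eq) → q · x₁ , q · x₂ , A-· q a₁ , A-· q a₂ , trans (*-congˡ eq) (scaled (fromℚ q) x₁ x₂ r) }
      ; A-*    = λ { (x₁ , x₂ , a₁ , a₂ , eq) (y₁ , y₂ , b₁ , b₂ , eq′) →
                   x₁ * y₁ + r * r * (x₂ * y₂) , x₁ * y₂ + x₂ * y₁
                 , A-+ (A-* a₁ b₁) (A-* r² (A-* a₂ b₂)) , A-+ (A-* a₁ b₂) (A-* a₂ b₁) , trans (*-cong eq eq′) (product x₁ x₂ y₁ y₂ r) }
      }
      where
      sum₂ : ∀ x₁ x₂ y₁ y₂ r → (x₁ + r * x₂) + (y₁ + r * y₂) ≈ x₁ + y₁ + r * (x₂ + y₂)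
      sum₂ = solve 5 (λ x₁ x₂ y₁ y₂ r → (x₁ :+ r :* x₂) :+ (y₁ :+ r :* y₂) := x₁ :+ y₁ :+ r :* (x₂ :+ y₂)) refl
      scaled : ∀ q x₁ x₂ r → q * (x₁ + r * x₂) ≈ q * x₁ + r * (q * x₂)
      scaled = solve 4 (λ q x₁ x₂ r → q :* (x₁ :+ r :* x₂) := q :* x₁ :+ r :* (q :* x₂)) refl
      product : ∀ x₁ x₂ y₁ y₂ r → (x₁ + r * x₂) * (y₁ + r * y₂) ≈ x₁ * y₁ + r * r * (x₂ * y₂) + r * (x₁ * y₂ + x₂ * y₁)
      product = solve 5 (λ x₁ x₂ y₁ y₂ r → (x₁ :+ r :* x₂) :* (y₁ :+ r :* y₂)
        := x₁ :* y₁ :+ r :* r :* (x₂ :* y₂) :+ r :* (x₁ :* y₂ :+ x₂ :* y₁)) refl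

    adjoin-A : ∀ {r x} → A x → Adjoin A r x
    adjoin-A {r} {x} a = x , 0# , a , A-0 , sym (trans (+-congˡ (zeroʳ r)) (+-identityʳ x))

    adjoin-root : ∀ {r} → Adjoin A r r
    adjoin-root {r} = 0# , 1# , A-0 , A-1 , sym (trans (+-identityˡ _) (*-identityʳ r))

  -- v₀, …, vₙ₋₁, r v₀, …, r vₙ₋₁
  doubled : ℕ → Carrier → (ℕ → Carrier) → ℕ → Carrier
  doubled n r v i with i ℕ.<? n
  ... | yes _ = v i
  ... | no  _ = r * v (i ℕ.∸ n)

  doubled-< : ∀ {n r v i} → i ℕ.< n → doubled n r v i ≡ v i
  doubled-< {n} {i = i} i<n with i ℕ.<? n
  ... | yes _  = ≡.refl
  ... | no i≮n = ⊥-elim (i≮n i<n)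

  doubled-≥ : ∀ {n r v} j → doubled n r v (n ℕ.+ j) ≡ r * v j
  doubled-≥ {n} {r} {v} j with n ℕ.+ j ℕ.<? n
  ... | yes n+j<n = ⊥-elim (ℕ.m+n≮m n j n+j<n)
  ... | no  _     = ≡.cong (λ k → r * v k) (ℕ.m+n∸m≡n n j)

  Σ<-doubled : ∀ n r v (f : ℕ → Carrier) → Σ< (n ℕ.+ n) (λ k → f k * doubled n r v k)
    ≈ Σ< n (λ i → f i * v i) + r * Σ< n (λ i → f (n ℕ.+ i) * v i)
  Σ<-doubled n r v f = trans (Σ<-split n n (λ k → f k * doubled n r v k)) (+-cong
    (Σ<-cong< n (λ i i<n → *-congˡ (reflexive (doubled-< {n} {r} {v} i<n))))
    (trans (Σ<-cong n (λ j → trans (*-congˡ (reflexive (doubled-≥ {n} {r} {v} j))) (x∙yz≈y∙xz (f (n ℕ.+ j)) r (v j))))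
      (Σ<-*ˡ n r (λ j → f (n ℕ.+ j) * v j))))

  adjoin⊆span : ∀ {n r v x} → Adjoin (Span n v) r x → Span (n ℕ.+ n) (doubled n r v) x
  adjoin⊆span {n} {r} {v} (x₁ , x₂ , combination-of q₁ eq₁ , combination-of q₂ eq₂ , eq) =
    combination-of q (trans eq (sym (trans (Σ<-doubled n r v (fromℚ ∘ q)) (+-cong
      (trans (Σ<-cong< n (λ i i<n → *-congʳ (reflexive (≡.cong fromℚ (q-< i<n))))) (sym eq₁))
      (*-congˡ (trans (Σ<-cong n (λ j → *-congʳ (reflexive (≡.cong fromℚ (q-≥ j))))) (sym eq₂)))))))
    where
    q : ℕ → ℚ
    q i with i ℕ.<? n
    ... | yes _ = q₁ i
    ... | no  _ = q₂ (i ℕ.∸ n)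
    q-< : ∀ {i} → i ℕ.< n → q i ≡ q₁ i
    q-< {i} i<n with i ℕ.<? n
    ... | yes _  = ≡.refl
    ... | no i≮n = ⊥-elim (i≮n i<n)
    q-≥ : ∀ j → q (n ℕ.+ j) ≡ q₂ j
    q-≥ j with n ℕ.+ j ℕ.<? n
    ... | yes n+j<n = ⊥-elim (ℕ.m+n≮m n j n+j<n)
    ... | no  _     = ≡.cong q₂ (ℕ.m+n∸m≡n n j)

  -- Linear independence of the powers of t over ℤ[r].
  Independent₂ : ℕ → Carrier → Carrier → Set _
  Independent₂ n r t = ∀ (a b : ℕ → ℤ) → Σ< n (λ i → fromℤ (a i) * t ^ i) + r * Σ< n (λ i → fromℤ (b i) * t ^ i) ≈ 0# →
    ∀ i → i ℕ.< n → a i ≡ + 0 × b i ≡ + 0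

  independent-doubled : ∀ {n r t} → Independent₂ n r t → Independent (n ℕ.+ n) (doubled n r (t ^_))
  independent-doubled {n} {r} {t} ind a eq k k<2n = go (k ℕ.<? n)
    where
    zeros : ∀ i → i ℕ.< n → a i ≡ + 0 × a (n ℕ.+ i) ≡ + 0
    zeros = ind a (λ i → a (n ℕ.+ i)) (trans (sym (Σ<-doubled n r (t ^_) (λ i → fromℤ (a i)))) eq)
    go : Dec (k ℕ.< n) → a k ≡ + 0
    go (yes k<n) = proj₁ (zeros k k<n)
    go (no k≮n)  = ≡.subst (λ j → a j ≡ + 0) (ℕ.m+[n∸m]≡n (ℕ.≮⇒≥ k≮n)) (proj₂ (zeros (k ℕ.∸ n)
      (ℕ.+-cancelˡ-< n _ _ (≡.subst (ℕ._< n ℕ.+ n) (≡.sym (ℕ.m+[n∸m]≡n (ℕ.≮⇒≥ k≮n))) k<2n))))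

  independent₂-evalℤ : ∀ {n r t} → Independent₂ n r t → ∀ zs ws → length zs ℕ.≤ n → length ws ℕ.≤ n →
    evalℤ zs t + r * evalℤ ws t ≈ 0# → ∀ i → i ℕ.< n → coeff zs i ≡ + 0 × coeff ws i ≡ + 0
  independent₂-evalℤ {n} {r} {t} ind zs ws zs≤n ws≤n eq = ind (coeff zs) (coeff ws)
    (trans (sym (+-cong (evalℤ-Σ n zs t zs≤n) (*-congˡ (evalℤ-Σ n ws t ws≤n)))) eq)

  module _ (√3 : Carrier) (√3*√3≈3 : √3 * √3 ≈ fromℕ 3) where

    independent-√3 : Independent 2 (√3 ^_)
    independent-√3 = eisenstein (from-yes (prime? 3)) (+ 0 ∷ []) (from-no (+ 3 ∣? + 1))
      (trans (*-congˡ (*-identityʳ √3)) (trans √3*√3≈3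
        (solve 1 (λ s → con (+ 3) := con (+ 3) :* horner (+ 1 ∷ + 0 ∷ []) s) refl √3)))

    irrational : ∀ a b → fromℤ a + fromℤ b * √3 ≈ 0# → a ≡ + 0 × b ≡ + 0
    irrational a b eq = zeros 0 (s≤s z≤n) , zeros 1 (s≤s (s≤s z≤n))
      where
      zeros : ∀ i → i ℕ.< 2 → coeff (a ∷ b ∷ []) i ≡ + 0
      zeros = independent-evalℤ independent-√3 (a ∷ b ∷ []) ℕ.≤-refl
        (trans (+-congˡ (trans (*-congˡ (trans (+-congˡ (zeroʳ √3)) (+-identityʳ _))) (*-comm √3 _))) eq)

    -- 11 = (1 + 2√3)(2√3 - 1)
    eisenstein₂ : ∀ {z} zs {t} → ¬ (+ 11 ∣ + 9 ℤ.* z) → t ^ suc (length zs) ≈ fromℕ 11 * evalℤ (z ∷ zs) t →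
      Independent₂ (suc (length zs)) √3 t
    eisenstein₂ {z} zs {t} 11∤9z eq a b rel i i<n = irrational (a i) (b i)
      (Independence.independent (ℤ[√3]-place √3 √3*√3≈3 irrational) (length zs) t u
        (λ i → ℤ.- w i , + 2 ℤ.* w i , u≈ i)
        (ℤ.- z , + 2 ℤ.* z , u≈ 0 , 11∤9z ∘ ≡.subst (+ 11 ∣_) (residue≡ z))
        t^n
        ((λ i → a i , b i , refl) , trans
          (Σ<-cong n (λ i → expand (fromℤ (a i)) (fromℤ (b i)) √3 (t ^ i)))
          (trans (Σ<-+ n (λ i → fromℤ (a i) * t ^ i) (λ i → √3 * (fromℤ (b i) * t ^ i)))
            (trans (+-congˡ (Σ<-*ˡ n √3 (λ i → fromℤ (b i) * t ^ i))) rel)))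
        i i<n)
      where
      n : ℕ
      n = suc (length zs)
      w : ℕ → ℤ
      w = coeff (z ∷ zs)
      u : ℕ → Carrier
      u i = (fromℕ 2 * √3 - 1#) * fromℤ (w i)
      -- The cofactor 2√3 - 1 of the prime has residue -1 + 5 · 2 = 9.
      residue≡ : ∀ z → Residues.residue (ℤ.- z) (+ 2 ℤ.* z) ≡ + 9 ℤ.* z
      residue≡ = ℤS.solve 1 (λ z → ℤS.:- z ℤS.:+ ℤS.con (+ 5) ℤS.:* (ℤS.con (+ 2) ℤS.:* z) ℤS.:= ℤS.con (+ 9) ℤS.:* z) ≡.refl
        where module ℤS = ℤSolver.+-*-Solver
      u≈ : ∀ i → u i ≈ fromℤ (ℤ.- w i) + fromℤ (+ 2 ℤ.* w i) * √3
      u≈ i = trans (rearrange √3 1# (fromℤ (w i))) (sym (+-cong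
        (trans (fromℤ-neg (w i)) (-‿cong (sym (*-identityˡ _)))) (*-congʳ (fromℤ-* (+ 2) (w i)))))
        where
        rearrange : ∀ s o w → (fromℕ 2 * s - o) * w ≈ - (o * w) + fromℕ 2 * w * s
        rearrange = solve 3 (λ s o w → (con (+ 2) :* s :- o) :* w := :- (o :* w) :+ con (+ 2) :* w :* s) refl
      expand : ∀ a b s t → (a + b * s) * t ≈ a * t + s * (b * t)
      expand = solve 4 (λ a b s t → (a :+ b :* s) :* t := a :* t :+ s :* (b :* t)) refl
      t^n : t ^ n ≈ (1# + fromℕ 2 * √3) * Σ< n (λ i → u i * t ^ i)
      t^n = trans eq (sym (trans (*-congˡ (trans (Σ<-cong n (λ i → *-assoc (fromℕ 2 * √3 - 1#) (fromℤ (w i)) (t ^ i)))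
        (trans (Σ<-*ˡ n (fromℕ 2 * √3 - 1#) (λ i → fromℤ (w i) * t ^ i)) (*-congˡ (sym (evalℤ-Σ n (z ∷ zs) t ℕ.≤-refl))))))
        (trans (sym (*-assoc _ _ _)) (*-congʳ norm))))
        where
        norm : (1# + fromℕ 2 * √3) * (fromℕ 2 * √3 - 1#) ≈ fromℕ 11
        norm = trans (*-cong (+-congʳ (sym 1≈)) (+-congˡ (-‿cong (sym 1≈))))
          (trans (solve 1 (λ s → (con (+ 1) :+ con (+ 2) :* s) :* (con (+ 2) :* s :- con (+ 1)) := con (+ 4) :* (s :* s) :- con (+ 1)) refl √3)
            (trans (+-congʳ (*-congˡ √3*√3≈3)) (solve 0 (con (+ 4) :* con (+ 3) :- con (+ 1) := con (+ 11)) refl)))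

-- The three base angles.

module Cases {c ℓ₁ ℓ₂} {ℛ : RealNumbers c ℓ₁ ℓ₂} (𝒯 : Trigonometry ℛ) where
  open Realizations 𝒯 hiding (zero)
  open Arithmetic ℛ
  open Bounds ℛ
  open SpecialAngles 𝒯
  open LinearAlgebra ℛ
  open Polynomials ℛ
  open Geometry 𝒯
  open SetoidReasoning (CommutativeRing.setoid commutativeRing)

  -- A linear form in the coefficients m, q₁, ..., q₄ of a relation. Substituting polynomials in t
  -- for y, √3θ, y′ and √3θ′ turns the relation into a polynomial whose coefficients are such forms,
  -- one for each power of t.
  Form : Set
  Form = Vec ℤ 5

  module Forms (m q₁ q₂ q₃ q₄ : ℤ) where

    form : Form → ℤ
    form (c₀ ∷ c₁ ∷ c₂ ∷ c₃ ∷ c₄ ∷ []) = c₀ ℤ.* m ℤ.+ c₁ ℤ.* q₁ ℤ.+ c₂ ℤ.* q₂ ℤ.+ c₃ ℤ.* q₃ ℤ.+ c₄ ℤ.* q₄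

    evalForms : List Form → Carrier → Carrier
    evalForms [] t = 0#
    evalForms ((c₀ ∷ c₁ ∷ c₂ ∷ c₃ ∷ c₄ ∷ []) ∷ fs) t =
      fromℤ c₀ * fromℤ m + fromℤ c₁ * fromℤ q₁ + fromℤ c₂ * fromℤ q₂ + fromℤ c₃ * fromℤ q₃ + fromℤ c₄ * fromℤ q₄ + t * evalForms fs t

    hornerForms : ∀ {n} → List Form → (m q₁ q₂ q₃ q₄ t : Solver.Polynomial n) → Solver.Polynomial n
    hornerForms [] m q₁ q₂ q₃ q₄ t = con (+ 0)
    hornerForms ((c₀ ∷ c₁ ∷ c₂ ∷ c₃ ∷ c₄ ∷ []) ∷ fs) m q₁ q₂ q₃ q₄ t =
      con c₀ :* m :+ con c₁ :* q₁ :+ con c₂ :* q₂ :+ con c₃ :* q₃ :+ con c₄ :* q₄ :+ t :* hornerForms fs m q₁ q₂ q₃ q₄ t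

    evalℤ-forms : ∀ fs t → evalℤ (map form fs) t ≈ evalForms fs t
    evalℤ-forms [] t = refl
    evalℤ-forms ((c₀ ∷ c₁ ∷ c₂ ∷ c₃ ∷ c₄ ∷ []) ∷ fs) t = +-cong
      (plus (c₀ ℤ.* m ℤ.+ c₁ ℤ.* q₁ ℤ.+ c₂ ℤ.* q₂ ℤ.+ c₃ ℤ.* q₃) c₄ q₄
        (plus (c₀ ℤ.* m ℤ.+ c₁ ℤ.* q₁ ℤ.+ c₂ ℤ.* q₂) c₃ q₃
          (plus (c₀ ℤ.* m ℤ.+ c₁ ℤ.* q₁) c₂ q₂ (plus (c₀ ℤ.* m) c₁ q₁ (fromℤ-* c₀ m)))))
      (*-congˡ (evalℤ-forms fs t))
      where
      plus : ∀ i j k {x} → fromℤ i ≈ x → fromℤ (i ℤ.+ j ℤ.* k) ≈ x + fromℤ j * fromℤ k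
      plus i j k eq = trans (fromℤ-+ i (j ℤ.* k)) (+-cong eq (fromℤ-* j k))

  private
    module ℤS = ℤSolver.+-*-Solver

    formP : ∀ {n} → (m q₁ q₂ q₃ q₄ : ℤS.Polynomial n) → Form → ℤS.Polynomial n
    formP m q₁ q₂ q₃ q₄ (c₀ ∷ c₁ ∷ c₂ ∷ c₃ ∷ c₄ ∷ []) =
      ℤS.con c₀ ℤS.:* m ℤS.:+ ℤS.con c₁ ℤS.:* q₁ ℤS.:+ ℤS.con c₂ ℤS.:* q₂ ℤS.:+ ℤS.con c₃ ℤS.:* q₃ ℤS.:+ ℤS.con c₄ ℤS.:* q₄

    p : Carrier → Vec (Fin 3) 3 → Vector Carrier 2
    p = minkowski R

    -- The subalgebra, spanned by n elements, bounds the degree from above; membership and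
    -- independence of these elements bound it from below.
    coordinate-basis : ∀ α {a n v} {A : Pred Carrier a} → IsSubalgebra A → (∀ {x} → A x → Span n v x) →
      A √3 → A (Y α) → A (Θ α) → (∀ i → i ℕ.< n → v i ∈ coordinateField (p α)) → Independent n v →
      [ coordinateField (p α) :ℚ]≡ n
    coordinate-basis α sub A⊆Span √3∈ Y∈ Θ∈ v∈K ind = basis v∈K ind λ x∈K →
      A⊆Span (field⊆subalgebra sub A⊆Span (λ a → a) (K⊆ α (gen √3∈) (gen Y∈) (gen Θ∈) x∈K))

    evalℤ∈ : ∀ {s} {S : Pred Carrier s} zs {t} → t ∈ ℚ⟨ S ⟩ → evalℤ zs t ∈ ℚ⟨ S ⟩
    evalℤ∈ []       t∈ = zer
    evalℤ∈ (z ∷ zs) t∈ = add (fromℤ∈ z) (mul t∈ (evalℤ∈ zs t∈))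

    poly-root : ∀ zs {y} → evalℤ zs y ≈ 0# → eval (poly zs) y ≈ 0#
    poly-root zs {y} eq = trans (eval-poly zs y) eq

  -- α = 45°, where 𝐊 = ℚ(t) for t = 2 cos 15°

  module Ruler-and-compass where

    private
      α : Carrier
      α = 45 °

      √2-poly √3-poly √6-poly t⁴-poly : List ℤ
      √2-poly = + 0 ∷ -[1+ 2 ] ∷ + 0 ∷ + 1 ∷ []
      √3-poly = -[1+ 1 ] ∷ + 0 ∷ + 1 ∷ []
      √6-poly = + 0 ∷ + 5 ∷ + 0 ∷ -[1+ 0 ] ∷ []
      t⁴-poly = -[1+ 0 ] ∷ + 0 ∷ + 4 ∷ []

    abstract
      -- 2 cos 15° in radicals. As t² = 2 + √3, the cubic t³ - 3t = t(√3 - 1) returns √2, so t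
      -- generates both square roots.
      t : Carrier
      t = 1/suc 1 * (√2 * √3 + √2)

      2t : fromℕ 2 * t ≈ √2 * √3 + √2
      2t = trans (sym (*-assoc _ _ _)) (trans (*-congʳ (fromℕ-*-1/suc 1)) (*-identityˡ _))

    t²≈2+√3 : t * t ≈ fromℕ 2 + √3
    t²≈2+√3 = #0-cancel (fromℕ-suc#0 3) (begin
      fromℕ 4 * (t * t)                       ≈⟨ solve 1 (λ t → con (+ 4) :* (t :* t) := con (+ 2) :* t :* (con (+ 2) :* t)) refl t ⟩
      fromℕ 2 * t * (fromℕ 2 * t)             ≈⟨ *-cong 2t 2t ⟩
      (√2 * √3 + √2) * (√2 * √3 + √2)         ≈⟨ solve 2 (λ a b → (a :* b :+ a) :* (a :* b :+ a) := a :* a :* (b :* b :+ con (+ 2) :* b :+ con (+ 1))) refl √2 √3 ⟩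
      √2 * √2 * (√3 * √3 + fromℕ 2 * √3 + fromℕ 1)   ≈⟨ *-cong √2*√2≈2 (+-congʳ (+-congʳ √3*√3≈3)) ⟩
      fromℕ 2 * (fromℕ 3 + fromℕ 2 * √3 + fromℕ 1)   ≈⟨ solve 1 (λ b → con (+ 2) :* (con (+ 3) :+ con (+ 2) :* b :+ con (+ 1)) := con (+ 4) :* (con (+ 2) :+ b)) refl √3 ⟩
      fromℕ 4 * (fromℕ 2 + √3)                ∎)

    √3≈ : √3 ≈ evalℤ √3-poly t
    √3≈ = modulo {k = - fromℕ 1} (x≈y⇒x-y≈0 t²≈2+√3)
      (solve 2 (λ t s → s := horner √3-poly t :+ :- con (+ 1) :* (t :* t :- (con (+ 2) :+ s))) refl t √3)

    √2≈ : √2 ≈ evalℤ √2-poly t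
    √2≈ = #0-cancel (fromℕ-suc#0 1) (sym (begin
      fromℕ 2 * evalℤ √2-poly t
        ≈⟨ solve 1 (λ t → con (+ 2) :* horner √2-poly t := con (+ 2) :* t :* (t :* t :- con (+ 3))) refl t ⟩
      fromℕ 2 * t * (t * t - fromℕ 3)                 ≈⟨ *-cong 2t (+-congʳ t²≈2+√3) ⟩
      (√2 * √3 + √2) * (fromℕ 2 + √3 - fromℕ 3)
        ≈⟨ solve 2 (λ a b → (a :* b :+ a) :* (con (+ 2) :+ b :- con (+ 3)) := a :* (b :* b :- con (+ 1))) refl √2 √3 ⟩
      √2 * (√3 * √3 - fromℕ 1)                        ≈⟨ *-congˡ (+-congʳ √3*√3≈3) ⟩
      √2 * (fromℕ 3 - fromℕ 1)                        ≈⟨ solve 1 (λ a → a :* (con (+ 3) :- con (+ 1)) := con (+ 2) :* a) refl √2 ⟩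
      fromℕ 2 * √2                                    ∎))

    √6≈ : √3 * √2 ≈ evalℤ √6-poly t
    √6≈ = begin
      √3 * √2                     ≈⟨ solve 2 (λ a b → b :* a := a :* b :+ a :- a) refl √2 √3 ⟩
      √2 * √3 + √2 - √2           ≈⟨ +-cong (sym 2t) (-‿cong √2≈) ⟩
      fromℕ 2 * t - evalℤ √2-poly t
        ≈⟨ solve 1 (λ t → con (+ 2) :* t :- horner √2-poly t := horner √6-poly t) refl t ⟩
      evalℤ √6-poly t ∎

    quartic : t ^ 4 - fromℕ 4 * (t * t) + fromℕ 1 ≈ 0#
    quartic = trans (solve 1 (λ t → t :^ 4 :- con (+ 4) :* (t :* t) :+ con (+ 1) := (t :* t :- con (+ 2)) :* (t :* t :- con (+ 2)) :- con (+ 3)) refl t)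
      (x≈y⇒x-y≈0 (trans (*-cong shifted shifted) √3*√3≈3))
      where
      shifted : t * t - fromℕ 2 ≈ √3
      shifted = trans (+-congʳ t²≈2+√3) (solve 1 (λ s → con (+ 2) :+ s :- con (+ 2) := s) refl √3)

    -- With t = x + 1 the quartic becomes x⁴ = 2(1 + 2x - x² - 2x³).
    independent-t : Independent 4 (t ^_)
    independent-t = independent-shift (+ 1) (solve 1 (λ t → t := t :- con (+ 1) :+ con (+ 1)) refl t)
      (eisenstein (from-yes (prime? 2)) (+ 2 ∷ -[1+ 0 ] ∷ -[1+ 1 ] ∷ []) {t - fromℕ 1} (from-no (+ 2 ∣? + 1))
        (modulo {k = fromℕ 1} quartic
          (solve 1 (λ t → (t :- con (+ 1)) :^ 4 := con (+ 2) :* horner (+ 1 ∷ + 2 ∷ -[1+ 0 ] ∷ -[1+ 1 ] ∷ []) (t :- con (+ 1))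
            :+ con (+ 1) :* (t :^ 4 :- con (+ 4) :* (t :* t) :+ con (+ 1))) refl t)))

    module A = Powers {4} {t} (span-resp (sym (modulo {k = fromℕ 1} quartic
        (solve 1 (λ t → t :^ 4 := horner t⁴-poly t :+ con (+ 1) :* (t :^ 4 :- con (+ 4) :* (t :* t) :+ con (+ 1))) refl t)))
      (span-evalℤ t⁴-poly (s≤s (s≤s (s≤s z≤n))))) (s≤s z≤n)

    -- Here √3θ = √6, y′ = 0 and √3θ′ = 2√3 = 2t² - 4. The constant coefficient is m - 4q₄ and that
    -- of t² is 2q₄, whence m = f₀ + 2f₂.
    separated : Separated α
    separated m q₁ q₂ q₃ q₄ eq = ≡.trans (combine m q₁ q₂ q₃ q₄)
      (≡.cong₂ (λ i j → i ℤ.+ + 2 ℤ.* j) (zeros 0 (s≤s z≤n)) (zeros 2 (s≤s (s≤s (s≤s z≤n)))))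
      where
      open Forms m q₁ q₂ q₃ q₄
      f₀ f₁ f₂ f₃ : Form
      f₀ = + 1 ∷ + 0 ∷ + 0 ∷ + 0 ∷ -[1+ 3 ] ∷ []
      f₁ = + 0 ∷ -[1+ 2 ] ∷ + 5 ∷ + 0 ∷ + 0 ∷ []
      f₂ = + 0 ∷ + 0 ∷ + 0 ∷ + 0 ∷ + 2 ∷ []
      f₃ = + 0 ∷ + 1 ∷ -[1+ 0 ] ∷ + 0 ∷ + 0 ∷ []
      fs : List Form
      fs = f₀ ∷ f₁ ∷ f₂ ∷ f₃ ∷ []
      combine : ∀ m q₁ q₂ q₃ q₄ → m ≡ Forms.form m q₁ q₂ q₃ q₄ f₀ ℤ.+ + 2 ℤ.* Forms.form m q₁ q₂ q₃ q₄ f₂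
      combine = ℤS.solve 5 (λ m q₁ q₂ q₃ q₄ → m ℤS.:= formP m q₁ q₂ q₃ q₄ f₀ ℤS.:+ ℤS.con (+ 2) ℤS.:* formP m q₁ q₂ q₃ q₄ f₂) ≡.refl
      Y90 : Y (α + α) ≈ 0#
      Y90 = trans (Y-double α) (trans (+-congʳ √2*√2≈2) (-‿inverseʳ _))
      Θ90 : Θ (α + α) ≈ fromℕ 2
      Θ90 = trans (Θ-double α) (trans (*-congˡ Θ45≈√2) √2*√2≈2)
      relation : evalForms fs t ≈ 0#
      relation = trans (sym (trans
        (+-cong (+-cong (+-cong (+-congˡ (*-congˡ √2≈)) (*-congˡ (trans (*-congˡ Θ45≈√2) √6≈))) (*-congˡ Y90)) (*-congˡ (*-cong √3≈ Θ90)))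
        (solve 6 (λ m q₁ q₂ q₃ q₄ t →
          m :+ q₁ :* horner √2-poly t :+ q₂ :* horner √6-poly t
            :+ q₃ :* con (+ 0) :+ q₄ :* (horner √3-poly t :* con (+ 2))
          := hornerForms fs m q₁ q₂ q₃ q₄ t) refl (fromℤ m) (fromℤ q₁) (fromℤ q₂) (fromℤ q₃) (fromℤ q₄) t))) eq
      zeros : ∀ i → i ℕ.< 4 → coeff (map form fs) i ≡ + 0
      zeros = independent-evalℤ independent-t (map form fs) ℕ.≤-refl (trans (evalℤ-forms fs t) relation)

    minimalPolynomial : IsMinimalPolynomial (poly (-[1+ 1 ] ∷ + 0 ∷ + 1 ∷ [])) (baseElement α)
    minimalPolynomial = minimal ≡.refl ≡.refl
      (poly-root (-[1+ 1 ] ∷ + 0 ∷ + 1 ∷ []) (trans (solve 1 (λ y → horner (-[1+ 1 ] ∷ + 0 ∷ + 1 ∷ []) y := y :* y :- con (+ 2)) refl √2) (x≈y⇒x-y≈0 √2*√2≈2)))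
      (eisenstein (from-yes (prime? 2)) (+ 0 ∷ []) (from-no (+ 2 ∣? + 1))
        (modulo {k = fromℕ 1} (x≈y⇒x-y≈0 √2*√2≈2) (solve 1 (λ y → y :^ 2 := con (+ 2) :* horner (+ 1 ∷ + 0 ∷ []) y :+ con (+ 1) :* (y :* y :- con (+ 2))) refl √2)))

    coordinateField≐ : coordinateField (p α) ≐ ℚ⟨√2,√3⟩
    coordinateField≐ =
        K⊆ α (gen (inj₂ (0<⇒0≤ 0<√3 , √3*√3≈3))) √2∈ (resp (sym Θ45≈√2) √2∈)
      , field-⊆ λ
        { (inj₁ (0≤x , x²)) → resp (sym (sqrt-unique 0≤x 0<√2 x² √2*√2≈2)) (Y∈K α)
        ; (inj₂ (0≤x , x²)) → resp (sym (sqrt-unique 0≤x 0<√3 x² √3*√3≈3)) (√3∈K α)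
        }
      where
      √2∈ : √2 ∈ ℚ⟨√2,√3⟩
      √2∈ = gen (inj₁ (0<⇒0≤ 0<√2 , √2*√2≈2))

    degree : [ coordinateField (p α) :ℚ]≡ 4
    degree = coordinate-basis α A.isSubalgebra (λ a → a)
      (span-resp (sym √3≈) (span-evalℤ √3-poly (s≤s (s≤s (s≤s z≤n)))))
      √2∈ (span-resp (sym Θ45≈√2) √2∈) (λ i _ → ^∈ i t∈K) independent-t
      where
      √2∈ : Span 4 (t ^_) √2
      √2∈ = span-resp (sym √2≈) (span-evalℤ √2-poly ℕ.≤-refl)
      t∈K : t ∈ coordinateField (p α)
      t∈K = divide∈ 1 (resp (sym 2t) (add (mul (Y∈K α) (√3∈K α)) (Y∈K α)))

  -- α = 20°, where 𝐊 = ℚ(θ) for θ = 2 sin 20°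

  module Origami where

    private
      α : Carrier
      α = 20 °

      y θ : Carrier
      y = Y α
      θ = Θ α

      √3-poly y-poly θ⁶-poly : List ℤ
      √3-poly = + 0 ∷ + 3 ∷ + 0 ∷ -[1+ 0 ] ∷ []
      y-poly  = + 4 ∷ + 0 ∷ -[1+ 4 ] ∷ + 0 ∷ + 1 ∷ []
      θ⁶-poly = + 3 ∷ + 0 ∷ -[1+ 8 ] ∷ + 0 ∷ + 6 ∷ []

    √3≈ : √3 ≈ evalℤ √3-poly θ
    √3≈ = trans (sym Θ20-cubic) (solve 1 (λ t → con (+ 3) :* t :- t :* t :* t := horner √3-poly t) refl θ)

    -- The square of 3θ - θ³ = √3.
    sextic : θ ^ 6 ≈ evalℤ θ⁶-poly θ
    sextic = modulo {k = fromℕ 1} (x≈y⇒x-y≈0 (trans (*-cong Θ20-cubic Θ20-cubic) √3*√3≈3))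
      (solve 1 (λ t → t :^ 6 := horner θ⁶-poly t
        :+ con (+ 1) :* ((con (+ 3) :* t :- t :* t :* t) :* (con (+ 3) :* t :- t :* t :* t) :- con (+ 3))) refl θ)

    independent-θ : Independent 6 (θ ^_)
    independent-θ = eisenstein (from-yes (prime? 3)) (+ 0 ∷ -[1+ 2 ] ∷ + 0 ∷ + 2 ∷ + 0 ∷ []) (from-no (+ 3 ∣? + 1))
      (trans sextic (solve 1 (λ t → horner θ⁶-poly t
        := con (+ 3) :* horner (+ 1 ∷ + 0 ∷ -[1+ 2 ] ∷ + 0 ∷ + 2 ∷ + 0 ∷ []) t) refl θ))

    -- The relation √3θ = 2(y² - 2) - y becomes linear in y once y² = 4 - θ² and √3 = 3θ - θ³ are
    -- inserted. Hence cos 20° lies in ℚ(sin 20°) and the degree does not exceed 6.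
    y≈ : y ≈ evalℤ y-poly θ
    y≈ = begin
      y                                                ≈⟨ solve 2 (λ y s → y := con (+ 2) :* (y :* y :- con (+ 2)) :- (con (+ 2) :* (y :* y :- con (+ 2)) :- y)) refl y √3 ⟩
      fromℕ 2 * (y * y - fromℕ 2) - (fromℕ 2 * (y * y - fromℕ 2) - y)   ≈⟨ +-congˡ (-‿cong √3Θ20) ⟨
      fromℕ 2 * (y * y - fromℕ 2) - √3 * θ             ≈⟨ +-congˡ (-‿cong (*-congʳ √3≈)) ⟩
      fromℕ 2 * (y * y - fromℕ 2) - evalℤ √3-poly θ * θ
        ≈⟨ modulo {k = fromℕ 2} (x≈y⇒x-y≈0 (Y²+Θ² α))
             (solve 2 (λ y t → con (+ 2) :* (y :* y :- con (+ 2)) :- horner √3-poly t :* t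
               := horner y-poly t :+ con (+ 2) :* (y :* y :+ t :* t :- con (+ 4))) refl y θ) ⟩
      evalℤ y-poly θ ∎

    cubic : y * y * y - fromℕ 3 * y - fromℕ 1 ≈ 0#
    cubic = x≈y⇒x-y≈0 (trans Y20-cubic (sym 1≈))

    -- With y = x + 1 the cubic becomes x³ = 3(1 - x²).
    independent-y : Independent 3 (y ^_)
    independent-y = independent-shift (+ 1) (solve 1 (λ y → y := y :- con (+ 1) :+ con (+ 1)) refl y)
      (eisenstein (from-yes (prime? 3)) (+ 0 ∷ -[1+ 0 ] ∷ []) {y - fromℕ 1} (from-no (+ 3 ∣? + 1))
        (modulo {k = fromℕ 1} cubic
          (solve 1 (λ y → (y :- con (+ 1)) :^ 3 := con (+ 3) :* horner (+ 1 ∷ + 0 ∷ -[1+ 0 ] ∷ []) (y :- con (+ 1))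
            :+ con (+ 1) :* (y :* y :* y :- con (+ 3) :* y :- con (+ 1))) refl y)))

    -- Everything lies in ℚ(y): √3θ = 2y² - y - 4, y′ = y² - 2 and √3θ′ = 2 + 2y - y². In each of
    -- these, as in y, the constant term is -2 times the coefficient of y² (the trace is 0), so f₀ +
    -- 2f₂ isolates m.
    separated : Separated α
    separated m q₁ q₂ q₃ q₄ eq = ≡.trans (combine m q₁ q₂ q₃ q₄)
      (≡.cong₂ (λ i j → i ℤ.+ + 2 ℤ.* j) (zeros 0 (s≤s z≤n)) (zeros 2 ℕ.≤-refl))
      where
      open Forms m q₁ q₂ q₃ q₄
      f₀ f₁ f₂ : Form
      f₀ = + 1 ∷ + 0 ∷ -[1+ 3 ] ∷ -[1+ 1 ] ∷ + 2 ∷ []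
      f₁ = + 0 ∷ + 1 ∷ -[1+ 0 ] ∷ + 0 ∷ + 2 ∷ []
      f₂ = + 0 ∷ + 0 ∷ + 2 ∷ + 1 ∷ -[1+ 0 ] ∷ []
      fs : List Form
      fs = f₀ ∷ f₁ ∷ f₂ ∷ []
      combine : ∀ m q₁ q₂ q₃ q₄ → m ≡ Forms.form m q₁ q₂ q₃ q₄ f₀ ℤ.+ + 2 ℤ.* Forms.form m q₁ q₂ q₃ q₄ f₂
      combine = ℤS.solve 5 (λ m q₁ q₂ q₃ q₄ → m ℤS.:= formP m q₁ q₂ q₃ q₄ f₀ ℤS.:+ ℤS.con (+ 2) ℤS.:* formP m q₁ q₂ q₃ q₄ f₂) ≡.refl
      √3Θ40 : √3 * Θ (α + α) ≈ fromℕ 2 + fromℕ 2 * y - y * y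
      √3Θ40 = begin
        √3 * Θ (α + α)     ≈⟨ *-congˡ (Θ-double α) ⟩
        √3 * (y * θ)       ≈⟨ solve 3 (λ s y t → s :* (y :* t) := y :* (s :* t)) refl √3 y θ ⟩
        y * (√3 * θ)       ≈⟨ *-congˡ √3Θ20 ⟩
        y * (fromℕ 2 * (y * y - fromℕ 2) - y)
          ≈⟨ modulo {k = fromℕ 2} cubic (solve 1 (λ y → y :* (con (+ 2) :* (y :* y :- con (+ 2)) :- y)
               := con (+ 2) :+ con (+ 2) :* y :- y :* y :+ con (+ 2) :* (y :* y :* y :- con (+ 3) :* y :- con (+ 1))) refl y) ⟩
        fromℕ 2 + fromℕ 2 * y - y * y ∎
      relation : evalForms fs y ≈ 0#
      relation = trans (sym (trans
        (+-cong (+-cong (+-congˡ (*-congˡ √3Θ20)) (*-congˡ (Y-double α))) (*-congˡ √3Θ40))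
        (solve 6 (λ m q₁ q₂ q₃ q₄ y →
          m :+ q₁ :* y :+ q₂ :* (con (+ 2) :* (y :* y :- con (+ 2)) :- y) :+ q₃ :* (y :* y :- con (+ 2))
            :+ q₄ :* (con (+ 2) :+ con (+ 2) :* y :- y :* y)
          := hornerForms fs m q₁ q₂ q₃ q₄ y) refl (fromℤ m) (fromℤ q₁) (fromℤ q₂) (fromℤ q₃) (fromℤ q₄) y))) eq
      zeros : ∀ i → i ℕ.< 3 → coeff (map form fs) i ≡ + 0
      zeros = independent-evalℤ independent-y (map form fs) ℕ.≤-refl (trans (evalℤ-forms fs y) relation)

    minimalPolynomial : IsMinimalPolynomial (poly (-[1+ 0 ] ∷ -[1+ 2 ] ∷ + 0 ∷ + 1 ∷ [])) (baseElement α)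
    minimalPolynomial = minimal ≡.refl ≡.refl
      (poly-root (-[1+ 0 ] ∷ -[1+ 2 ] ∷ + 0 ∷ + 1 ∷ []) (trans
        (solve 1 (λ y → horner (-[1+ 0 ] ∷ -[1+ 2 ] ∷ + 0 ∷ + 1 ∷ []) y := y :* y :* y :- con (+ 3) :* y :- con (+ 1)) refl y) cubic))
      independent-y

    coordinateField≐ : coordinateField (p α) ≐ ℚ⟨ sin α ⟩₁
    coordinateField≐ =
        K⊆ α (resp (sym √3≈) (evalℤ∈ √3-poly θ∈))
             (resp (sym y≈) (evalℤ∈ y-poly θ∈)) θ∈
      , field-⊆ λ x≈ → resp (sym x≈) (divide∈ 1 (Θ∈K α))
      where
      θ∈ : θ ∈ ℚ⟨ sin α ⟩₁
      θ∈ = mul (fromℕ∈ 2) (gen refl)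

    module A = Powers {6} {θ} (span-resp (sym sextic)
      (span-evalℤ θ⁶-poly (ℕ.n≤1+n 5))) (s≤s z≤n)

    degree : [ coordinateField (p α) :ℚ]≡ 6
    degree = coordinate-basis α A.isSubalgebra (λ a → a)
      (span-resp (sym √3≈) (A-evalℤ A.isSubalgebra √3-poly A.t∈))
      (span-resp (sym y≈) (A-evalℤ A.isSubalgebra y-poly A.t∈))
      A.t∈ (λ i _ → ^∈ i (Θ∈K α)) independent-θ

  -- α = 2π/11, where 𝐊 = ℚ(√3, θ) for θ = 2 sin (2π/11)

  module Hendecagon where

    private
      α : Carrier
      α = α₁₁

      y θ : Carrier
      y = Y α
      θ = Θ α

      f : List ℤ
      f = + 1 ∷ + 3 ∷ -[1+ 2 ] ∷ -[1+ 3 ] ∷ + 1 ∷ + 1 ∷ []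

    quintic : evalℤ f y ≈ 0#
    quintic = trans (solve 1 (λ y → horner f y := y :* y :* y :* y :* y :+ y :* y :* y :* y :- con (+ 4) :* (y :* y :* y) :- con (+ 3) :* (y :* y) :+ con (+ 3) :* y :+ con (+ 1)) refl y) Y₁₁-quintic

    -- f(2) = 11, and with y = x + 2 the quintic becomes x⁵ = -11(1 + 5x + 7x² + 4x³ + x⁴).
    independent-y : Independent 5 (y ^_)
    independent-y = independent-shift (+ 2) (solve 1 (λ y → y := y :- con (+ 2) :+ con (+ 2)) refl y)
      (eisenstein (from-yes (prime? 11)) (-[1+ 4 ] ∷ -[1+ 6 ] ∷ -[1+ 3 ] ∷ -[1+ 0 ] ∷ []) {y - fromℕ 2} (from-no (+ 11 ∣? -[1+ 0 ]))
        (modulo {k = fromℕ 1} quintic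
          (solve 1 (λ y → (y :- con (+ 2)) :^ 5
            := con (+ 11) :* horner (-[1+ 0 ] ∷ -[1+ 4 ] ∷ -[1+ 6 ] ∷ -[1+ 3 ] ∷ -[1+ 0 ] ∷ []) (y :- con (+ 2)) :+ con (+ 1) :* horner f y) refl y)))

    private
      θ¹⁰-poly : List ℤ
      θ¹⁰-poly = + 11 ∷ + 0 ∷ -[1+ 54 ] ∷ + 0 ∷ + 77 ∷ + 0 ∷ -[1+ 43 ] ∷ + 0 ∷ + 11 ∷ []

      -- Put s = θ² = 2 - Y(2α). `norm` is the decic in terms of s. As 10α = 2π - α, y = Y(10α) is
      -- the quintuple angle polynomial at 2 - s, and its reduction by f(2 - s) = 0 is `y-poly₂`.
      -- With s = 4 - y², `cofactor` is the quotient of y-poly₂(s) - y by f(y).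
      norm y-poly₂ cofactor : List ℤ
      norm     = -[1+ 10 ] ∷ + 55 ∷ -[1+ 76 ] ∷ + 44 ∷ -[1+ 10 ] ∷ + 1 ∷ []
      y-poly₂  = -[1+ 8 ] ∷ + 30 ∷ -[1+ 26 ] ∷ + 9 ∷ -[1+ 0 ] ∷ []
      cofactor = -[1+ 0 ] ∷ + 2 ∷ + 1 ∷ -[1+ 0 ] ∷ []

      y-poly : List ℤ
      y-poly = -[1+ 8 ] ∷ + 0 ∷ + 30 ∷ + 0 ∷ -[1+ 26 ] ∷ + 0 ∷ + 9 ∷ + 0 ∷ -[1+ 0 ] ∷ []

      θ²≈ : θ * θ ≈ fromℕ 4 - y * y
      θ²≈ = trans (solve 2 (λ y t → t :* t := y :* y :+ t :* t :- y :* y) refl y θ) (+-congʳ (Y²+Θ² α))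

      evalℤ-cong : ∀ zs {x x′} → x ≈ x′ → evalℤ zs x ≈ evalℤ zs x′
      evalℤ-cong []       eq = refl
      evalℤ-cong (z ∷ zs) eq = +-congˡ (*-cong eq (evalℤ-cong zs eq))

    -- The minimal polynomial of y, composed with y² - 2 = 2 - θ², is -f(y)f(-y).
    decic : θ ^ 10 ≈ evalℤ θ¹⁰-poly θ
    decic = x-y≈0⇒x≈y (begin
      θ ^ 10 - evalℤ θ¹⁰-poly θ
        ≈⟨ solve 1 (λ t → t :^ 10 :- horner θ¹⁰-poly t := horner norm (t :* t)) refl θ ⟩
      evalℤ norm (θ * θ)
        ≈⟨ evalℤ-cong norm θ²≈ ⟩
      evalℤ norm (fromℕ 4 - y * y)
        ≈⟨ solve 1 (λ y → horner norm (con (+ 4) :- y :* y) := horner f (:- y) :* horner f y) refl y ⟩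
      evalℤ f (- y) * evalℤ f y     ≈⟨ *-congˡ quintic ⟩
      evalℤ f (- y) * 0#             ≈⟨ zeroʳ _ ⟩
      0#                              ∎)

    y≈ : y ≈ evalℤ y-poly θ
    y≈ = sym (x-y≈0⇒x≈y (begin
      evalℤ y-poly θ - y
        ≈⟨ solve 2 (λ t y → horner y-poly t :- y := horner y-poly₂ (t :* t) :- y) refl θ y ⟩
      evalℤ y-poly₂ (θ * θ) - y
        ≈⟨ +-congʳ (evalℤ-cong y-poly₂ θ²≈) ⟩
      evalℤ y-poly₂ (fromℕ 4 - y * y) - y
        ≈⟨ solve 1 (λ y → horner y-poly₂ (con (+ 4) :- y :* y) :- y
             := horner cofactor y :* horner f y) refl y ⟩
      evalℤ cofactor y * evalℤ f y   ≈⟨ *-congˡ quintic ⟩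
      evalℤ cofactor y * 0#           ≈⟨ zeroʳ _ ⟩
      0#                                                            ∎))

    independent₂ : Independent₂ 10 √3 θ
    independent₂ = eisenstein₂ √3 √3*√3≈3 {+ 1}
      (+ 0 ∷ -[1+ 4 ] ∷ + 0 ∷ + 7 ∷ + 0 ∷ -[1+ 3 ] ∷ + 0 ∷ + 1 ∷ + 0 ∷ []) (from-no (+ 11 ∣? + 9))
      (trans decic (solve 1 (λ t → horner θ¹⁰-poly t
        := con (+ 11) :* horner (+ 1 ∷ + 0 ∷ -[1+ 4 ] ∷ + 0 ∷ + 7 ∷ + 0 ∷ -[1+ 3 ] ∷ + 0 ∷ + 1 ∷ + 0 ∷ []) t) refl θ))

    -- 1, y and y′ are even polynomials in θ, collected in `fs`; √3θ and √3θ′ are √3 times odd ones,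
    -- collected in `gs`. The even part alone determines m.
    separated : Separated α
    separated m q₁ q₂ q₃ q₄ eq = ≡.trans (combine m q₁ q₂ q₃ q₄)
      (≡.cong₂ ℤ._+_ (≡.cong₂ (λ i j → i ℤ.+ + 2 ℤ.* j) (zeros 0 (s≤s z≤n)) (zeros 2 (s≤s (s≤s (s≤s z≤n)))))
        (≡.cong (λ i → + 51 ℤ.* i) (zeros 8 (ℕ.n≤1+n 9))))
      where
      open Forms m q₁ q₂ q₃ q₄
      o f₀ f₂ f₈ : Form
      o  = + 0 ∷ + 0 ∷ + 0 ∷ + 0 ∷ + 0 ∷ []
      f₀ = + 1 ∷ -[1+ 8 ] ∷ + 0 ∷ + 2 ∷ + 0 ∷ []
      f₂ = + 0 ∷ + 30 ∷ + 0 ∷ -[1+ 0 ] ∷ + 0 ∷ []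
      f₈ = + 0 ∷ -[1+ 0 ] ∷ + 0 ∷ + 0 ∷ + 0 ∷ []
      fs gs : List Form
      fs = f₀ ∷ o ∷ f₂ ∷ o ∷ (+ 0 ∷ -[1+ 26 ] ∷ + 0 ∷ + 0 ∷ + 0 ∷ []) ∷ o ∷ (+ 0 ∷ + 9 ∷ + 0 ∷ + 0 ∷ + 0 ∷ []) ∷ o ∷ f₈ ∷ []
      gs = o ∷ (+ 0 ∷ + 0 ∷ + 1 ∷ + 0 ∷ -[1+ 8 ] ∷ []) ∷ o ∷ (+ 0 ∷ + 0 ∷ + 0 ∷ + 0 ∷ + 30 ∷ [])
        ∷ o ∷ (+ 0 ∷ + 0 ∷ + 0 ∷ + 0 ∷ -[1+ 26 ] ∷ []) ∷ o ∷ (+ 0 ∷ + 0 ∷ + 0 ∷ + 0 ∷ + 9 ∷ [])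
        ∷ o ∷ (+ 0 ∷ + 0 ∷ + 0 ∷ + 0 ∷ -[1+ 0 ] ∷ []) ∷ []
      -- f₀ + 2f₂ removes q₃ and leaves 2 · 30 - 9 = 51 times q₁, which f₈ = -q₁ cancels.
      combine : ∀ m q₁ q₂ q₃ q₄ → m ≡ Forms.form m q₁ q₂ q₃ q₄ f₀ ℤ.+ + 2 ℤ.* Forms.form m q₁ q₂ q₃ q₄ f₂ ℤ.+ + 51 ℤ.* Forms.form m q₁ q₂ q₃ q₄ f₈
      combine = ℤS.solve 5 (λ m q₁ q₂ q₃ q₄ → m ℤS.:= formP m q₁ q₂ q₃ q₄ f₀ ℤS.:+ ℤS.con (+ 2) ℤS.:* formP m q₁ q₂ q₃ q₄ f₂
        ℤS.:+ ℤS.con (+ 51) ℤS.:* formP m q₁ q₂ q₃ q₄ f₈) ≡.refl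
      Y2α : Y (α + α) ≈ fromℕ 2 - θ * θ
      Y2α = trans (Y-double α) (modulo {k = fromℕ 1} (x≈y⇒x-y≈0 (Y²+Θ² α))
        (solve 2 (λ y t → y :* y :- con (+ 2) := con (+ 2) :- t :* t :+ con (+ 1) :* (y :* y :+ t :* t :- con (+ 4))) refl y θ))
      relation : evalForms fs θ + √3 * evalForms gs θ ≈ 0#
      relation = trans (sym (trans
        (+-cong (+-cong (+-congʳ (+-congˡ (*-congˡ y≈))) (*-congˡ Y2α)) (*-congˡ (*-congˡ (trans (Θ-double α) (*-congʳ y≈)))))
        (solve 7 (λ m q₁ q₂ q₃ q₄ t s →
          m :+ q₁ :* horner y-poly t :+ q₂ :* (s :* t) :+ q₃ :* (con (+ 2) :- t :* t) :+ q₄ :* (s :* (horner y-poly t :* t))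
          := hornerForms fs m q₁ q₂ q₃ q₄ t :+ s :* hornerForms gs m q₁ q₂ q₃ q₄ t)
          refl (fromℤ m) (fromℤ q₁) (fromℤ q₂) (fromℤ q₃) (fromℤ q₄) θ √3))) eq
      zeros : ∀ i → i ℕ.< 10 → coeff (map form fs) i ≡ + 0
      zeros i i<10 = proj₁ (independent₂-evalℤ independent₂ (map form fs) (map form gs) (ℕ.n≤1+n 9) ℕ.≤-refl
        (trans (+-cong (evalℤ-forms fs θ) (*-congˡ (evalℤ-forms gs θ))) relation) i i<10)

    minimalPolynomial : IsMinimalPolynomial (poly f) (baseElement α)
    minimalPolynomial = minimal ≡.refl ≡.refl (poly-root f quintic) independent-y

    module A = Powers {10} {θ} (span-resp (sym decic) (span-evalℤ θ¹⁰-poly (ℕ.n≤1+n 9))) (s≤s z≤n)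

    -- The algebra is ℚ(θ) + √3ℚ(θ); independence of the powers of θ over ℤ[√3] shows that nothing
    -- collapses in it.
    degree : [ coordinateField (p α) :ℚ]≡ 20
    degree = coordinate-basis α (adjoin-isSubalgebra A.isSubalgebra (IsSubalgebra.A-resp A.isSubalgebra (sym √3*√3≈3) (A-fromℤ A.isSubalgebra (+ 3))))
      adjoin⊆span (adjoin-root A.isSubalgebra)
      (adjoin-A A.isSubalgebra (span-resp (sym y≈) (A-evalℤ A.isSubalgebra y-poly A.t∈)))
      (adjoin-A A.isSubalgebra A.t∈) (λ i _ → basis∈K i) (independent-doubled independent₂)
      where
      basis∈K : ∀ i → doubled 10 √3 (θ ^_) i ∈ coordinateField (p α)
      basis∈K i with i ℕ.<? 10
      ... | yes _ = ^∈ i (Θ∈K α)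
      ... | no  _ = mul (√3∈K α) (^∈ (i ℕ.∸ 10) (Θ∈K α))

    exotic : Exotic (coordinateField (p α))
    exotic = 20 , degree , 5 , from-yes (prime? 5) , ℕ.≤-refl , ℕ.divides-refl 4

    cos∈K : ℚ⟨ cos α ⟩₁ ⊆ coordinateField (p α)
    cos∈K = field-⊆ λ x≈ → resp (sym x≈) (divide∈ 1 (Y∈K α))

    private
      module B = Powers {5} {y} (span-resp (sym (modulo {k = fromℕ 1} quintic
          (solve 1 (λ y → y :^ 5 := horner (-[1+ 0 ] ∷ -[1+ 2 ] ∷ + 3 ∷ + 4 ∷ -[1+ 0 ] ∷ []) y :+ con (+ 1) :* horner f y) refl y)))
        (span-evalℤ (-[1+ 0 ] ∷ -[1+ 2 ] ∷ + 3 ∷ + 4 ∷ -[1+ 0 ] ∷ []) ℕ.≤-refl)) (s≤s z≤n)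

    degree-cos : [ ℚ⟨ cos α ⟩₁ :ℚ]≡ 5
    degree-cos = basis (λ i _ → ^∈ i (mul (fromℕ∈ 2) (gen refl))) independent-y
      (field⊆subalgebra B.isSubalgebra (λ a → a) λ x≈ → span-resp (sym x≈) (A-divide B.isSubalgebra 1 B.t∈))

theorem1 : ∀ {c ℓ₁ ℓ₂} (ℛ : RealNumbers c ℓ₁ ℓ₂) (𝒯 : Trigonometry ℛ) →
    let open Realizations 𝒯 in
    (∃[ p ] IsFaithful (H 3 3) p
    × IsMinkowski (45 °) p
    × coordinateField p ≐ ℚ⟨√2,√3⟩
    × [ coordinateField p :ℚ]≡ 4
    × RulerAndCompass (coordinateField p)
    × IsMinimalPolynomial (poly (-[1+ 1 ] ∷ + 0 ∷ + 1 ∷ []))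
    (baseElement (45 °)))
    × (∃[ p ] IsFaithful (H 3 3) p
    × IsMinkowski (20 °) p
    × coordinateField p ≐ ℚ⟨ sin (20 °) ⟩₁
    × [ coordinateField p :ℚ]≡ 6
    × StrictlyOrigami (coordinateField p)
    × IsMinimalPolynomial (poly (-[1+ 0 ] ∷ -[1+ 2 ] ∷ + 0 ∷ + 1 ∷ []))
    (baseElement (20 °)))
    × (∃[ p ] IsFaithful (H 3 3) p
    × IsMinkowski ((+ 2 / 11) · π) p
    × Exotic (coordinateField p)
    × ℚ⟨ cos ((+ 2 / 11) · π) ⟩₁ ⊆ coordinateField p
    × [ ℚ⟨ cos ((+ 2 / 11) · π) ⟩₁ :ℚ]≡ 5
    × IsMinimalPolynomial
    (poly (+ 1 ∷ + 3 ∷ -[1+ 2 ] ∷ -[1+ 3 ] ∷ + 1 ∷ + 1 ∷ []))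
    (baseElement ((+ 2 / 11) · π)))
theorem1 ℛ 𝒯 =
    ( minkowski R (45 °) , faithful (45 °) Ruler-and-compass.separated , isMinkowski (45 °)
    , Ruler-and-compass.coordinateField≐ , Ruler-and-compass.degree , (2 , Ruler-and-compass.degree)
    , Ruler-and-compass.minimalPolynomial )
  , ( minkowski R (20 °) , faithful (20 °) Origami.separated , isMinkowski (20 °)
    , Origami.coordinateField≐ , Origami.degree , (1 , 1 , s≤s z≤n , Origami.degree)
    , Origami.minimalPolynomial )
  , ( minkowski R α₁₁ , faithful α₁₁ Hendecagon.separated , isMinkowski α₁₁
    , Hendecagon.exotic , Hendecagon.cos∈K , Hendecagon.degree-cos
    , Hendecagon.minimalPolynomial )
  where
  open Realizations 𝒯 using (minkowski; _°)
  open SpecialAngles 𝒯 using (α₁₁)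
  open Geometry 𝒯 using (R; faithful; isMinkowski)
  open Cases 𝒯
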